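{- For every $\epsilon \in [0, \frac{1}{4}]$, every $n$-node unweighted undirected graph $G = (V,E)$ has a subgraph $H$ on the same vertex set $V$ with $\tilde{O}(n^{1+\epsilon})$ edges such that for all $u,v \in V$, $$\delta_G(u,v) \le \delta_H(u,v) \le \delta_G(u,v) + \tilde{O}(n^{2/3 - 5\epsilon/3}),$$ where the hidden polylogarithmic factors and constants do not depend on $G$.
   Context: All graphs are undirected and unweighted with $n$ nodes. $\delta_G(u,v)$ denotes the shortest-path distance between $u$ and $v$ in $G$. The notation $\tilde{O}(g(n))$ means $O(g(n)\cdot \mathrm{polylog}\, n)$. -}

module Defs where

open import Level using (0ℓ)
open import Data.Fin using (Fin; toℕ)
open import Data.Fin.Properties as Fin using (pigeonhole; any?)
open import Data.Integer using (ℤ; +_; -[1+_])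
open import Data.List using (List; length; filter; cartesianProduct; allFin)
open import Data.Maybe using (map)
open import Data.Nat as ℕ using (ℕ; zero; suc; s≤s)
import Data.Nat.Properties as ℕ
open import Data.Nat.Induction using (<-wellFounded)
open import Data.Nat.Logarithm using (⌊log₂_⌋)
open import Data.Product using (∃; ∃-syntax; _×_; _,_; proj₁; proj₂)
open import Data.Rational using (ℚ; 0ℚ; 1ℚ; ½; _+_; _*_; _-_; -_; ∣_∣; _≤_; _<_; 1/_; ↥_; ↧ₙ_; NonZero; NonNegative; Positive; positive)
import Data.Rational.Properties as ℚ
open import Data.Rational.Solver using (module +-*-Solver)
open import Data.Sum using (_⊎_; inj₁; inj₂)
open import Induction.WellFounded using (Acc; acc)
open import Relation.Binary using (Rel; Symmetric; Irreflexive; Decidable)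
open import Relation.Binary.PropositionalEquality using (_≡_; refl; sym; trans; cong; subst)
open import Relation.Nullary using (¬_; Dec; yes; no)
open import Relation.Nullary.Decidable using (_×-dec_; map′)
open import Relation.Nullary.Construct.Add.Supremum using (_⁺; [_]; ⊤⁺)
open import Relation.Binary.Construct.Add.Supremum.NonStrict ℕ._≤_ public using (_≤⁺_)

-- Real numbers, as Cauchy sequences of rationals.

record ℝ : Set where
  field
    approx : ℕ → ℚ
    cauchy : ∀ e → 0ℚ < e → ∃[ N ] ∀ i j → N ℕ.≤ i → N ℕ.≤ j →
             ∣ approx i - approx j ∣ ≤ e

open ℝ public

infix 4 _≤ʳ_ _<ʳ_

_≤ʳ_ : Rel ℝ 0ℓ
x ≤ʳ y = ∀ e → 0ℚ < e → ∃[ N ] ∀ i → N ℕ.≤ i → approx x i ≤ approx y i + e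

_<ʳ_ : Rel ℝ 0ℓ
x <ʳ y = ∃[ e ] 0ℚ < e × ∃[ N ] ∀ i → N ℕ.≤ i → approx x i + e ≤ approx y i

fromℚ : ℚ → ℝ
fromℚ q .approx _ = q
fromℚ q .cauchy e 0<e = 0 , λ _ _ _ _ →
  subst (λ z → ∣ z ∣ ≤ e) (sym (ℚ.+-inverseʳ q)) (ℚ.<⇒≤ 0<e)

infixl 6 _+ʳ_ _-ʳ_
infixl 7 _·ʳ_

_+ʳ_ : ℝ → ℝ → ℝ
(x +ʳ y) .approx i = approx x i + approx y i
(x +ʳ y) .cauchy e 0<e = Nx ℕ.⊔ Ny , bound
  where
  open ℚ.≤-Reasoning
  half : ℚ
  half = ½ * e
  0<half : 0ℚ < half
  0<half = ℚ.positive⁻¹ half {{ℚ.pos*pos⇒pos ½ e {{positive 0<e}}}}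
  Nx Ny : ℕ
  Nx = proj₁ (cauchy x half 0<half)
  Ny = proj₁ (cauchy y half 0<half)
  interchange : ∀ a b c d → (a + b) - (c + d) ≡ (a - c) + (b - d)
  interchange = solve 4 (λ a b c d → (a :+ b) :- (c :+ d) := (a :- c) :+ (b :- d)) refl
    where open +-*-Solver
  halves : half + half ≡ e
  halves = trans (sym (ℚ.*-distribʳ-+ e ½ ½)) (ℚ.*-identityˡ e)
  bound : ∀ i j → Nx ℕ.⊔ Ny ℕ.≤ i → Nx ℕ.⊔ Ny ℕ.≤ j →
          ∣ (approx x i + approx y i) - (approx x j + approx y j) ∣ ≤ e
  bound i j N≤i N≤j = begin
    ∣ (approx x i + approx y i) - (approx x j + approx y j) ∣
      ≡⟨ cong ∣_∣ (interchange (approx x i) (approx y i) (approx x j) (approx y j)) ⟩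
    ∣ (approx x i - approx x j) + (approx y i - approx y j) ∣
      ≤⟨ ℚ.∣p+q∣≤∣p∣+∣q∣ (approx x i - approx x j) (approx y i - approx y j) ⟩
    ∣ approx x i - approx x j ∣ + ∣ approx y i - approx y j ∣
      ≤⟨ ℚ.+-mono-≤
           (proj₂ (cauchy x half 0<half) i j (ℕ.m⊔n≤o⇒m≤o Nx Ny N≤i) (ℕ.m⊔n≤o⇒m≤o Nx Ny N≤j))
           (proj₂ (cauchy y half 0<half) i j (ℕ.m⊔n≤o⇒n≤o Nx Ny N≤i) (ℕ.m⊔n≤o⇒n≤o Nx Ny N≤j)) ⟩
    half + half
      ≡⟨ halves ⟩
    e ∎

_·ʳ_ : ℚ → ℝ → ℝ
(q ·ʳ x) .approx i = q * approx x i
(q ·ʳ x) .cauchy e 0<e = proj₁ (cauchy x e′ 0<e′) , bound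
  where
  open ℚ.≤-Reasoning
  s : ℚ
  s = 1ℚ + ∣ q ∣
  instance
    ∣q∣≥0 : NonNegative ∣ q ∣
    ∣q∣≥0 = ℚ.∣-∣-nonNeg q
    s>0 : Positive s
    s>0 = ℚ.pos+nonNeg⇒pos 1ℚ ∣ q ∣
    s≢0 : NonZero s
    s≢0 = ℚ.pos⇒nonZero s
    e>0 : Positive e
    e>0 = positive 0<e
  e′ : ℚ
  e′ = 1/ s * e
  instance
    e′>0 : Positive e′
    e′>0 = ℚ.pos*pos⇒pos (1/ s) {{ℚ.1/pos⇒pos s}} e
  0<e′ : 0ℚ < e′
  0<e′ = ℚ.positive⁻¹ e′
  ∣q∣≤s : ∣ q ∣ ≤ s
  ∣q∣≤s = subst (_≤ s) (ℚ.+-identityˡ ∣ q ∣) (ℚ.+-monoˡ-≤ ∣ q ∣ (ℚ.nonNegative⁻¹ 1ℚ))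
  factor : ∀ a b → q * a - q * b ≡ q * (a - b)
  factor = solve 3 (λ q a b → q :* a :- q :* b := q :* (a :- b)) refl q
    where open +-*-Solver
  bound : ∀ i j → proj₁ (cauchy x e′ 0<e′) ℕ.≤ i → proj₁ (cauchy x e′ 0<e′) ℕ.≤ j →
          ∣ q * approx x i - q * approx x j ∣ ≤ e
  bound i j N≤i N≤j = begin
    ∣ q * approx x i - q * approx x j ∣   ≡⟨ cong ∣_∣ (factor (approx x i) (approx x j)) ⟩
    ∣ q * (approx x i - approx x j) ∣     ≡⟨ ℚ.∣p*q∣≡∣p∣*∣q∣ q (approx x i - approx x j) ⟩
    ∣ q ∣ * ∣ approx x i - approx x j ∣   ≤⟨ ℚ.*-monoˡ-≤-nonNeg ∣ q ∣ (proj₂ (cauchy x e′ 0<e′) i j N≤i N≤j) ⟩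
    ∣ q ∣ * e′                            ≤⟨ ℚ.*-monoʳ-≤-nonNeg e′ {{ℚ.pos⇒nonNeg e′}} ∣q∣≤s ⟩
    s * (1/ s * e)                        ≡⟨ sym (ℚ.*-assoc s (1/ s) e) ⟩
    s * 1/ s * e                          ≡⟨ cong (_* e) (ℚ.*-inverseʳ s) ⟩
    1ℚ * e                                ≡⟨ ℚ.*-identityˡ e ⟩
    e                                     ∎

_-ʳ_ : ℝ → ℝ → ℝ
x -ʳ y = x +ʳ ((- 1ℚ) ·ʳ y)

-- Comparison with powers.  For r = p/q with q > 0 and n ≥ 1, the inequality
-- m ≤ c · n^(p/q) is m^q ≤ c^q · n^p, with n^p moved to the left when p < 0.

[_≤_·_^ℤ_/_] : ℕ → ℕ → ℕ → ℤ → ℕ → Set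
[ m ≤ c · n ^ℤ + p      / q ] = m ℕ.^ q ℕ.≤ c ℕ.^ q ℕ.* n ℕ.^ p
[ m ≤ c · n ^ℤ -[1+ p ] / q ] = m ℕ.^ q ℕ.* n ℕ.^ suc p ℕ.≤ c ℕ.^ q

[_≤_·_^ℚ_] : ℕ → ℕ → ℕ → ℚ → Set
[ m ≤ c · n ^ℚ r ] = [ m ≤ c · n ^ℤ ↥ r / ↧ₙ r ]

-- For n ≥ 1 and real α, n^α is the infimum of n^r over rational r > α, so
-- m ≤ c · n^α holds iff m ≤ c · n^r for every such r.

[_≤_·_^ʳ_] : ℕ → ℕ → ℕ → ℝ → Set
[ m ≤ c · n ^ʳ α ] = ∀ r → α <ʳ fromℚ r → [ m ≤ c · n ^ℚ r ]

-- f ∈Õ[n^ α ] means f(n) = O(n^α · polylog n).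

_∈Õ[n^_] : (ℕ → ℕ) → ℝ → Set
f ∈Õ[n^ α ] = ∃[ C ] ∃[ k ] ∃[ n₀ ] ∀ n → 1 ℕ.≤ n → n₀ ℕ.≤ n →
  [ f n ≤ C ℕ.* ⌊log₂ n ⌋ ℕ.^ k · n ^ʳ α ]

-- Adjacency is decidable, as is automatic classically; this is what makes the
-- edge count and distances total functions.

record Graph (n : ℕ) : Set₁ where
  infix 4 _~_ _~?_
  field
    _~_      : Rel (Fin n) 0ℓ
    _~?_     : Decidable _~_
    ~-sym    : Symmetric _~_
    ~-irrefl : Irreflexive _≡_ _~_

  -- Each edge {i , j} is listed once, as the pair with i < j.
  edges : List (Fin n × Fin n)
  edges = filter (λ (i , j) → (i Fin.<? j) ×-dec (i ~? j))
                 (cartesianProduct (allFin n) (allFin n))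

  ∣E∣ : ℕ
  ∣E∣ = length edges

  infixr 5 _∷_
  data Walk : Fin n → Fin n → ℕ → Set where
    []  : ∀ {u} → Walk u u 0
    _∷_ : ∀ {u w v d} → u ~ w → Walk w v d → Walk u v (suc d)

  IsDistance : Fin n → Fin n → ℕ ⁺ → Set
  IsDistance u v [ d ] = Walk u v d × (∀ {d′} → Walk u v d′ → d ℕ.≤ d′)
  IsDistance u v ⊤⁺    = ∀ {d} → ¬ Walk u v d

  walk? : ∀ d u v → Dec (Walk u v d)
  walk? zero    u v = map′ (λ { refl → [] }) (λ { [] → refl }) (u Fin.≟ v)
  walk? (suc d) u v = map′ (λ (_ , e , p) → e ∷ p) (λ { (e ∷ p) → _ , e , p })
                           (any? λ w → (u ~? w) ×-dec walk? d w v)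

  private
    vertex : ∀ {u v d} → Walk u v d → Fin (suc d) → Fin n
    vertex {u} p       Fin.zero    = u
    vertex     (e ∷ p) (Fin.suc i) = vertex p i

    prefix : ∀ {u v d} (p : Walk u v d) i → Walk u (vertex p i) (toℕ i)
    prefix p       Fin.zero    = []
    prefix (e ∷ p) (Fin.suc i) = e ∷ prefix p i

    suffix : ∀ {u v d} (p : Walk u v d) i → Walk (vertex p i) v (d ℕ.∸ toℕ i)
    suffix p       Fin.zero    = p
    suffix (e ∷ p) (Fin.suc i) = suffix p i

    _++_ : ∀ {u w v c d} → Walk u w c → Walk w v d → Walk u v (c ℕ.+ d)
    []      ++ q = q
    (e ∷ p) ++ q = e ∷ (p ++ q)

    shortcut : ∀ {u v d} → Walk u v d → n ℕ.≤ d → ∃[ d′ ] d′ ℕ.< d × Walk u v d′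
    shortcut {v = v} {d} p n≤d with i , j , i<j , pᵢ≡pⱼ ← pigeonhole (s≤s n≤d) (vertex p) =
      toℕ i ℕ.+ (d ℕ.∸ toℕ j) , shorter ,
      prefix p i ++ subst (λ w → Walk w v (d ℕ.∸ toℕ j)) (sym pᵢ≡pⱼ) (suffix p j)
      where
      shorter : toℕ i ℕ.+ (d ℕ.∸ toℕ j) ℕ.< d
      shorter = ℕ.<-≤-trans (ℕ.+-monoˡ-< (d ℕ.∸ toℕ j) i<j)
                  (ℕ.≤-reflexive (ℕ.m+[n∸m]≡n (Fin.toℕ≤pred[n] j)))

    short : ∀ {u v d} → Acc ℕ._<_ d → Walk u v d → ∃[ d′ ] d′ ℕ.< n × Walk u v d′
    short {d = d} (acc rs) p with d ℕ.<? n
    ... | yes d<n = d , d<n , p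
    ... | no  d≮n with d′ , d′<d , q ← shortcut p (ℕ.≮⇒≥ d≮n) = short (rs d′<d) q

    search : ∀ u v b → (∃[ d ] IsDistance u v [ d ]) ⊎ (∀ {d} → d ℕ.< b → ¬ Walk u v d)
    search u v zero = inj₂ λ ()
    search u v (suc b) with search u v b
    ... | inj₁ found = inj₁ found
    ... | inj₂ none with walk? b u v
    ...   | yes p = inj₁ (b , p , λ q → ℕ.≮⇒≥ λ d′<b → none d′<b q)
    ...   | no ¬p = inj₂ λ d<1+b q → case d<1+b q
      where
      case : ∀ {d} → d ℕ.< suc b → ¬ Walk u v d
      case (s≤s d≤b) q with ℕ.m≤n⇒m<n∨m≡n d≤b
      ... | inj₁ d<b  = none d<b q
      ... | inj₂ refl = ¬p q

  distance : ∀ u v → ∃ (IsDistance u v)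
  distance u v with search u v n
  ... | inj₁ (d , isd) = [ d ] , isd
  ... | inj₂ none      = ⊤⁺ , λ p →
    let d′ , d′<n , q = short (<-wellFounded _) p in none d′<n q

  -- The shortest-path distance, ⊤⁺ (infinity) between different components.
  δ : Fin n → Fin n → ℕ ⁺
  δ u v = proj₁ (distance u v)

open Graph public using (∣E∣; δ)

_⊆ᴳ_ : ∀ {n} → Graph n → Graph n → Set
H ⊆ᴳ G = ∀ u v → Graph._~_ H u v → Graph._~_ G u v

infixl 6 _+⁺_

_+⁺_ : ℕ ⁺ → ℕ → ℕ ⁺
x +⁺ k = map (ℕ._+ k) x

{-# OPTIONS --safe #-}
-- Write M = n ^ ε and D for the allowed error, so that D³ M⁵ = n².  A strip is a
-- geodesic of length at most Λ with at least m vertices that have M neighbours not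
-- yet adjacent to a strip; it is added and owns its newly covered neighbours.  Any
-- walk may be routed so that it uses each strip once, with excess 4, and all other
-- missing edges are patched with a sparse subgraph of logarithmic stretch.  Hence the
-- error of a path is governed by the number of strips it meets and by the at most m
-- uncovered heavy vertices on each of its stretches of length Λ.
--
-- If M ≤ n ^ (1/7), take Λ = n and m = D: only n / (D M) ≤ D strips exist, and as
-- geodesics may be rerouted along old strips they cost n + (number of strips)² edges.
-- If M ≥ n ^ (1/7), take Λ = D and m = n / (M³ D).  A path whose 2Λ-neighbourhood has
-- fewer than n / M² vertices meets at most n / (M³ m) = D strips and has length at most
-- n / M², so at most n m / (M² D) ≤ D heavy vertices.  For the other paths, a hitting
-- set of about M² vertices meets every neighbourhood of size n / M²; buying paths
-- between its members costs about n M edges and reduces to the thin end pieces.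
module Submission where

open import Defs
open import Data.Bool using (Bool; if_then_else_; true; false; _∧_; _∨_; not)
import Data.Bool.Properties as Bool
open import Data.Empty using (⊥; ⊥-elim)
open import Data.Fin using (Fin; zero; suc; toℕ)
open import Data.Fin.Properties as Fin using (any?; all?)
open import Data.Integer using (-[1+_])
import Data.Integer as ℤ
import Data.Integer.Properties as ℤ
open import Data.List using (List; []; _∷_; _++_; length; filter; cartesianProduct; allFin; map; lookup; take; drop; upTo)
import Data.List.Properties as List
open import Data.List.Membership.Propositional using (_∈_; find; lose)
open import Data.List.Membership.Propositional.Properties using (∈-++⁺ˡ; ∈-++⁺ʳ; ∈-++⁻; ∈-map⁺; ∈-allFin; ∈-filter⁺; ∈-filter⁻; ∈-lookup; ∈-∃++; ∈-cartesianProduct⁺; ∈-upTo⁺)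
import Data.List.Relation.Unary.All as All
open import Data.List.Relation.Unary.Any using (here; there)
import Data.List.Relation.Unary.Any as Any
open import Data.List.Relation.Unary.AllPairs using ([]; _∷_)
open import Data.List.Relation.Unary.Unique.Propositional using (Unique)
import Data.List.Relation.Unary.Unique.Propositional.Properties as Unique
open import Data.Maybe using (Maybe; just; nothing)
import Data.Maybe as Maybe
import Data.Maybe.Properties as Maybe
open import Data.Nat using (ℕ; zero; suc; _+_; _*_; _∸_; _^_; _≤_; _<_; _⊔_; _≤′_; ≤′-refl; ≤′-step; z≤n; s≤s; _≤?_; NonZero; >-nonZero)
open import Data.Nat.Properties hiding (_≟_; ≡-irrelevant)
open import Data.Nat.DivMod using (m≡m%n+[m/n]*n; m%n<n; m/n*n≤m)
import Data.Nat.Base as ℕ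
open import Data.Nat.Base using (⌊_/2⌋; ⌈_/2⌉)
open import Data.Nat.Induction using (<-rec)
open import Data.Nat.Logarithm using (⌊log₂_⌋; ⌊log₂⌋-mono-≤; ⌊log₂⌊n/2⌋⌋≡⌊log₂n⌋∸1; ⌊log₂[2^n]⌋≡n)
open import Data.Nat.Tactic.RingSolver using (solve-∀)
open import Data.Product using (∃; ∃-syntax; Σ-syntax; _×_; _,_; proj₁; proj₂)
open import Data.Rational using (ℚ; 0ℚ; 1ℚ; _/_)
import Data.Rational as ℚ
import Data.Rational.Properties as ℚ
import Data.Rational.Solver as ℚ
import Data.Rational.Unnormalised as ℚᵘ
import Data.Rational.Unnormalised.Properties as ℚᵘ
open import Data.Sum using (_⊎_; inj₁; inj₂; [_,_]′)
open import Function using (_∘_; case_of_)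
open import Relation.Binary.PropositionalEquality using (_≡_; refl; sym; trans; cong; cong₂; subst; subst₂; module ≡-Reasoning)
open import Relation.Nullary using (¬_; Dec; yes; no; does; contradiction)
open import Relation.Nullary.Decidable using (_×-dec_; _⊎-dec_; _→-dec_; dec-true; dec-false)
open import Relation.Nullary.Construct.Add.Supremum using (⊤⁺) renaming ([_] to ⟨_⟩)
open import Algebra.Properties.Semiring.Sum +-*-semiring using (sum; ∑-distrib-+; ∑-comm; sum-cong-≗; *-distribˡ-sum)
open import Relation.Binary.PropositionalEquality.WithK using (≡-irrelevant)
open import Data.List.Relation.Unary.Any.Properties using (lookup-index)
import Data.Product.Properties as Product
open import Relation.Binary.Construct.Add.Supremum.NonStrict _≤_ using ([_]; _≤⊤⁺)

-- Counting

-- The value of `D` comes from the walks with a small neighbourhood: `n / (M² D)` stretches with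
-- `m = n / (M³ D)` heavy vertices each contribute at most `D` exactly when `n² ≤ D³ M⁵`. This `m`
-- is at least 1 iff `M⁴ ≤ n`, which is the range of `ε`. The threshold `n ^ (1/7)` is the point
-- where `M D² = n`. Above it, the `M² D` strips of length `D` cost `M² D² ≤ n M` edges. Below it,
-- the number `n / (M D)` of strips is at most `D`, so its square is at most `n / M`. Path buying
-- costs `n M` because there are about `n / M` stars and `M²` vertices in the hitting set, and every
-- bought edge is paid for by such a pair. All parameters are powers of two, so these inequalities
-- become linear in the exponents `N`, `K`, `e`, and rounding costs constant factors only. For each
-- `n` the construction consults `ε` through a single rational approximation, precise enough to
-- change `n ^ ε` by at most a constant factor.

bit : Bool → ℕ
bit true  = 1
bit false = 0

bit≤1 : ∀ b → bit b ≤ 1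
bit≤1 true  = ≤-refl
bit≤1 false = z≤n

bit-mono : ∀ {a b} → (a ≡ true → b ≡ true) → bit a ≤ bit b
bit-mono {false} _ = z≤n
bit-mono {true}  f rewrite f refl = ≤-refl

true≢false : ∀ {b} → b ≡ true → b ≡ false → ⊥
true≢false refl ()

true⊎false : ∀ b → b ≡ true ⊎ b ≡ false
true⊎false true  = inj₁ refl
true⊎false false = inj₂ refl

dec-true⁻ : ∀ {a} {A : Set a} (a? : Dec A) → does a? ≡ true → A
dec-true⁻ (yes a) _ = a

dec-false⁻ : ∀ {a} {A : Set a} (a? : Dec A) → does a? ≡ false → ¬ A
dec-false⁻ (no ¬a) _ = ¬a

∧-true : ∀ {a b} → a ≡ true → b ≡ true → a ∧ b ≡ true
∧-true refl refl = refl

∧-true⁻ : ∀ {a b} → a ∧ b ≡ true → a ≡ true × b ≡ true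
∧-true⁻ {true} p = refl , p

∨-true⁻ : ∀ {a b} → a ∨ b ≡ true → a ≡ true ⊎ b ≡ true
∨-true⁻ {true}  _ = inj₁ refl
∨-true⁻ {false} p = inj₂ p

∨-trueʳ : ∀ a {b} → b ≡ true → a ∨ b ≡ true
∨-trueʳ true  _ = refl
∨-trueʳ false p = p

∨-trueˡ : ∀ {a b} → a ≡ true → a ∨ b ≡ true
∨-trueˡ refl = refl

sum-mono : ∀ {n} {f g : Fin n → ℕ} → (∀ i → f i ≤ g i) → sum f ≤ sum g
sum-mono {zero}  _   = z≤n
sum-mono {suc n} f≤g = +-mono-≤ (f≤g zero) (sum-mono (f≤g ∘ suc))

sum-mono-< : ∀ {n} {f g : Fin n → ℕ} → (∀ i → f i ≤ g i) → ∀ x → f x < g x → sum f < sum g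
sum-mono-< f≤g zero    fx<gx = +-mono-<-≤ fx<gx (sum-mono (f≤g ∘ suc))
sum-mono-< f≤g (suc x) fx<gx = +-mono-≤-< (f≤g zero) (sum-mono-< (f≤g ∘ suc) x fx<gx)

sum-const : ∀ n c → sum {n} (λ _ → c) ≡ n * c
sum-const zero    c = refl
sum-const (suc n) c = cong (c +_) (sum-const n c)

card : ∀ {n} → (Fin n → Bool) → ℕ
card P = sum (λ i → bit (P i))

infix 4 _⊆_
_⊆_ : ∀ {a} {A : Set a} → (A → Bool) → (A → Bool) → Set a
P ⊆ Q = ∀ x → P x ≡ true → Q x ≡ true

infixl 6 _∖_
_∖_ : ∀ {a} {A : Set a} → (A → Bool) → (A → Bool) → A → Bool
(Q ∖ P) x = Q x ∧ not (P x)

∖-true : ∀ {a} {A : Set a} {P Q : A → Bool} {x} → Q x ≡ true → P x ≡ false → (Q ∖ P) x ≡ true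
∖-true Qx ¬Px rewrite Qx | ¬Px = refl

∖-true⁻ : ∀ {a} {A : Set a} {P Q : A → Bool} {x} → (Q ∖ P) x ≡ true → Q x ≡ true × P x ≡ false
∖-true⁻ {P = P} {Q} {x} p with Q x | P x
∖-true⁻ refl | true | false = refl , refl

card-mono : ∀ {n} {P Q : Fin n → Bool} → P ⊆ Q → card P ≤ card Q
card-mono P⊆Q = sum-mono (λ i → bit-mono (P⊆Q i))

card-mono-< : ∀ {n} {P Q : Fin n → Bool} → P ⊆ Q → ∀ x → P x ≡ false → Q x ≡ true → card P < card Q
card-mono-< {P = P} {Q} P⊆Q x ¬Px Qx = sum-mono-< (λ i → bit-mono (P⊆Q i)) x bit<
  where
  bit< : bit (P x) < bit (Q x)
  bit< rewrite ¬Px | Qx = ≤-refl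

card≤n : ∀ {n} (P : Fin n → Bool) → card P ≤ n
card≤n {n} P = ≤-trans (sum-mono (λ i → bit≤1 (P i))) (≤-reflexive (trans (sum-const n 1) (*-identityʳ n)))

card-∖ : ∀ {n} {P Q : Fin n → Bool} → P ⊆ Q → card P + card (Q ∖ P) ≡ card Q
card-∖ {P = P} {Q} P⊆Q = trans (sym (∑-distrib-+ (bit ∘ P) (bit ∘ (Q ∖ P)))) (sum-cong-≗ split)
  where
  split : ∀ i → bit (P i) + bit (Q i ∧ not (P i)) ≡ bit (Q i)
  split i with P i in eq | Q i in eq′
  ... | true  | true  = refl
  ... | true  | false = ⊥-elim (true≢false (P⊆Q i eq) eq′)
  ... | false | true  = refl
  ... | false | false = refl

card-empty : ∀ {n} {P : Fin n → Bool} → (∀ i → P i ≡ true → ⊥) → card P ≡ 0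
card-empty {zero}      _ = refl
card-empty {suc n} {P} ¬P with P zero in eq
... | true  = ⊥-elim (¬P zero eq)
... | false = card-empty (¬P ∘ suc)

card-single : ∀ {n} {P : Fin n → Bool} → (∀ i j → P i ≡ true → P j ≡ true → i ≡ j) → card P ≤ 1
card-single {zero}      _ = z≤n
card-single {suc n} {P} !P with P zero in eq
... | true  = s≤s (≤-reflexive (card-empty λ i Pi → case !P zero (suc i) eq Pi of λ ()))
... | false = card-single (λ i j Pi Pj → Fin.suc-injective (!P (suc i) (suc j) Pi Pj))

card-bounded : ∀ {n} {P : Fin n → Bool} c b → (∀ i → P i ≡ true → b ≡ true) → card P ≤ c → card P ≤ c * bit b
card-bounded c true  _  P≤c = ≤-trans P≤c (≤-reflexive (sym (*-identityʳ c)))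
card-bounded c false ¬P _   = ≤-trans (≤-reflexive (card-empty λ i Pi → case ¬P i Pi of λ ())) z≤n

-- The pairs with `A i ∧ R i y` are summed by rows and by columns; only columns in `Q` contribute.
double-count : ∀ {k n} (A : Fin k → Bool) (R : Fin k → Fin n → Bool) (Q : Fin n → Bool) c c′ →
  (∀ i → A i ≡ true → c ≤ card (R i)) →
  (∀ i y → A i ≡ true → R i y ≡ true → Q y ≡ true) →
  (∀ y → card (λ i → A i ∧ R i y) ≤ c′) →
  c * card A ≤ c′ * card Q
double-count A R Q c c′ lower R⊆Q upper = begin
  c * card A                                ≡⟨ *-distribˡ-sum c (bit ∘ A) ⟩
  sum (λ i → c * bit (A i))                 ≤⟨ sum-mono row ⟩
  sum (λ i → card (λ y → A i ∧ R i y))      ≡⟨ ∑-comm (λ i y → bit (A i ∧ R i y)) ⟩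
  sum (λ y → card (λ i → A i ∧ R i y))      ≤⟨ sum-mono column ⟩
  sum (λ y → c′ * bit (Q y))                ≡⟨ *-distribˡ-sum c′ (bit ∘ Q) ⟨
  c′ * card Q                               ∎
  where
  open ≤-Reasoning
  row : ∀ i → c * bit (A i) ≤ card (λ y → A i ∧ R i y)
  row i with A i in eq
  ... | true  = ≤-trans (≤-reflexive (*-identityʳ c)) (lower i eq)
  ... | false = ≤-trans (≤-reflexive (*-zeroʳ c)) z≤n
  column : ∀ y → card (λ i → A i ∧ R i y) ≤ c′ * bit (Q y)
  column y = card-bounded c′ (Q y) (λ i p → let Ai , Riy = ∧-true⁻ p in R⊆Q i y Ai Riy) (upper y)

-- A cardinality over positions; it nevertheless unfolds along the list.
count : ∀ {A : Set} → (A → Bool) → List A → ℕ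
count P xs = card (λ i → P (lookup xs i))

count-++ : ∀ {A : Set} (P : A → Bool) xs ys → count P (xs ++ ys) ≡ count P xs + count P ys
count-++ P []       ys = refl
count-++ P (x ∷ xs) ys = trans (cong (bit (P x) +_) (count-++ P xs ys)) (sym (+-assoc (bit (P x)) _ _))

count-remove : ∀ {A : Set} (P : A → Bool) xs →
  count P xs + length (filter (λ x → P x Bool.≟ false) xs) ≡ length xs
count-remove P [] = refl
count-remove P (x ∷ xs) with P x
... | true  = cong suc (count-remove P xs)
... | false = trans (+-suc _ _) (cong suc (count-remove P xs))

-- The function may use the proof that `y` lies in `Q`; uniqueness of identity proofs makes the
-- listed value equal to `f y q` for every such proof.
collect : ∀ {n} {A : Set} (Q : Fin n → Bool) (f : ∀ y → Q y ≡ true → A) →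
  ∃[ xs ] length xs ≡ card Q × (∀ y q → f y q ∈ xs)
collect {zero}  Q f = [] , refl , λ ()
collect {suc n} Q f with xs , len , mem ← collect (Q ∘ suc) (f ∘ suc) | Q zero in eq
... | true  = f zero eq ∷ xs , cong suc len ,
  λ { zero q → here (cong (f zero) (≡-irrelevant q eq)) ; (suc y) q → there (mem y q) }
... | false = xs , len , λ { zero q → ⊥-elim (true≢false q eq) ; (suc y) q → mem y q }

sum≤max : ∀ {n} (f : Fin (suc n) → ℕ) → ∃[ v ] sum f ≤ suc n * f v
sum≤max {zero}  f = zero , ≤-refl
sum≤max {suc n} f with v , le ← sum≤max (f ∘ suc) with f zero ≤? f (suc v)
... | yes p = suc v , +-mono-≤ p le
... | no ¬p = zero , +-monoʳ-≤ (f zero) (≤-trans le (*-monoʳ-≤ (suc n) (<⇒≤ (≰⇒> ¬p))))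

card-positive : ∀ {n} (P : Fin n → Bool) x → P x ≡ true → 1 ≤ card P
card-positive P x Px = ≤-trans (s≤s z≤n) (card-mono-< {P = λ _ → false} (λ _ ()) x refl Px)

count-bounded : ∀ {A : Set} (P : A → Bool) xs t →
  (∀ i → t ≤ toℕ i → P (lookup xs i) ≡ true → ⊥) → count P xs ≤ t
count-bounded P []       t       _  = z≤n
count-bounded P (x ∷ xs) zero    ¬P = ≤-reflexive (card-empty λ i → ¬P i z≤n)
count-bounded P (x ∷ xs) (suc t) ¬P = +-mono-≤ (bit≤1 _) (count-bounded P xs t (λ i t≤i → ¬P (suc i) (s≤s t≤i)))

-- Constructive substitute for excluded middle over vertices: either no pair admits a further strip,
-- or one such pair is produced.
finite-choice : ∀ {n} {A B : Fin n → Set} → (∀ i → A i ⊎ B i) → (∀ i → A i) ⊎ ∃ B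
finite-choice {zero}  f = inj₁ λ ()
finite-choice {suc n} f with f zero | finite-choice (f ∘ suc)
... | inj₂ b | _            = inj₂ (zero , b)
... | inj₁ _ | inj₂ (i , b) = inj₂ (suc i , b)
... | inj₁ a | inj₁ as      = inj₁ λ { zero → a ; (suc i) → as i }

-- Walks, geodesics and subgraphs given by lists of pairs

module Walks {n : ℕ} (G : Graph n) where
  open Graph G public using (_~_; _~?_; ~-sym; ~-irrefl; Walk; distance)
  open Graph public using ([]; _∷_)

  V : Set
  V = Fin n

  infixr 5 _⊕_
  _⊕_ : ∀ {u w v c d} → Walk u w c → Walk w v d → Walk u v (c + d)
  []      ⊕ q = q
  (e ∷ p) ⊕ q = e ∷ (p ⊕ q)

  reverse : ∀ {u v d} → Walk u v d → Walk v u d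
  reverse []                    = []
  reverse {v = v} {suc d} (_∷_ {u} e p) =
    subst (Walk v u) (+-comm d 1) (reverse p ⊕ (~-sym e ∷ []))

  later : ∀ {u v d} → Walk u v d → List V
  later []                = []
  later (_∷_ {w = w} e p) = w ∷ later p

  vertices : ∀ {u v d} → Walk u v d → List V
  vertices {u} p = u ∷ later p

  later-⊕ : ∀ {u w v c d} (p : Walk u w c) (q : Walk w v d) → later (p ⊕ q) ≡ later p ++ later q
  later-⊕ []      q = refl
  later-⊕ (e ∷ p) q = cong (_ ∷_) (later-⊕ p q)

  length-later : ∀ {u v d} (p : Walk u v d) → length (later p) ≡ d
  length-later []      = refl
  length-later (e ∷ p) = cong suc (length-later p)

  Geodesic : V → V → ℕ → Set
  Geodesic u v d = ∀ {d′} → Walk u v d′ → d ≤ d′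

  geodesic-prefix : ∀ {u w v a b} → Walk w v b → Geodesic u v (a + b) → Geodesic u w a
  geodesic-prefix {a = a} {b} q geo p = +-cancelʳ-≤ b a _ (geo (p ⊕ q))

  geodesic-suffix : ∀ {u w v a b} → Walk u w a → Geodesic u v (a + b) → Geodesic w v b
  geodesic-suffix {a = a} {b} p geo q = +-cancelˡ-≤ a b _ (geo (p ⊕ q))

  record Split {u v d} (p : Walk u v d) (x : V) (a : ℕ) : Set where
    constructor mkSplit
    field
      {b}    : ℕ
      front  : Walk u x a
      back   : Walk x v b
      total  : a + b ≡ d
      later≡ : later p ≡ later front ++ later back

    front-geodesic : Geodesic u v d → Geodesic u x a
    front-geodesic geo = geodesic-prefix back (subst (λ d → Geodesic u v d) (sym total) geo)

    back-geodesic : Geodesic u v d → Geodesic x v b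
    back-geodesic geo = geodesic-suffix front (subst (λ d → Geodesic u v d) (sym total) geo)

  split : ∀ {u v d} (p : Walk u v d) i → Split p (lookup (vertices p) i) (toℕ i)
  split p       zero    = mkSplit [] p refl refl
  split (e ∷ p) (suc i) with mkSplit f b t l ← split p i = mkSplit (e ∷ f) b (cong suc t) (cong (_ ∷_) l)

  split-∈ : ∀ {u v d x} (p : Walk u v d) → x ∈ vertices p → ∃[ a ] Split p x a
  split-∈ p x∈p = toℕ (Any.index x∈p) , subst (λ x → Split p x (toℕ (Any.index x∈p))) (sym (lookup-index x∈p)) (split p (Any.index x∈p))

  -- Counted from the first vertex in `P`, the vertex at position `i` of a geodesic is at distance
  -- `i`, so none beyond position `c` can lie in `P`. With `c = 2` this is the origin of every
  -- factor 3 below.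
  close-count : ∀ {u v d} (p : Walk u v d) → Geodesic u v d → ∀ (P : V → Bool) c →
    (∀ {x z} → P x ≡ true → P z ≡ true → ∃[ a ] a ≤ c × Walk x z a) →
    count P (vertices p) ≤ suc c
  close-count {u} p geo P c close with P u in Pu
  ... | true = s≤s (count-bounded P (later p) c far)
    where
    far : ∀ i → c ≤ toℕ i → P (lookup (later p) i) ≡ true → ⊥
    far i c≤i Pi with a , a≤c , q ← close Pu Pi =
      <⇒≱ (s≤s c≤i) (≤-trans (Split.front-geodesic (split p (suc i)) geo q) a≤c)
  close-count []      geo P c close | false = z≤n
  close-count (e ∷ p) geo P c close | false = close-count p (geodesic-suffix (e ∷ []) geo) P c close

  _∈ᵇ_ : V → List V → Bool
  x ∈ᵇ xs = does (Any.any? (x Fin.≟_) xs)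

  ∈ᵇ⁺ : ∀ {x xs} → x ∈ xs → x ∈ᵇ xs ≡ true
  ∈ᵇ⁺ {x} {xs} = dec-true (Any.any? (x Fin.≟_) xs)

  ∈ᵇ⁻ : ∀ {x xs} → x ∈ᵇ xs ≡ true → x ∈ xs
  ∈ᵇ⁻ {x} {xs} = dec-true⁻ (Any.any? (x Fin.≟_) xs)

  -- A geodesic does not repeat vertices.
  count≤card : ∀ {u v d} (p : Walk u v d) → Geodesic u v d → ∀ P (Q : V → Bool) →
    (∀ {x} → x ∈ vertices p → P x ≡ true → Q x ≡ true) → count P (vertices p) ≤ card Q
  count≤card p geo P Q P⊆Q =
    subst₂ _≤_ (*-identityˡ (count P (vertices p))) (*-identityˡ (card Q))
    (double-count (λ i → P (lookup (vertices p) i)) (λ i y → does (lookup (vertices p) i Fin.≟ y)) Q 1 1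
      (λ i _ → card-positive (λ y → does (lookup (vertices p) i Fin.≟ y)) _ (dec-true (lookup (vertices p) i Fin.≟ _) refl))
      (λ i y Pi i≡y → subst (λ y → Q y ≡ true) (dec-true⁻ (_ Fin.≟ _) i≡y) (P⊆Q (∈-lookup i) Pi))
      (λ y → close-count p geo (λ x → P x ∧ does (x Fin.≟ y)) 0 λ {x} {z} Px Pz →
        0 , z≤n , subst (λ z → Walk x z 0)
          (trans (dec-true⁻ (x Fin.≟ y) (proj₂ (∧-true⁻ {P x} Px)))
            (sym (dec-true⁻ (z Fin.≟ y) (proj₂ (∧-true⁻ {P z} Pz))))) []))

  Edges : Set
  Edges = List (V × V)

  Linked : Edges → V → V → Set
  Linked L u v = (u , v) ∈ L ⊎ (v , u) ∈ L

  linked? : ∀ L u v → Dec (Linked L u v)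
  linked? L u v = ((u , v) ∈? L) ⊎-dec ((v , u) ∈? L)
    where open import Data.List.Membership.DecPropositional (Product.≡-dec Fin._≟_ Fin._≟_) using (_∈?_)

  -- Intersecting with adjacency in `G` makes every list a subgraph, whatever the orientation or
  -- repetition of its pairs.
  Sub : Edges → Graph n
  Sub L = record
    { _~_      = λ u v → u ~ v × Linked L u v
    ; _~?_     = λ u v → (u ~? v) ×-dec linked? L u v
    ; ~-sym    = λ (e , l) → ~-sym e , [ inj₂ , inj₁ ]′ l
    ; ~-irrefl = λ u≡v (e , _) → ~-irrefl u≡v e
    }

  embed : ∀ {L u v d} → Graph.Walk (Sub L) u v d → Walk u v d
  embed []            = []
  embed ((e , _) ∷ p) = e ∷ embed p

  Near : Edges → V → V → ℕ → Set
  Near L u v d = ∃[ d′ ] d′ ≤ d × Graph.Walk (Sub L) u v d′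

  near-refl : ∀ {L u} → Near L u u 0
  near-refl = 0 , z≤n , []

  near-edge : ∀ {L u v} → u ~ v → Linked L u v → Near L u v 1
  near-edge e l = 1 , ≤-refl , (e , l) ∷ []

  near-weaken : ∀ {L u v c d} → c ≤ d → Near L u v c → Near L u v d
  near-weaken c≤d (d′ , d′≤c , p) = d′ , ≤-trans d′≤c c≤d , p

  infix 4 _⊑_
  _⊑_ : Edges → Edges → Set
  L ⊑ L′ = ∀ {u v} → Linked L u v → Linked L′ u v

  ++-⊑ˡ : ∀ {L L′} → L ⊑ L ++ L′
  ++-⊑ˡ = [ inj₁ ∘ ∈-++⁺ˡ , inj₂ ∘ ∈-++⁺ˡ ]′

  ++-⊑ʳ : ∀ L {L′} → L′ ⊑ L ++ L′
  ++-⊑ʳ L = [ inj₁ ∘ ∈-++⁺ʳ L , inj₂ ∘ ∈-++⁺ʳ L ]′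

  near-mono : ∀ {L L′ u v d} → L ⊑ L′ → Near L u v d → Near L′ u v d
  near-mono {L} {L′} s (d′ , d′≤d , p) = d′ , d′≤d , lift p
    where
    lift : ∀ {u v d} → Graph.Walk (Sub L) u v d → Graph.Walk (Sub L′) u v d
    lift []            = []
    lift ((e , l) ∷ p) = (e , s l) ∷ lift p

  open Graph using () renaming (Walk to WalkIn)

  near-trans : ∀ {L u w v c d} → Near L u w c → Near L w v d → Near L u v (c + d)
  near-trans {L} (c′ , c′≤c , p) (d′ , d′≤d , q) = c′ + d′ , +-mono-≤ c′≤c d′≤d , join p q
    where
    join : ∀ {u w v c d} → WalkIn (Sub L) u w c → WalkIn (Sub L) w v d → WalkIn (Sub L) u v (c + d)
    join []      q = q
    join (e ∷ p) q = e ∷ join p q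

  near-sym : ∀ {L u v d} → Near L u v d → Near L v u d
  near-sym {L} (d′ , d′≤d , p) = near-weaken d′≤d (back p)
    where
    back : ∀ {u v d} → WalkIn (Sub L) u v d → Near L v u d
    back []            = near-refl
    back {d = suc d} ((e , l) ∷ p) = near-weaken (≤-reflexive (+-comm d 1))
      (near-trans (back p) (near-edge (~-sym e) ([ inj₂ , inj₁ ]′ l)))

  unique-length : ∀ {A : Set} {xs : List A} → Unique xs → ∀ ys → (∀ {x} → x ∈ xs → x ∈ ys) → length xs ≤ length ys
  unique-length [] ys xs⊆ys = z≤n
  unique-length {xs = x ∷ xs} (x∉xs ∷ xs!) ys xs⊆ys with l , r , refl ← ∈-∃++ (xs⊆ys (here refl)) =
    ≤-trans (s≤s (unique-length xs! (l ++ r) shrink)) (≤-reflexive (sym length-mid))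
    where
    length-mid : length (l ++ x ∷ r) ≡ suc (length (l ++ r))
    length-mid = trans (List.length-++ l) (trans (+-suc (length l) (length r)) (cong suc (sym (List.length-++ l))))
    shrink : ∀ {y} → y ∈ xs → y ∈ l ++ r
    shrink y∈xs with ∈-++⁻ l (xs⊆ys (there y∈xs))
    ... | inj₁ y∈l          = ∈-++⁺ˡ y∈l
    ... | inj₂ (here refl)  = ⊥-elim (All.lookup x∉xs y∈xs refl)
    ... | inj₂ (there y∈r)  = ∈-++⁺ʳ l y∈r

  -- After turning every listed pair so that its smaller end comes first, the list contains all
  -- counted edges, and these are pairwise distinct.
  ∣E∣-Sub : ∀ L → ∣E∣ (Sub L) ≤ length L
  ∣E∣-Sub L = ≤-trans (unique-length edges! (map orient L) edges⊆) (≤-reflexive (List.length-map orient L))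
    where
    orient : V × V → V × V
    orient (i , j) with i Fin.<? j
    ... | yes _ = i , j
    ... | no  _ = j , i
    keep? = λ ((i , j) : V × V) → (i Fin.<? j) ×-dec Graph._~?_ (Sub L) i j
    edges! : Unique (Graph.edges (Sub L))
    edges! = Unique.filter⁺ keep? (Unique.cartesianProduct⁺ (Unique.allFin⁺ n) (Unique.allFin⁺ n))
    orient-< : ∀ {i j} → toℕ i < toℕ j → orient (i , j) ≡ (i , j)
    orient-< {i} {j} i<j with i Fin.<? j
    ... | yes _   = refl
    ... | no  i≮j = contradiction i<j i≮j
    orient-> : ∀ {i j} → toℕ i < toℕ j → orient (j , i) ≡ (i , j)
    orient-> {i} {j} i<j with j Fin.<? i
    ... | yes j<i = contradiction i<j (<⇒≯ j<i)
    ... | no  _   = refl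
    edges⊆ : ∀ {e} → e ∈ Graph.edges (Sub L) → e ∈ map orient L
    edges⊆ {i , j} e∈ with i<j , (_ , l) ← proj₂ (∈-filter⁻ keep? {xs = cartesianProduct (allFin n) (allFin n)} e∈) with l
    ... | inj₁ ij∈L = subst (_∈ map orient L) (orient-< i<j) (∈-map⁺ orient ij∈L)
    ... | inj₂ ji∈L = subst (_∈ map orient L) (orient-> i<j) (∈-map⁺ orient ji∈L)

-- Greedy hitting sets

Hit : ∀ {n} → List (Fin n) → (Fin n → Bool) → Set
Hit S P = ∃[ s ] s ∈ S × P s ≡ true

module Hitting {n W t : ℕ} (0<W : 1 ≤ W) (0<t : 1 ≤ t) (n≤tW : n ≤ t * W) where

  instance
    W≢0 : NonZero W
    W≢0 = >-nonZero 0<W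
    t≢0 : NonZero t
    t≢0 = >-nonZero 0<t

  Family : Set
  Family = List (Fin n → Bool)

  Large : Family → Set
  Large F = ∀ {P} → P ∈ F → W ≤ card P

  hits : Family → Fin n → ℕ
  hits F v = count (λ P → P v) F

  incidences : ∀ F → Large F → length F * W ≤ sum (hits F)
  incidences F large = begin
    length F * W                         ≡⟨ sum-const (length F) W ⟨
    sum {length F} (λ _ → W)             ≤⟨ sum-mono (λ i → large (∈-lookup i)) ⟩
    sum (λ i → card (lookup F i))        ≡⟨ ∑-comm (λ i v → bit (lookup F i v)) ⟩
    sum (hits F)                         ∎
    where open ≤-Reasoning

  -- Averaging: at least `length F * W` incidences are spread over `n ≤ t * W` vertices.
  popular : ∀ F → Large F → 1 ≤ length F → ∃[ v ] length F ≤ t * hits F v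
  popular F large 0<F = v , *-cancelʳ-≤ (length F) (t * hits F v) W (begin
    length F * W        ≤⟨ incidences F large ⟩
    sum (hits F)        ≤⟨ le ⟩
    n * hits F v        ≤⟨ *-monoˡ-≤ (hits F v) n≤tW ⟩
    t * W * hits F v    ≡⟨ swap t W (hits F v) ⟩
    t * hits F v * W    ∎)
    where
    open ≤-Reasoning
    swap : ∀ a b c → a * b * c ≡ a * c * b
    swap = solve-∀
    average : ∀ {m} (f : Fin m → ℕ) → 1 ≤ sum f → ∃[ v ] sum f ≤ m * f v
    average {suc m} f _ = sum≤max f
    vle = average (hits F) (≤-trans (*-mono-≤ 0<F 0<W) (incidences F large))
    v = proj₁ vle
    le = proj₂ vle

  Remaining : Family → List (Fin n) → Family → Set
  Remaining F S F′ = ∀ {P} → P ∈ F → Hit S P ⊎ P ∈ F′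

  remaining-++ : ∀ {F S F′ S′ F″} → Remaining F S F′ → Remaining F′ S′ F″ → Remaining F (S ++ S′) F″
  remaining-++ {S = S} r r′ P∈F with r P∈F
  ... | inj₁ (s , s∈S , Ps) = inj₁ (s , ∈-++⁺ˡ s∈S , Ps)
  ... | inj₂ P∈F′ with r′ P∈F′
  ...   | inj₁ (s , s∈S′ , Ps) = inj₁ (s , ∈-++⁺ʳ S s∈S′ , Ps)
  ...   | inj₂ P∈F″            = inj₂ P∈F″

  -- As long as more than half of `F` is unhit, each choice hits at least `length F / (2 * t)`
  -- further sets; the second alternative of `progress` is the sum of these gains. Once half is hit,
  -- nothing more is chosen.
  record Progress (F : Family) (i : ℕ) : Set where
    field
      chosen    : List (Fin n)
      rest      : Family
      few       : length chosen ≤ i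
      large     : Large rest
      remaining : Remaining F chosen rest
      progress  : 2 * length rest ≤ length F ⊎ i * length F + t * (2 * length rest) ≤ t * (2 * length F)

  greedy : ∀ F → Large F → ∀ i → Progress F i
  greedy F large zero = record
    { chosen = [] ; rest = F ; few = z≤n ; large = large ; remaining = inj₂ ; progress = inj₂ ≤-refl }
  greedy F large (suc i) = next (greedy F large i)
    where
    next : Progress F i → Progress F (suc i)
    next P with 2 * length (Progress.rest P) ≤? length F
    ... | yes half = record
      { chosen = chosen ; rest = rest ; few = m≤n⇒m≤1+n few ; large = large′ ; remaining = remaining ; progress = inj₁ half }
      where open Progress P renaming (large to large′)
    ... | no ¬half with Progress.progress P
    ...   | inj₁ half = contradiction half ¬half
    ...   | inj₂ prog = record
      { chosen = chosen ++ v ∷ [] ; rest = rest′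
      ; few = ≤-trans (≤-reflexive (List.length-++ chosen)) (≤-trans (+-monoˡ-≤ 1 few) (≤-reflexive (+-comm i 1)))
      ; large = λ P∈ → large′ (proj₁ (∈-filter⁻ unhit? {xs = rest} P∈))
      ; remaining = remaining-++ {F} {chosen} {rest} remaining after
      ; progress = inj₂ step }
      where
      open Progress P renaming (large to large′)
      positive : 1 ≤ length rest
      positive = n≢0⇒n>0 λ eq → ¬half (subst (λ l → 2 * l ≤ length F) (sym eq) z≤n)
      best = popular rest large′ positive
      v = proj₁ best
      unhit? = λ (P : Fin n → Bool) → P v Bool.≟ false
      rest′ = filter unhit? rest
      after : Remaining rest (v ∷ []) rest′
      after {P} P∈ with P v in eq
      ... | true  = inj₁ (v , here refl , eq)
      ... | false = inj₂ (∈-filter⁺ unhit? P∈ eq)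
      rearrange : ∀ t c r → t * (2 * (c + r)) ≡ 2 * (t * c) + t * (2 * r)
      rearrange = solve-∀
      shuffle : ∀ f x y → f + x + y ≡ x + (f + y)
      shuffle = solve-∀
      step : suc i * length F + t * (2 * length rest′) ≤ t * (2 * length F)
      step = begin
        length F + i * length F + t * (2 * length rest′)
          ≡⟨ shuffle (length F) (i * length F) _ ⟩
        i * length F + (length F + t * (2 * length rest′))
          ≤⟨ +-monoʳ-≤ (i * length F) (+-monoˡ-≤ _ (≤-trans (<⇒≤ (≰⇒> ¬half)) (*-monoʳ-≤ 2 (proj₂ best)))) ⟩
        i * length F + (2 * (t * hits rest v) + t * (2 * length rest′))
          ≡⟨ cong (i * length F +_) (rearrange t (hits rest v) (length rest′)) ⟨
        i * length F + t * (2 * (hits rest v + length rest′))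
          ≡⟨ cong (λ l → i * length F + t * (2 * l)) (count-remove (λ P → P v) rest) ⟩
        i * length F + t * (2 * length rest)
          ≤⟨ prog ⟩
        t * (2 * length F) ∎
        where open ≤-Reasoning

  -- After `t` choices the accumulated gain is half of `F`, so both alternatives of `progress` give
  -- the same conclusion.
  halve : ∀ F → Large F → ∃[ S ] ∃[ F′ ] length S ≤ t × Large F′ × Remaining F S F′ × 2 * length F′ ≤ length F
  halve F large = chosen , rest , few , large′ , remaining , half progress
    where
    open Progress (greedy F large t) renaming (large to large′)
    half : 2 * length rest ≤ length F ⊎ t * length F + t * (2 * length rest) ≤ t * (2 * length F) → 2 * length rest ≤ length F
    half (inj₁ h) = h
    half (inj₂ h) = *-cancelˡ-≤ t (+-cancelˡ-≤ (t * length F) _ _ (≤-trans h (≤-reflexive (double t (length F)))))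
      where
      double : ∀ t f → t * (2 * f) ≡ t * f + t * f
      double = solve-∀

  -- Each halving costs `t` vertices, and `j` halvings exhaust fewer than `2 ^ j` sets.
  hitting : ∀ j F → Large F → length F < 2 ^ j → ∃[ S ] length S ≤ j * t × (∀ {P} → P ∈ F → Hit S P)
  hitting zero    [] _ _ = [] , z≤n , λ ()
  hitting zero    (_ ∷ _) _ (s≤s ())
  hitting (suc j) F large F<2^1+j
    with S , F′ , S≤t , large′ , rem , half ← halve F large
    with S′ , S′≤ , hit ← hitting j F′ large′ (*-cancelˡ-< 2 _ _ (≤-<-trans half F<2^1+j)) =
    S ++ S′ , ≤-trans (≤-reflexive (List.length-++ S)) (+-mono-≤ S≤t S′≤) , all-hit
    where
    all-hit : ∀ {P} → P ∈ F → Hit (S ++ S′) P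
    all-hit P∈F with rem P∈F
    ... | inj₁ (s , s∈ , Ps) = s , ∈-++⁺ˡ s∈ , Ps
    ... | inj₂ P∈F′ with s , s∈ , Ps ← hit P∈F′ = s , ∈-++⁺ʳ S s∈ , Ps

-- Balls, and a sparse subgraph of logarithmic multiplicative stretch

module Balls {n : ℕ} (G : Graph n) where
  open Walks G

  -- Only the endpoint of each step, not the starting set B, has to lie in R.
  ball : (R B : V → Bool) → ℕ → V → Bool
  ball R B zero      = B
  ball R B (suc i) y = ball R B i y ∨ (R y ∧ does (any? λ x → (ball R B i x Bool.≟ true) ×-dec (x ~? y)))

  module _ {R B : V → Bool} where

    ball-step : ∀ i {x y} → ball R B i x ≡ true → x ~ y → R y ≡ true → ball R B (suc i) y ≡ true
    ball-step i {x} {y} x∈ x~y Ry = ∨-trueʳ (ball R B i y) (∧-true Ry (dec-true (any? _) (x , x∈ , x~y)))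

    ball-mono : ∀ {i j} → i ≤ j → ball R B i ⊆ ball R B j
    ball-mono {i} i≤j y y∈ = grow (≤⇒≤′ i≤j)
      where
      grow : ∀ {j} → i ≤′ j → ball R B j y ≡ true
      grow ≤′-refl      = y∈
      grow (≤′-step le) = ∨-trueˡ (grow le)

    ball-⊆ : B ⊆ R → ∀ i → ball R B i ⊆ R
    ball-⊆ B⊆R zero    y y∈ = B⊆R y y∈
    ball-⊆ B⊆R (suc i) y y∈ with ∨-true⁻ {ball R B i y} y∈
    ... | inj₁ y∈′ = ball-⊆ B⊆R i y y∈′
    ... | inj₂ p   = proj₁ (∧-true⁻ p)

    -- Breadth-first search: every vertex of a new shell contributes one edge, to a parent in the
    -- previous ball.
    forest : ∀ i → ∃[ L ] length L ≤ card (ball R B i) ×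
      (∀ {y} → ball R B i y ≡ true → ∃[ s ] B s ≡ true × Near L s y i)
    forest zero = [] , z≤n , λ {y} y∈ → y , y∈ , near-refl
    forest (suc i) with L , len , reach ← forest i = L ++ new , length≤ , reach′
      where
      inner outer shell : V → Bool
      inner = ball R B i
      outer = ball R B (suc i)
      shell = outer ∖ inner
      parent : ∀ y → shell y ≡ true → ∃[ x ] inner x ≡ true × x ~ y
      parent y y∈ with y∈outer , y∉inner ← ∖-true⁻ {P = inner} {outer} {y} y∈ with ∨-true⁻ {inner y} y∈outer
      ... | inj₁ y∈inner = ⊥-elim (true≢false y∈inner y∉inner)
      ... | inj₂ p       = dec-true⁻ (any? _) (proj₂ (∧-true⁻ {R y} p))
      collected = collect shell (λ y y∈ → proj₁ (parent y y∈) , y)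
      new = proj₁ collected
      length≤ : length (L ++ new) ≤ card outer
      length≤ = begin
        length (L ++ new)        ≡⟨ List.length-++ L ⟩
        length L + length new    ≤⟨ +-mono-≤ len (≤-reflexive (proj₁ (proj₂ collected))) ⟩
        card inner + card shell  ≡⟨ card-∖ {P = inner} {outer} (λ y → ∨-trueˡ) ⟩
        card outer               ∎
        where open ≤-Reasoning
      reach′ : ∀ {y} → outer y ≡ true → ∃[ s ] B s ≡ true × Near (L ++ new) s y (suc i)
      reach′ {y} y∈ with true⊎false (inner y)
      ... | inj₁ eq with s , Bs , near ← reach eq = s , Bs , near-weaken (n≤1+n i) (near-mono (++-⊑ˡ {L}) near)
      ... | inj₂ eq = attach (parent y y∈shell) (proj₂ (proj₂ collected) y y∈shell)
        where
        y∈shell : shell y ≡ true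
        y∈shell = ∖-true {P = inner} {outer} y∈ eq
        attach : ((x , _) : ∃[ x ] inner x ≡ true × x ~ y) → (x , y) ∈ new →
          ∃[ s ] B s ≡ true × Near (L ++ new) s y (suc i)
        attach (x , x∈ , x~y) xy∈ with s , Bs , near ← reach x∈ =
          s , Bs , near-weaken (≤-reflexive (+-comm i 1))
            (near-trans (near-mono (++-⊑ˡ {L}) near) (near-edge x~y (inj₁ (∈-++⁺ʳ L xy∈))))

  around : (V → Bool) → ℕ → V → Bool
  around = ball (λ _ → true)

  around-walk : ∀ {B x y d i} → B x ≡ true → Walk x y d → d ≤ i → around B i y ≡ true
  around-walk {B} Bx p d≤i = ball-mono (≤-trans (≤-reflexive (+-identityʳ _)) d≤i) _ (extend 0 Bx p)
    where
    extend : ∀ i {x y d} → around B i x ≡ true → Walk x y d → around B (d + i) y ≡ true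
    extend i x∈ []                    = x∈
    extend i {y = y} {suc d} x∈ (x~w ∷ p) =
      subst (λ j → around B j y ≡ true) (+-suc d i) (extend (suc i) (ball-step i x∈ x~w refl) p)

  around⁻ : ∀ {B i y} → around B i y ≡ true → ∃[ s ] B s ≡ true × ∃[ d ] d ≤ i × Walk s y d
  around⁻ {B} {i} y∈ with _ , _ , reach ← forest {λ _ → true} {B} i with s , Bs , d , d≤i , p ← reach y∈ =
    s , Bs , d , d≤i , embed p

  -- Doubling at every radius would reach `2 ^ j`; for `n < 2 ^ N` a radius below `N` must therefore
  -- be slow.
  slow-growth : ∀ {R B : V → Bool} → 1 ≤ card B → ∀ j →
    (∃[ i ] i < j × card (ball R B (suc i)) ≤ 2 * card (ball R B i)) ⊎ 2 ^ j ≤ card (ball R B j)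
  slow-growth 0<B zero = inj₂ 0<B
  slow-growth {R} {B} 0<B (suc j) with slow-growth {R} {B} 0<B j
  ... | inj₁ (i , i<j , slow) = inj₁ (i , m≤n⇒m≤1+n i<j , slow)
  ... | inj₂ fast with card (ball R B (suc j)) ≤? 2 * card (ball R B j)
  ...   | yes slow = inj₁ (j , ≤-refl , slow)
  ...   | no ¬slow = inj₂ (≤-trans (*-monoʳ-≤ 2 fast) (<⇒≤ (≰⇒> ¬slow)))

  -- A ball B with at most twice its size at the next radius is removed; the
  -- tree spanning the larger ball serves all edges that touch B.
  logarithmic-spanner : ∀ N → n < 2 ^ N → ∃[ L ] length L ≤ 2 * n × (∀ {u v} → u ~ v → Near L u v (2 * N))
  logarithmic-spanner N n<2^N =
    let L , len , near = cover (card all) all ≤-refl in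
    L , ≤-trans len (*-monoʳ-≤ 2 (card≤n all)) , near refl refl
    where
    all : V → Bool
    all _ = true
    cover : ∀ f R → card R ≤ f → ∃[ L ] length L ≤ 2 * card R ×
      (∀ {u v} → R u ≡ true → R v ≡ true → u ~ v → Near L u v (2 * N))
    cover f R R≤f with any? (λ x → R x Bool.≟ true)
    cover f R R≤f | no empty = [] , z≤n , λ Ru _ _ → ⊥-elim (empty (_ , Ru))
    cover zero R R≤0 | yes (c , Rc) = ⊥-elim (<⇒≱ (card-positive R c Rc) R≤0)
    cover (suc f) R R≤f | yes (c , Rc) = T ++ proj₁ rec , length≤ , near
      where
      centre : V → Bool
      centre x = does (x Fin.≟ c)
      c∈ : centre c ≡ true
      c∈ = dec-true (c Fin.≟ c) refl
      slow : ∃[ i ] i < N × card (ball R centre (suc i)) ≤ 2 * card (ball R centre i)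
      slow with slow-growth {R} {centre} (card-positive centre c c∈) N
      ... | inj₁ s = s
      ... | inj₂ big = ⊥-elim (<⇒≱ n<2^N (≤-trans big (card≤n (ball R centre N))))
      i = proj₁ slow
      core rest : V → Bool
      core = ball R centre i
      rest = R ∖ core
      core⊆R : core ⊆ R
      core⊆R = ball-⊆ (λ y y∈ → subst (λ y → R y ≡ true) (sym (dec-true⁻ (y Fin.≟ c) y∈)) Rc) i
      tree = forest {R} {centre} (suc i)
      T = proj₁ tree
      rest≤f : card rest ≤ f
      rest≤f = +-cancelˡ-≤ 1 _ _ (begin
        1 + card rest          ≤⟨ +-monoˡ-≤ (card rest) (card-positive core c (ball-mono {R} {centre} {0} {i} z≤n c c∈)) ⟩
        card core + card rest  ≡⟨ card-∖ core⊆R ⟩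
        card R                 ≤⟨ R≤f ⟩
        suc f                  ∎)
        where open ≤-Reasoning
      rec = cover f rest rest≤f
      length≤ : length (T ++ proj₁ rec) ≤ 2 * card R
      length≤ = begin
        length (T ++ proj₁ rec)          ≡⟨ List.length-++ T ⟩
        length T + length (proj₁ rec)    ≤⟨ +-mono-≤ (≤-trans (proj₁ (proj₂ tree)) (proj₂ (proj₂ slow))) (proj₁ (proj₂ rec)) ⟩
        2 * card core + 2 * card rest    ≡⟨ *-distribˡ-+ 2 (card core) (card rest) ⟨
        2 * (card core + card rest)      ≡⟨ cong (2 *_) (card-∖ core⊆R) ⟩
        2 * card R                       ∎
        where open ≤-Reasoning
      to-centre : ∀ {y} → ball R centre (suc i) y ≡ true → Near T c y (suc i)
      to-centre y∈ with s , s∈ , near ← proj₂ (proj₂ tree) y∈ =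
        subst (λ s → Near T s _ (suc i)) (dec-true⁻ (s Fin.≟ c) s∈) near
      via-core : ∀ {x y} → core x ≡ true → R y ≡ true → x ~ y → Near (T ++ proj₁ rec) x y (2 * N)
      -- One end in the core places both ends within `suc i ≤ N` of the centre.
      via-core x∈ Ry x~y = near-weaken (+-mono-≤ (proj₁ (proj₂ slow)) (≤-trans (proj₁ (proj₂ slow)) (m≤m+n N 0)))
        (near-mono (++-⊑ˡ {T}) (near-trans (near-sym (to-centre (ball-mono {R} {centre} (n≤1+n i) _ x∈))) (to-centre (ball-step i x∈ x~y Ry))))
      near : ∀ {u v} → R u ≡ true → R v ≡ true → u ~ v → Near (T ++ proj₁ rec) u v (2 * N)
      near {u} {v} Ru Rv u~v with true⊎false (core u) | true⊎false (core v)
      ... | inj₁ eu | _       = via-core eu Rv u~v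
      ... | inj₂ eu | inj₁ ev = near-sym (via-core ev Ru (~-sym u~v))
      ... | inj₂ eu | inj₂ ev = near-mono (++-⊑ʳ T)
        (proj₂ (proj₂ rec) (∖-true {P = core} {R} Ru eu) (∖-true {P = core} {R} Rv ev) u~v)

-- Strips

gather : ∀ {n c} {A : Set} (f : Fin n → List A) → (∀ y → length (f y) ≤ c) →
  ∃[ xs ] length xs ≤ n * c × (∀ y {x} → x ∈ f y → x ∈ xs)
gather {zero}  f _ = [] , z≤n , λ ()
gather {suc n} f f≤c with xs , len , mem ← gather (f ∘ suc) (f≤c ∘ suc) =
  f zero ++ xs , ≤-trans (≤-reflexive (List.length-++ (f zero))) (+-mono-≤ (f≤c zero) len) ,
  λ { zero x∈ → ∈-++⁺ˡ x∈ ; (suc y) x∈ → ∈-++⁺ʳ (f zero) (mem y x∈) }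

-- Last occurrences, and rerouting along earlier strips

module Rerouting {n : ℕ} (G : Graph n) where
  open Walks G

  -- Leaving a strip at its last vertex on the walk ensures that the remainder never returns to it;
  -- this is how each strip is used only once.
  last-occurrence : ∀ {u v d} (P : V → Bool) (p : Walk u v d) →
    (∃[ z ] ∃[ a ] Σ[ s ∈ Split p z a ] P z ≡ true × (∀ {y} → y ∈ later (Split.back s) → P y ≡ true → ⊥)) ⊎
    (∀ {y} → y ∈ vertices p → P y ≡ true → ⊥)
  last-occurrence {u} P [] with true⊎false (P u)
  ... | inj₁ Pu  = inj₁ (_ , _ , mkSplit [] [] refl refl , Pu , λ ())
  ... | inj₂ ¬Pu = inj₂ λ { (here refl) Pu → true≢false Pu ¬Pu }
  last-occurrence {u} P (e ∷ p) with last-occurrence P p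
  ... | inj₁ (z , a , mkSplit f b t l , Pz , none) = inj₁ (z , suc a , mkSplit (e ∷ f) b (cong suc t) (cong (_ ∷_) l) , Pz , none)
  ... | inj₂ none with true⊎false (P u)
  ...   | inj₁ Pu  = inj₁ (_ , _ , mkSplit [] (e ∷ p) refl refl , Pu , none)
  ...   | inj₂ ¬Pu = inj₂ λ { (here refl) Pu → true≢false Pu ¬Pu ; (there y∈) → none y∈ }

  last-from : ∀ {u v d} (P : V → Bool) (p : Walk u v d) → P u ≡ true →
    ∃[ z ] ∃[ a ] Σ[ s ∈ Split p z a ] P z ≡ true × (∀ {y} → y ∈ later (Split.back s) → P y ≡ true → ⊥)
  last-from P p Pu with last-occurrence P p
  ... | inj₁ found = found
  ... | inj₂ none  = ⊥-elim (none (here refl) Pu)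

  end-∈ : ∀ {u v d} (p : Walk u v d) → v ∈ vertices p
  end-∈ []      = here refl
  end-∈ (e ∷ p) = there (end-∈ p)

  later-back : ∀ {u v d z a} {p : Walk u v d} (s : Split p z a) {y} → y ∈ later (Split.back s) → y ∈ later p
  later-back s y∈ = subst (_ ∈_) (sym (Split.later≡ s)) (∈-++⁺ʳ (later (Split.front s)) y∈)

  -- The price of adding a walk to `L`.
  new : Edges → ∀ {u v d} → Walk u v d → Edges
  new L []                    = []
  new L (_∷_ {u} {w} e p) with linked? L u w
  ... | yes _ = new L p
  ... | no  _ = (u , w) ∷ new L p

  new-∷ : ∀ L {u w v d} (e : u ~ w) (p : Walk w v d) → length (new L (e ∷ p)) ≤ suc (length (new L p))
  new-∷ L {u} {w} e p with linked? L u w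
  ... | yes _ = n≤1+n _
  ... | no  _ = ≤-refl

  new≤length : ∀ L {u v d} (p : Walk u v d) → length (new L p) ≤ d
  new≤length L []      = z≤n
  new≤length L (e ∷ p) = ≤-trans (new-∷ L e p) (s≤s (new≤length L p))

  new-embed-⊕ : ∀ L {u w v c d} (s : Graph.Walk (Sub L) u w c) (p : Walk w v d) → new L (embed s ⊕ p) ≡ new L p
  new-embed-⊕ L [] p = refl
  new-embed-⊕ L (_∷_ {u} {w} (e , l) s) p with linked? L u w
  ... | yes _ = new-embed-⊕ L s p
  ... | no ¬l = contradiction l ¬l

  -- The vertex list is kept along with the walk, so that membership of a vertex transfers to the
  -- copy in the subgraph.
  realise : ∀ {L L′} → L ⊑ L′ → ∀ {u v d} (p : Walk u v d) → (∀ {e} → e ∈ new L p → e ∈ L′) →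
    Σ[ s ∈ Graph.Walk (Sub L′) u v d ] Walks.later (Sub L′) s ≡ later p
  realise L⊑L′ [] _ = [] , refl
  realise {L} L⊑L′ (_∷_ {u} {w} e p) new⊆ with linked? L u w
  ... | yes l with s , eq ← realise L⊑L′ p new⊆ = (e , L⊑L′ l) ∷ s , cong (w ∷_) eq
  ... | no  _ with s , eq ← realise L⊑L′ p (new⊆ ∘ there) = (e , inj₁ (new⊆ (here refl))) ∷ s , cong (w ∷_) eq

  -- A segment of a geodesic is a geodesic, so the part of `s` between the two vertices is as short
  -- as any walk in `G`. Their order on `s` is unknown; one of the two cases runs backwards.
  along-geodesic : ∀ {L u v d} (s : Graph.Walk (Sub L) u v d) → Geodesic u v d →
    ∀ {y z a} → y ∈ Walks.vertices (Sub L) s → z ∈ Walks.vertices (Sub L) s → Walk y z a → Near L y z a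
  along-geodesic {L} {u} {v} s geo {y} {z} {a} y∈ z∈ q with α , sp ← Walks.split-∈ (Sub L) s y∈ = cases (locate z∈)
    where
    module H = Walks (Sub L)
    open H.Split sp
    geo′ : Geodesic u v (α + b)
    geo′ = subst (λ d → Geodesic u v d) (sym total) geo
    locate : z ∈ H.vertices s → z ∈ H.vertices front ⊎ z ∈ H.later back
    locate (here z≡u) = inj₁ (here z≡u)
    locate (there z∈l) with ∈-++⁻ (H.later front) (subst (z ∈_) later≡ z∈l)
    ... | inj₁ z∈f = inj₁ (there z∈f)
    ... | inj₂ z∈b = inj₂ z∈b
    cases : z ∈ H.vertices front ⊎ z ∈ H.later back → Near L y z a
    cases (inj₁ z∈f) with β , H.mkSplit f₁ f₂ t _ ← H.split-∈ front z∈f = near-sym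
      (_ , geodesic-suffix (embed f₁) (subst (λ d → Geodesic u y d) (sym t) (geodesic-prefix (embed back) geo′)) (reverse q) , f₂)
    cases (inj₂ z∈b) with β , H.mkSplit b₁ b₂ t _ ← H.split-∈ back (there z∈b) =
      _ , geodesic-prefix (embed b₂) (subst (λ d → Geodesic y v d) (sym t) (geodesic-suffix (embed front) geo′)) q , b₁

  -- A walk that meets an old strip follows it up to the last common vertex, so
  -- every old strip is charged for at most one new edge.
  reroute : ∀ {k L} (on : Fin k → V → Bool) (touched : V → Bool) →
    (∀ {x} → touched x ≡ true → ∃[ i ] on i x ≡ true) →
    (∀ {i y z a} → on i y ≡ true → on i z ≡ true → Walk y z a → Near L y z a) →
    ∀ f {x v d} → d ≤ f → (q : Walk x v d) (A : Fin k → Bool) →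
    (∀ {i y} → y ∈ later q → on i y ≡ true → A i ≡ true) →
    ∃[ d′ ] d′ ≤ d × Σ[ q′ ∈ Walk x v d′ ] length (new L q′) ≤ count (not ∘ touched) (later q′) + card A
  reroute on touched on⁻ along f d≤f [] A avail = 0 , z≤n , [] , z≤n
  reroute {L = L} on touched on⁻ along (suc f) (s≤s d≤f) (_∷_ {w = y} e q) A avail with true⊎false (touched y)
  ... | inj₂ fresh with d′ , d′≤d , q′ , cost ← reroute on touched on⁻ along f d≤f q A (avail ∘ there) =
    suc d′ , s≤s d′≤d , e ∷ q′ , (begin
      length (new L (e ∷ q′))                                                  ≤⟨ new-∷ L e q′ ⟩
      suc (length (new L q′))                                                  ≤⟨ s≤s cost ⟩
      suc (count (not ∘ touched) (later q′)) + card A                          ≡⟨ cong (λ b → bit (not b) + count (not ∘ touched) (later q′) + card A) fresh ⟨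
      bit (not (touched y)) + count (not ∘ touched) (later q′) + card A        ∎)
    where open ≤-Reasoning
  -- Only `e`, the edge entering strip `i`, is charged to `i`. The stretch up to `z` lies in `L`,
  -- and the edge leaving `z` is charged to the vertex it enters.
  ... | inj₁ old with i , on-i ← on⁻ old
    with z , a , s@(mkSplit {b} front back total _) , on-z , none ← last-from (on i) q on-i
    with c , c≤a , t ← along on-i on-z front
    with d′ , d′≤b , q′ , cost ← reroute on touched on⁻ along f (≤-trans (≤-trans (m≤n+m b a) (≤-reflexive total)) d≤f) back
           (A ∖ λ j → does (j Fin.≟ i))
           (λ {j} {y} y∈ on-y → ∖-true {P = λ j → does (j Fin.≟ i)} {A} (avail (there (later-back s y∈)) on-y)
             (dec-false (j Fin.≟ i) λ { refl → none y∈ on-y })) =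
    suc (c + d′) , s≤s (≤-trans (+-mono-≤ c≤a d′≤b) (≤-reflexive total)) , e ∷ (embed t ⊕ q′) , (begin
      length (new L (e ∷ (embed t ⊕ q′)))                                      ≤⟨ new-∷ L e (embed t ⊕ q′) ⟩
      suc (length (new L (embed t ⊕ q′)))                                      ≡⟨ cong (suc ∘ length) (new-embed-⊕ L t q′) ⟩
      suc (length (new L q′))                                                  ≤⟨ s≤s cost ⟩
      suc (fresh (later q′) + card rest)                                       ≡⟨ +-suc (fresh (later q′)) (card rest) ⟨
      fresh (later q′) + suc (card rest)                                       ≤⟨ +-mono-≤ fresh-mono rest< ⟩
      fresh (later (e ∷ (embed t ⊕ q′))) + card A                              ∎)
    where
    open ≤-Reasoning
    rest = A ∖ λ j → does (j Fin.≟ i)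
    fresh = count (not ∘ touched)
    rest< : suc (card rest) ≤ card A
    rest< = card-mono-< {P = rest} {A} (λ j p → proj₁ (∧-true⁻ {A j} p)) i
      (trans (cong (λ b → A i ∧ not b) (dec-true (i Fin.≟ i) refl)) (Bool.∧-zeroʳ (A i)))
      (avail (here refl) on-i)
    fresh-mono : fresh (later q′) ≤ fresh (later (e ∷ (embed t ⊕ q′)))
    fresh-mono = begin
      fresh (later q′)                                ≤⟨ m≤n+m _ (fresh (later (embed t))) ⟩
      fresh (later (embed t)) + fresh (later q′)      ≡⟨ count-++ (not ∘ touched) (later (embed t)) (later q′) ⟨
      fresh (later (embed t) ++ later q′)             ≡⟨ cong fresh (later-⊕ (embed t) q′) ⟨
      fresh (later (embed t ⊕ q′))                    ≤⟨ m≤n+m _ (bit (not (touched y))) ⟩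
      fresh (later (e ∷ (embed t ⊕ q′)))              ∎

-- Greedy construction of the strips

module Strips {n : ℕ} (G : Graph n) {M Λ m : ℕ} (0<M : 1 ≤ M) (0<m : 1 ≤ m) where
  open Walks G
  open Rerouting G

  Ownership : ℕ → Set
  Ownership k = V → Maybe (Fin k)

  owned free : ∀ {k} → Ownership k → V → Bool
  owned own x = Maybe.is-just (own x)
  free own x = Maybe.is-nothing (own x)

  owned⁻ : ∀ {k} (own : Ownership k) {x} → owned own x ≡ true → ∃[ i ] own x ≡ just i
  owned⁻ own {x} p with own x
  ... | just i = i , refl

  free⁻ : ∀ {k} (own : Ownership k) {x} → free own x ≡ true → own x ≡ nothing
  free⁻ own {x} p with own x
  ... | nothing = refl

  class : ∀ {k} → Ownership k → Fin k → V → Bool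
  class own i x = does (Maybe.≡-dec Fin._≟_ (own x) (just i))

  freeNeighbours : ∀ {k} → Ownership k → V → V → Bool
  freeNeighbours own y x = free own x ∧ does (y ~? x)

  heavy : ∀ {k} → Ownership k → V → Bool
  heavy own y = does (M ≤? card (freeNeighbours own y))

  -- Invariants while strips are added. `cost₁` pays the full length of each strip; `cost₂` pays
  -- every vertex once, when it is newly touched, plus one edge per earlier strip. The former serves
  -- short strips, the latter strips of unrestricted length.
  record StripSystem : Set where
    field
      {k}     : ℕ
      own     : Ownership k
      on      : Fin k → V → Bool
      touched : V → Bool
      L       : Edges
      touched⁻ : ∀ {x} → touched x ≡ true → ∃[ i ] on i x ≡ true
      along    : ∀ {i y z a} → on i y ≡ true → on i z ≡ true → Walk y z a → Near L y z a
      short    : ∀ {i y z} → on i y ≡ true → on i z ≡ true → ∃[ a ] a ≤ Λ × Walk y z a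
      attached : ∀ {i x} → own x ≡ just i → ∃[ y ] on i y ≡ true × x ~ y × Linked L x y
      size     : ∀ i → M * m ≤ 3 * card (class own i)
      cost₁    : length L ≤ card (owned own) + k * Λ
      cost₂    : length L ≤ card (owned own) + (card touched + k * k)

  empty : StripSystem
  empty = record
    { k = 0 ; own = λ _ → nothing ; on = λ () ; touched = λ _ → false ; L = []
    ; touched⁻ = λ () ; along = λ { {()} } ; short = λ { {()} } ; attached = λ ()
    ; size = λ () ; cost₁ = z≤n ; cost₂ = z≤n }

  module Extend (S : StripSystem) {u v d} (q : Walk u v d) (geo : Geodesic u v d) (d≤Λ : d ≤ Λ)
    (cheap : length (new (StripSystem.L S) q) ≤ count (not ∘ StripSystem.touched S) (later q) + StripSystem.k S)
    (dense : m ≤ count (heavy (StripSystem.own S)) (vertices q)) where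
    open StripSystem S

    claimed : V → Bool
    claimed x = free own x ∧ does (any? λ y → (y ∈ᵇ vertices q Bool.≟ true) ×-dec (x ~? y))

    claimed⁻ : ∀ x → claimed x ≡ true → free own x ≡ true × ∃[ y ] y ∈ᵇ vertices q ≡ true × x ~ y
    claimed⁻ x p with fx , a ← ∧-true⁻ {free own x} p = fx , dec-true⁻ (any? _) a

    claimed⁺ : ∀ {x y} → free own x ≡ true → y ∈ vertices q → x ~ y → claimed x ≡ true
    claimed⁺ {x} {y} fx y∈ x~y = ∧-true fx (dec-true (any? _) (y , ∈ᵇ⁺ y∈ , x~y))

    -- Only free vertices are claimed, so no earlier strip loses a vertex and the bounds in `size`
    -- persist.
    own′ : Ownership (suc k)
    own′ x = if claimed x then just zero else Maybe.map suc (own x)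

    own′-claimed : ∀ {x} → claimed x ≡ true → own′ x ≡ just zero
    own′-claimed p rewrite p = refl

    own′-old : ∀ {x i} → own x ≡ just i → own′ x ≡ just (suc i)
    own′-old {x} eq rewrite eq = refl

    own′⁻ : ∀ {x i} → own′ x ≡ just i → (claimed x ≡ true × i ≡ zero) ⊎ ∃[ j ] own x ≡ just j × i ≡ suc j
    own′⁻ {x} eq with true⊎false (claimed x)
    ... | inj₁ p = inj₁ (p , sym (Maybe.just-injective (trans (sym (own′-claimed p)) eq)))
    ... | inj₂ ¬p rewrite ¬p with own x | eq
    ...   | just j | refl = inj₂ (j , refl , refl)

    on′ : Fin (suc k) → V → Bool
    on′ zero    x = x ∈ᵇ vertices q
    on′ (suc i) x = on i x

    touched′ : V → Bool
    touched′ x = touched x ∨ x ∈ᵇ vertices q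

    touched′⁻ : ∀ {x} → touched′ x ≡ true → ∃[ i ] on′ i x ≡ true
    touched′⁻ {x} p with ∨-true⁻ {touched x} p
    ... | inj₁ t with i , on-i ← touched⁻ t = suc i , on-i
    ... | inj₂ x∈ = zero , x∈

    link : ∀ x → claimed x ≡ true → V × V
    link x p = x , proj₁ (proj₂ (claimed⁻ x p))

    links : Edges
    links = proj₁ (collect claimed link)

    L′ : Edges
    L′ = L ++ (new L q ++ links)

    old⊑ : L ⊑ L′
    old⊑ = ++-⊑ˡ {L}

    along′ : ∀ {i y z a} → on′ i y ≡ true → on′ i z ≡ true → Walk y z a → Near L′ y z a
    along′ {suc i} y∈ z∈ p = near-mono old⊑ (along y∈ z∈ p)
    along′ {zero} {y} {z} y∈ z∈ p
      with s , eq ← realise old⊑ q (∈-++⁺ʳ L ∘ ∈-++⁺ˡ) =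
      along-geodesic s geo (subst (λ l → y ∈ u ∷ l) (sym eq) (∈ᵇ⁻ {y} {vertices q} y∈)) (subst (λ l → z ∈ u ∷ l) (sym eq) (∈ᵇ⁻ {z} {vertices q} z∈)) p

    short′ : ∀ {i y z} → on′ i y ≡ true → on′ i z ≡ true → ∃[ a ] a ≤ Λ × Walk y z a
    short′ {suc i} y∈ z∈ = short y∈ z∈
    short′ {zero} {y} {z} y∈ z∈ with a , sp ← split-∈ q (∈ᵇ⁻ {y} {vertices q} y∈) | ∈ᵇ⁻ {z} {vertices q} z∈
    ... | here refl = a , ≤-trans (≤-trans (m≤m+n a _) (≤-reflexive (Split.total sp))) d≤Λ , reverse (Split.front sp)
    ... | there z∈l with ∈-++⁻ (later (Split.front sp)) (subst (z ∈_) (Split.later≡ sp) z∈l)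
    ...   | inj₁ z∈f with c , mkSplit {b} f₁ f₂ t _ ← split-∈ (Split.front sp) (there z∈f) =
      b , ≤-trans (≤-trans (m≤n+m b c) (≤-trans (≤-reflexive t) (≤-trans (m≤m+n a _) (≤-reflexive (Split.total sp))))) d≤Λ , reverse f₂
    ...   | inj₂ z∈b with c , mkSplit {b} b₁ b₂ t _ ← split-∈ (Split.back sp) (there z∈b) =
      c , ≤-trans (≤-trans (m≤m+n c b) (≤-trans (≤-reflexive t) (≤-trans (m≤n+m _ a) (≤-reflexive (Split.total sp))))) d≤Λ , b₁

    attached′ : ∀ {i x} → own′ x ≡ just i → ∃[ y ] on′ i y ≡ true × x ~ y × Linked L′ x y
    attached′ {i} {x} eq with own′⁻ {x} eq
    ... | inj₁ (p , refl) with y , y∈ , x~y ← proj₂ (claimed⁻ x p) in ceq =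
      y , y∈ , x~y , inj₁ (∈-++⁺ʳ L (∈-++⁺ʳ (new L q)
        (subst (λ c → (x , proj₁ c) ∈ links) ceq (proj₂ (proj₂ (collect claimed link)) x p))))
    ... | inj₂ (j , eq′ , refl) with y , on-y , x~y , l ← attached eq′ = y , on-y , x~y , old⊑ l

    -- Each of at least `m` heavy vertices has `M` free neighbours, all claimed. Vertices of the
    -- strip with a common neighbour are at distance at most 2, so by `close-count` no claimed
    -- vertex is counted more than 3 times.
    claimed-many : M * m ≤ 3 * card claimed
    claimed-many = ≤-trans (*-monoʳ-≤ M dense)
      (double-count (λ i → heavy own (at i)) (λ i y → freeNeighbours own (at i) y) claimed M 3
        (λ i h → dec-true⁻ (M ≤? _) h)
        (λ i y _ fn → let fy , a = ∧-true⁻ {free own y} fn in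
          claimed⁺ fy (∈-lookup i) (~-sym (dec-true⁻ (at i ~? y) a)))
        (λ y → close-count q geo (λ x → heavy own x ∧ freeNeighbours own x y) 2 λ {x} {z} px pz →
          2 , ≤-refl , adjacent px ∷ ~-sym (adjacent pz) ∷ []))
      where
      at = lookup (vertices q)
      adjacent : ∀ {x y} → heavy own x ∧ freeNeighbours own x y ≡ true → x ~ y
      adjacent {x} {y} p = dec-true⁻ (x ~? y) (proj₂ (∧-true⁻ {free own y} (proj₂ (∧-true⁻ {heavy own x} p))))

    size′ : ∀ i → M * m ≤ 3 * card (class own′ i)
    size′ zero = ≤-trans claimed-many (*-monoʳ-≤ 3 (card-mono {P = claimed} {class own′ zero}
      λ x p → dec-true (Maybe.≡-dec Fin._≟_ (own′ x) (just zero)) (own′-claimed p)))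
    size′ (suc i) = ≤-trans (size i) (*-monoʳ-≤ 3 (card-mono {P = class own i} {class own′ (suc i)}
      λ x p → dec-true (Maybe.≡-dec Fin._≟_ (own′ x) (just (suc i)))
        (own′-old (dec-true⁻ (Maybe.≡-dec Fin._≟_ (own x) (just i)) p))))

    owned′≥ : card (owned own) + card claimed ≤ card (owned own′)
    owned′≥ = begin
      card (owned own) + card claimed                        ≤⟨ +-monoʳ-≤ _ (card-mono {P = claimed} {owned own′ ∖ owned own} fresh) ⟩
      card (owned own) + card (owned own′ ∖ owned own)       ≡⟨ card-∖ {P = owned own} {owned own′} keep ⟩
      card (owned own′)                                      ∎
      where
      open ≤-Reasoning
      keep : owned own ⊆ owned own′
      keep x p with i , eq ← owned⁻ own p = cong Maybe.is-just (own′-old eq)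
      fresh : claimed ⊆ owned own′ ∖ owned own
      fresh x p = ∖-true {P = owned own} {owned own′} (cong Maybe.is-just (own′-claimed p))
        (cong Maybe.is-just (free⁻ own (proj₁ (claimed⁻ x p))))

    touched′≥ : card touched + count (not ∘ touched) (later q) ≤ card touched′
    touched′≥ = begin
      card touched + count (not ∘ touched) (later q)       ≤⟨ +-monoʳ-≤ (card touched) (m≤n+m _ (bit (not (touched u)))) ⟩
      card touched + count (not ∘ touched) (vertices q)    ≤⟨ +-monoʳ-≤ (card touched) (count≤card q geo (not ∘ touched) (touched′ ∖ touched) fresh) ⟩
      card touched + card (touched′ ∖ touched)             ≡⟨ card-∖ {P = touched} {touched′} (λ x → ∨-trueˡ) ⟩
      card touched′                                        ∎
      where
      open ≤-Reasoning
      fresh : ∀ {x} → x ∈ vertices q → not (touched x) ≡ true → (touched′ ∖ touched) x ≡ true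
      fresh {x} x∈ ¬t = ∧-true (∨-trueʳ (touched x) (∈ᵇ⁺ x∈)) ¬t

    length-L′ : length L′ ≡ length L + (length (new L q) + card claimed)
    length-L′ = trans (List.length-++ L) (cong (length L +_)
      (trans (List.length-++ (new L q)) (cong (length (new L q) +_) (proj₁ (proj₂ (collect claimed link))))))

    cost₁′ : length L′ ≤ card (owned own′) + suc k * Λ
    cost₁′ = begin
      length L′                                                 ≡⟨ length-L′ ⟩
      length L + (length (new L q) + card claimed)              ≤⟨ +-mono-≤ cost₁ (+-monoˡ-≤ _ (≤-trans (new≤length L q) d≤Λ)) ⟩
      card (owned own) + k * Λ + (Λ + card claimed)             ≡⟨ shuffle (card (owned own)) (k * Λ) Λ (card claimed) ⟩
      card (owned own) + card claimed + suc k * Λ               ≤⟨ +-monoˡ-≤ _ owned′≥ ⟩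
      card (owned own′) + suc k * Λ                             ∎
      where
      open ≤-Reasoning
      shuffle : ∀ o kl l c → o + kl + (l + c) ≡ o + c + (l + kl)
      shuffle = solve-∀

    cost₂′ : length L′ ≤ card (owned own′) + (card touched′ + suc k * suc k)
    cost₂′ = begin
      length L′
        ≡⟨ length-L′ ⟩
      length L + (length (new L q) + card claimed)
        ≤⟨ +-mono-≤ cost₂ (+-monoˡ-≤ _ cheap) ⟩
      card (owned own) + (card touched + k * k) + (fresh + k + card claimed)
        -- The slack `suc k` completes `k * k + k` to `suc k * suc k`.
        ≤⟨ m≤m+n _ (suc k) ⟩
      card (owned own) + (card touched + k * k) + (fresh + k + card claimed) + suc k
        ≡⟨ shuffle (card (owned own)) (card touched) k fresh (card claimed) ⟩
      card (owned own) + card claimed + (card touched + fresh + suc k * suc k)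
        ≤⟨ +-mono-≤ owned′≥ (+-monoˡ-≤ _ touched′≥) ⟩
      card (owned own′) + (card touched′ + suc k * suc k) ∎
      where
      open ≤-Reasoning
      fresh = count (not ∘ touched) (later q)
      shuffle : ∀ o t k f c → o + (t + k * k) + (f + k + c) + suc k ≡ o + c + (t + f + suc k * suc k)
      shuffle = solve-∀

    extended : StripSystem
    extended = record
      { own = own′ ; on = on′ ; touched = touched′ ; L = L′
      ; touched⁻ = touched′⁻ ; along = λ {i} → along′ {i} ; short = λ {i} → short′ {i} ; attached = attached′
      ; size = size′ ; cost₁ = cost₁′ ; cost₂ = cost₂′ }

    -- The termination measure: every strip claims at least one vertex because `M * m` is positive.
    grows : card (owned own) < card (owned own′)
    grows = ≤-trans (≤-trans (≤-reflexive (+-comm 1 _)) (+-monoʳ-≤ _ positive)) owned′≥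
      where
      positive : 1 ≤ card claimed
      positive = n≢0⇒n>0 λ eq → <⇒≱ (*-mono-≤ 0<M 0<m) (subst (λ c → M * m ≤ 3 * c) eq claimed-many)

  Sparse : StripSystem → Set
  Sparse S = ∀ {u v d} → Walk u v d → d ≤ Λ →
    ∃[ d′ ] d′ ≤ d × Σ[ q ∈ Walk u v d′ ] count (heavy (StripSystem.own S)) (vertices q) < m

  module _ (S : StripSystem) where
    open StripSystem S

    SparsePair DensePair : V → V → Set
    SparsePair u v = ∀ {d} → Walk u v d → d ≤ Λ →
      ∃[ d′ ] d′ ≤ d × Σ[ q ∈ Walk u v d′ ] count (heavy own) (vertices q) < m
    DensePair u v = ∃[ d ] Σ[ q ∈ Walk u v d ] Geodesic u v d × d ≤ Λ ×
      length (new L q) ≤ count (not ∘ touched) (later q) + k × m ≤ count (heavy own) (vertices q)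

    pair : ∀ u v → SparsePair u v ⊎ DensePair u v
    pair u v with distance u v
    ... | ⊤⁺ , none = inj₁ λ p → ⊥-elim (none p)
    ... | ⟨ d ⟩ , p , geo with d ≤? Λ
    ...   | no  d≰Λ = inj₁ λ q d′≤Λ → contradiction (≤-trans (geo q) d′≤Λ) d≰Λ
    ...   | yes d≤Λ with d′ , d′≤d , q , cheap ← reroute on touched touched⁻ along d ≤-refl p (λ _ → true) (λ _ _ → refl)
      with m ≤? count (heavy own) (vertices q)
    -- The rerouted walk is no longer than the geodesic `p`, hence again a geodesic.
    ...     | yes dense  = inj₂ (d′ , q , ≤-trans d′≤d ∘ geo , ≤-trans d′≤d d≤Λ ,
                ≤-trans cheap (+-monoʳ-≤ _ (card≤n {k} (λ _ → true))) , dense)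
    ...     | no  ¬dense = inj₁ λ p′ _ → d′ , ≤-trans d′≤d (geo p′) , q , ≰⇒> ¬dense

  complete : ∀ f S → n ≤ f + card (owned (StripSystem.own S)) → ∃ Sparse
  complete f S n≤ with finite-choice (λ u → finite-choice (pair S u))
  complete f S n≤ | inj₁ sparse = S , λ {u} {v} → sparse u v
  complete zero S n≤ | inj₂ (u , v , d , q , geo , d≤Λ , cheap , dense) =
    ⊥-elim (<⇒≱ (Extend.grows S q geo d≤Λ cheap dense) (≤-trans (card≤n (owned (Extend.own′ S q geo d≤Λ cheap dense))) n≤))
  complete (suc f) S n≤ | inj₂ (u , v , d , q , geo , d≤Λ , cheap , dense) =
    complete f (Extend.extended S q geo d≤Λ cheap dense)
      (≤-trans n≤ (≤-trans (≤-reflexive (sym (+-suc f _))) (+-monoʳ-≤ f (Extend.grows S q geo d≤Λ cheap dense))))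

  -- The finished system, seen through owned vertices only. In `detour` two steps lead to and from
  -- the strip, and the points reached there may be 2 farther apart than `x` and `z`; together this
  -- is the excess 4.
  record Strips : Set where
    field
      {k}    : ℕ
      own    : Ownership k
      L      : Edges
      detour : ∀ {i x z a} → own x ≡ just i → own z ≡ just i → Walk x z a → Near L x z (a + 4)
      narrow : ∀ {i x z} → own x ≡ just i → own z ≡ just i → ∃[ a ] a ≤ Λ + 2 × Walk x z a
      size   : ∀ i → M * m ≤ 3 * card (class own i)
      sparse : ∀ {u v d} → Walk u v d → d ≤ Λ →
        ∃[ d′ ] d′ ≤ d × Σ[ q ∈ Walk u v d′ ] count (heavy own) (vertices q) < m
      light  : ∀ {x y} → x ~ y → free own x ≡ true → heavy own y ≡ false → Linked L x y
      cost₁  : length L ≤ n * M + (n + k * Λ)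
      cost₂  : length L ≤ n * M + (n + (n + k * k))

    -- Classes of different strips are disjoint, and each is large by `size`.
    few : ∀ (A : Fin k → Bool) (Q : V → Bool) →
      (∀ {i x} → A i ≡ true → own x ≡ just i → Q x ≡ true) → M * m * card A ≤ 3 * card Q
    few A Q A⊆Q = begin
      M * m * card A                                       ≡⟨ *-distribˡ-sum (M * m) (bit ∘ A) ⟩
      sum (λ i → M * m * bit (A i))                        ≤⟨ sum-mono weigh ⟩
      sum (λ i → 3 * card (λ x → A i ∧ class own i x))     ≡⟨ *-distribˡ-sum 3 (λ i → card (λ x → A i ∧ class own i x)) ⟨
      3 * sum (λ i → card (λ x → A i ∧ class own i x))     ≡⟨ cong (3 *_) (∑-comm (λ i x → bit (A i ∧ class own i x))) ⟩
      3 * sum (λ x → card (λ i → A i ∧ class own i x))     ≤⟨ *-monoʳ-≤ 3 (sum-mono disjoint) ⟩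
      3 * card Q                                           ∎
      where
      open ≤-Reasoning
      weigh : ∀ i → M * m * bit (A i) ≤ 3 * card (λ x → A i ∧ class own i x)
      weigh i with A i
      ... | true  = ≤-trans (≤-reflexive (*-identityʳ (M * m))) (size i)
      ... | false = ≤-trans (≤-reflexive (*-zeroʳ (M * m))) z≤n
      class⁻ : ∀ i x → A i ∧ class own i x ≡ true → own x ≡ just i
      class⁻ i x p = dec-true⁻ (Maybe.≡-dec Fin._≟_ (own x) (just i)) (proj₂ (∧-true⁻ {A i} p))
      disjoint : ∀ x → card (λ i → A i ∧ class own i x) ≤ bit (Q x)
      disjoint x = ≤-trans
        (card-bounded {P = λ i → A i ∧ class own i x} 1 (Q x) (λ i p → A⊆Q (proj₁ (∧-true⁻ {A i} p)) (class⁻ i x p))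
          (card-single λ i j pi pj → Maybe.just-injective (trans (sym (class⁻ i x pi)) (class⁻ j x pj))))
        (≤-reflexive (*-identityˡ (bit (Q x))))

  strips : Strips
  strips with S , sparse ← complete n empty (m≤m+n n _) = record
    { own = own ; L = L ++ lights ; detour = detour ; narrow = narrow ; size = size ; sparse = sparse ; light = light
    ; cost₁ = ≤-trans length≤ (+-monoʳ-≤ (n * M) (≤-trans cost₁ (+-monoˡ-≤ _ (card≤n (owned own)))))
    ; cost₂ = ≤-trans length≤ (+-monoʳ-≤ (n * M) (≤-trans cost₂ (+-mono-≤ (card≤n (owned own)) (+-monoˡ-≤ _ (card≤n touched))))) }
    where
    open StripSystem S
    -- A vertex that is not heavy has fewer than `M` free neighbours, so all these edges together
    -- cost at most `n * M`.
    lightEdges : V → Edges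
    lightEdges y = if heavy own y then [] else proj₁ (collect (freeNeighbours own y) (λ x _ → x , y))
    lightEdges≤ : ∀ y → length (lightEdges y) ≤ M
    lightEdges≤ y with true⊎false (heavy own y)
    ... | inj₁ h rewrite h = z≤n
    ... | inj₂ l rewrite l = ≤-trans (≤-reflexive (proj₁ (proj₂ (collect (freeNeighbours own y) (λ x _ → x , y)))))
                               (<⇒≤ (≰⇒> (dec-false⁻ (M ≤? card (freeNeighbours own y)) l)))
    gathered = gather lightEdges lightEdges≤
    lights = proj₁ gathered
    length≤ : length (L ++ lights) ≤ n * M + length L
    length≤ = ≤-trans (≤-reflexive (trans (List.length-++ L) (+-comm (length L) _))) (+-monoˡ-≤ (length L) (proj₁ (proj₂ gathered)))
    light : ∀ {x y} → x ~ y → free own x ≡ true → heavy own y ≡ false → Linked (L ++ lights) x y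
    light {x} {y} x~y fx ly = inj₁ (∈-++⁺ʳ L (proj₂ (proj₂ gathered) y listed))
      where
      listed : (x , y) ∈ lightEdges y
      listed rewrite ly = proj₂ (proj₂ (collect (freeNeighbours own y) (λ x _ → x , y))) x
        (∧-true fx (dec-true (y ~? x) (~-sym x~y)))
    detour : ∀ {i x z a} → own x ≡ just i → own z ≡ just i → Walk x z a → Near (L ++ lights) x z (a + 4)
    detour {a = a} ox oz p
      with x′ , on-x , x~x′ , lx ← attached ox | z′ , on-z , z~z′ , lz ← attached oz =
      near-mono (++-⊑ˡ {L}) (near-weaken (≤-reflexive (shuffle a))
        (near-trans (near-edge x~x′ lx) (near-trans (along on-x on-z (~-sym x~x′ ∷ p ⊕ z~z′ ∷ []))
          (near-sym (near-edge z~z′ lz)))))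
      where
      shuffle : ∀ a → 1 + (1 + (a + 1) + 1) ≡ a + 4
      shuffle = solve-∀
    narrow : ∀ {i x z} → own x ≡ just i → own z ≡ just i → ∃[ a ] a ≤ Λ + 2 × Walk x z a
    narrow ox oz
      with x′ , on-x , x~x′ , _ ← attached ox | z′ , on-z , z~z′ , _ ← attached oz
      with a , a≤Λ , p ← short on-x on-z =
      suc (a + 1) , ≤-trans (≤-reflexive (sym (+-suc a 1))) (+-monoˡ-≤ 2 a≤Λ) , x~x′ ∷ p ⊕ ~-sym z~z′ ∷ []

-- Walking along strips

module Detours {n : ℕ} (G : Graph n) {M Λ m : ℕ} (0<M : 1 ≤ M) (0<m : 1 ≤ m) (S : Strips.Strips G {M} {Λ} {m} 0<M 0<m) where
  open Walks G
  open Rerouting G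
  open Balls G
  open Strips G {M} {Λ} {m} 0<M 0<m
  open Strips.Strips S

  cut : ∀ a {u v d} (p : Walk u v d) → a ≤ d → ∃[ w ] Split p w a
  cut zero    p       _         = _ , mkSplit [] p refl refl
  cut (suc a) (e ∷ p) (s≤s a≤d) with w , mkSplit f b t l ← cut a p a≤d = w , mkSplit (e ∷ f) b (cong suc t) (cong (_ ∷_) l)

  front-∈ : ∀ {u v d w a} {p : Walk u v d} (s : Split p w a) {y} → y ∈ vertices (Split.front s) → y ∈ vertices p
  front-∈ s (here eq)  = here eq
  front-∈ s (there y∈) = there (subst (_ ∈_) (sym (Split.later≡ s)) (∈-++⁺ˡ y∈))

  back-∈ : ∀ {u v d w a} {p : Walk u v d} (s : Split p w a) {y} → y ∈ vertices (Split.back s) → y ∈ vertices p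
  back-∈ s (here refl) = front-∈ s (end-∈ (Split.front s))
  back-∈ s (there y∈)  = there (later-back s y∈)

  Within : ℕ → List V → V → Set
  Within r xs y = ∃[ z ] z ∈ xs × ∃[ a ] a ≤ r × Walk z y a

  -- The walk is cut every `Λ` steps and each block is replaced by `sparse`. A replacement stays
  -- within `Λ` of the start of its block, which lies on the original walk.
  blocks : ∀ b {x v d} → d ≤ b * Λ → (q : Walk x v d) → ∃[ d′ ] d′ ≤ d × Σ[ q′ ∈ Walk x v d′ ]
    count (heavy own) (later q′) ≤ b * m × (∀ {y} → y ∈ vertices q′ → Within Λ (vertices q) y)
  blocks zero    z≤n [] = 0 , z≤n , [] , z≤n , λ { (here refl) → _ , here refl , 0 , z≤n , [] }
  blocks (suc b) {x} {v} {d} d≤ q with d ≤? Λ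
  ... | yes d≤Λ with d′ , d′≤d , q′ , few′ ← sparse q d≤Λ =
    d′ , d′≤d , q′ , ≤-trans (m≤n+m _ (bit (heavy own x))) (≤-trans (<⇒≤ few′) (m≤m+n m (b * m))) , within
    where
    within : ∀ {y} → y ∈ vertices q′ → Within Λ (vertices q) y
    within y∈ with a , s ← split-∈ q′ y∈ = x , here refl , a ,
      ≤-trans (m≤m+n a _) (≤-trans (≤-reflexive (Split.total s)) (≤-trans d′≤d d≤Λ)) , Split.front s
  ... | no d≰Λ
    with w , s ← cut Λ q (<⇒≤ (≰⇒> d≰Λ))
    with d₁ , d₁≤Λ , q₁ , few₁ ← sparse (Split.front s) ≤-refl
       | d₂ , d₂≤ , q₂ , few₂ , within₂ ← blocks b (+-cancelˡ-≤ Λ _ _ (≤-trans (≤-reflexive (Split.total s)) d≤)) (Split.back s) =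
    d₁ + d₂ , ≤-trans (+-mono-≤ d₁≤Λ d₂≤) (≤-reflexive (Split.total s)) , q₁ ⊕ q₂ , few-heavy , within
    where
    few-heavy : count (heavy own) (later (q₁ ⊕ q₂)) ≤ m + b * m
    few-heavy = begin
      count (heavy own) (later (q₁ ⊕ q₂))                              ≡⟨ cong (count (heavy own)) (later-⊕ q₁ q₂) ⟩
      count (heavy own) (later q₁ ++ later q₂)                         ≡⟨ count-++ (heavy own) (later q₁) (later q₂) ⟩
      count (heavy own) (later q₁) + count (heavy own) (later q₂)      ≤⟨ +-mono-≤ (≤-trans (m≤n+m _ (bit (heavy own x))) (<⇒≤ few₁)) few₂ ⟩
      m + b * m                                                        ∎
      where open ≤-Reasoning
    first : ∀ {y} → y ∈ vertices q₁ → Within Λ (vertices q) y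
    first y∈ with a , t ← split-∈ q₁ y∈ = x , here refl , a ,
      ≤-trans (m≤m+n a _) (≤-trans (≤-reflexive (Split.total t)) d₁≤Λ) , Split.front t
    second : ∀ {y} → y ∈ vertices q₂ → Within Λ (vertices q) y
    second y∈ with z , z∈ , near ← within₂ y∈ = z , back-∈ s z∈ , near
    within : ∀ {y} → y ∈ vertices (q₁ ⊕ q₂) → Within Λ (vertices q) y
    within (here eq) = first (here eq)
    within (there y∈) with ∈-++⁻ (later q₁) (subst (_ ∈_) (later-⊕ q₁ q₂) y∈)
    ... | inj₁ y∈₁ = first (there y∈₁)
    ... | inj₂ y∈₂ = second (there y∈₂)

  module _ {Y : Edges} {κ : ℕ} (L⊑Y : L ⊑ Y) (patch : ∀ {u v} → u ~ v → Near Y u v κ) where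

    -- Each owner is left for good at its last vertex on the walk, so it
    -- causes at most one detour of excess 4 and one patched edge.
    walk-along : ∀ f {x v d} → d ≤ f → (q : Walk x v d) (A : Fin k → Bool) →
      (∀ {i y} → y ∈ vertices q → own y ≡ just i → A i ≡ true) →
      Near Y x v (d + ((4 + κ) * card A + κ * count (heavy own) (later q)))
    walk-along f d≤f [] A avail = near-weaken z≤n near-refl
    walk-along (suc f) {x} {v} {suc d} (s≤s d≤f) (_∷_ {w = y} e q) A avail = cases (own x) refl
      where
      open ≤-Reasoning
      h : List V → ℕ
      h = count (heavy own)
      Goal = Near Y x v (suc d + ((4 + κ) * card A + κ * h (y ∷ later q)))
      cases : (o : Maybe (Fin k)) → own x ≡ o → Goal
      -- An edge from an unowned vertex can be missing from `L` only if it enters a heavy vertex,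
      -- and the patch is charged to that vertex.
      cases nothing free-x with rec ← walk-along f d≤f q A (avail ∘ there) with true⊎false (heavy own y)
      ... | inj₂ light-y = near-weaken (+-monoʳ-≤ (suc d) (+-monoʳ-≤ _ (*-monoʳ-≤ κ (m≤n+m _ (bit (heavy own y))))))
        (near-trans (near-edge e (L⊑Y (light e (cong Maybe.is-nothing free-x) light-y))) rec)
      ... | inj₁ heavy-y = near-weaken (begin
          κ + (d + ((4 + κ) * card A + κ * h (later q)))               ≡⟨ shuffle κ d ((4 + κ) * card A) (h (later q)) ⟩
          d + ((4 + κ) * card A + κ * (1 + h (later q)))               ≡⟨ cong (λ b → d + ((4 + κ) * card A + κ * (bit b + h (later q)))) heavy-y ⟨
          d + ((4 + κ) * card A + κ * h (y ∷ later q))                 ≤⟨ n≤1+n _ ⟩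
          suc d + ((4 + κ) * card A + κ * h (y ∷ later q))             ∎)
        (near-trans (patch e) rec)
        where
        shuffle : ∀ κ d a h → κ + (d + (a + κ * h)) ≡ d + (a + κ * (1 + h))
        shuffle = solve-∀
      cases (just i) own-x
        with z , a , s , own-z , none ← last-from (class own i) (e ∷ q) (dec-true (Maybe.≡-dec Fin._≟_ (own x) (just i)) own-x) =
        leave s none (near-mono L⊑Y (detour own-x (dec-true⁻ (Maybe.≡-dec Fin._≟_ (own z) (just i)) own-z) (Split.front s)))
        where
        rest : Fin k → Bool
        rest = A ∖ λ j → does (j Fin.≟ i)
        rest< : suc (card rest) ≤ card A
        rest< = card-mono-< {P = rest} {A} (λ j p → proj₁ (∧-true⁻ {A j} p)) i
          (trans (cong (λ b → A i ∧ not b) (dec-true (i Fin.≟ i) refl)) (Bool.∧-zeroʳ (A i)))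
          (avail (here refl) own-x)
        leave : ∀ {z a} (s : Split (e ∷ q) z a) →
          (∀ {y} → y ∈ later (Split.back s) → class own i y ≡ true → ⊥) → Near Y x z (a + 4) → Goal
        leave {a = a} (mkSplit front [] total _) none near = near-weaken (begin
          a + 4                                                       ≤⟨ +-mono-≤ (≤-reflexive (trans (sym (+-identityʳ a)) total)) (m≤m+n 4 κ) ⟩
          suc d + (4 + κ)                                             ≡⟨ cong (suc d +_) (*-identityʳ (4 + κ)) ⟨
          suc d + (4 + κ) * 1                                         ≤⟨ +-monoʳ-≤ (suc d) (*-monoʳ-≤ (4 + κ) (≤-trans (s≤s z≤n) rest<)) ⟩
          suc d + (4 + κ) * card A                                    ≤⟨ +-monoʳ-≤ (suc d) (m≤m+n _ _) ⟩
          suc d + ((4 + κ) * card A + κ * h (y ∷ later q))            ∎) near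
        leave {a = a} s@(mkSplit front (_∷_ {w = w} {d = b} e′ back) total later≡) none near =
          near-weaken (begin
          a + 4 + (κ + (b + ((4 + κ) * card rest + κ * h (later back))))  ≡⟨ shuffle a b κ (card rest) (h (later back)) ⟩
          a + b + ((4 + κ) * suc (card rest) + κ * h (later back))        ≤⟨ +-mono-≤ ab≤ (+-mono-≤ (*-monoʳ-≤ (4 + κ) rest<) (*-monoʳ-≤ κ h≤)) ⟩
          suc d + ((4 + κ) * card A + κ * h (y ∷ later q))                ∎)
          (near-trans near (near-trans (patch e′)
            (walk-along f b≤f back rest λ {j} {y} y∈ own-y → ∖-true {P = λ j → does (j Fin.≟ i)} {A}
              (avail (back-∈ s (there y∈)) own-y)
              (dec-false (j Fin.≟ i) λ { refl → none y∈ (dec-true (Maybe.≡-dec Fin._≟_ (own y) (just i)) own-y) }))))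
          where
          shuffle : ∀ a b κ r h → a + 4 + (κ + (b + ((4 + κ) * r + κ * h))) ≡ a + b + ((4 + κ) * suc r + κ * h)
          shuffle = solve-∀
          ab≤ : a + b ≤ suc d
          ab≤ = ≤-trans (+-monoʳ-≤ a (n≤1+n b)) (≤-reflexive total)
          b≤f : b ≤ f
          b≤f = ≤-trans (+-cancelˡ-≤ 1 b d (≤-trans (≤-trans (m≤n+m (suc b) a) (≤-reflexive total)) ≤-refl)) d≤f
          h≤ : h (later back) ≤ h (y ∷ later q)
          h≤ = begin
            h (later back)                             ≤⟨ m≤n+m _ (bit (heavy own w)) ⟩
            h (w ∷ later back)                         ≤⟨ m≤n+m _ (h (later front)) ⟩
            h (later front) + h (w ∷ later back)       ≡⟨ count-++ (heavy own) (later front) (w ∷ later back) ⟨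
            h (later front ++ w ∷ later back)          ≡⟨ cong h later≡ ⟨
            h (y ∷ later q)                            ∎

    -- The radius allows `Λ` from the original walk to its rerouted blocks and `Λ + 2` across the
    -- class of a strip met there, so the corridor contains these classes entirely.
    corridor : List V → V → Bool
    corridor xs = around (_∈ᵇ xs) (Λ + (Λ + 2))

    thin-walk : ∀ b {x v d} → d ≤ b * Λ → (q : Walk x v d) → ∃[ a ]
      M * m * a ≤ 3 * card (corridor (vertices q)) × Near Y x v (d + ((4 + κ) * a + κ * (b * m)))
    thin-walk b {x} {v} {d} d≤ q with d′ , d′≤d , q′ , few-heavy , within ← blocks b d≤ q =
      card A , few A Q (λ {i} {x} Ai own-x → dec-true⁻ (inside? i) Ai x own-x) ,
      near-weaken (+-mono-≤ d′≤d (+-monoʳ-≤ _ (*-monoʳ-≤ κ few-heavy))) (walk-along d′ ≤-refl q′ A avail)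
      where
      Q : V → Bool
      Q = corridor (vertices q)
      inside? : ∀ i → Dec (∀ x → own x ≡ just i → Q x ≡ true)
      inside? i = all? λ x → Maybe.≡-dec Fin._≟_ (own x) (just i) →-dec (Q x Bool.≟ true)
      -- Taking all strips whose class lies in the corridor, rather than those met by the walk,
      -- gives exactly the hypothesis of `few`; the strips met are among them by the choice of
      -- radius.
      A : Fin k → Bool
      A i = does (inside? i)
      avail : ∀ {i y} → y ∈ vertices q′ → own y ≡ just i → A i ≡ true
      avail {i} y∈ own-y = dec-true (inside? i) λ x own-x →
        let z , z∈ , c , c≤ , p = within y∈
            c′ , c′≤ , p′ = narrow own-y own-x
        in around-walk (∈ᵇ⁺ z∈) (p ⊕ p′) (+-mono-≤ c≤ c′≤)

  geodesic-size : ∀ {u v d} (p : Walk u v d) → Geodesic u v d → ∀ (Q : V → Bool) →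
    (∀ {x} → x ∈ vertices p → Q x ≡ true) → suc d ≤ card Q
  geodesic-size {u} {v} {d} p geo Q ⊆Q = begin
    suc d                             ≡⟨ cong suc (length-later p) ⟨
    length (vertices p)               ≡⟨ trans (sum-const (length (vertices p)) 1) (*-identityʳ _) ⟨
    count (λ _ → true) (vertices p)   ≤⟨ count≤card p geo (λ _ → true) Q (λ x∈ _ → ⊆Q x∈) ⟩
    card Q                            ∎
    where open ≤-Reasoning

-- Path buying between the members of a list of vertices

module Subset {n : ℕ} (G : Graph n) {M : ℕ} (0<M : 1 ≤ M) (stars : Strips.Strips G {M} {0} {1} 0<M (s≤s z≤n))
  (S : List (Fin n)) where
  open Walks G
  open Rerouting G
  open Strips G {M} {0} {1} 0<M (s≤s z≤n)
  open Strips.Strips stars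

  σ : ℕ
  σ = length S

  at : Fin σ → V
  at = lookup S

  -- With `Λ = 0` the strips are single vertices and their classes stars; with `m = 1`, sparsity of
  -- the trivial walk at `x` excludes that `x` is heavy.
  no-heavy : ∀ x → heavy own x ≡ false
  no-heavy x with true⊎false (heavy own x)
  ... | inj₂ l = l
  ... | inj₁ h with 0 , z≤n , [] , few ← sparse {x} [] z≤n =
    ⊥-elim (<⇒≱ few (≤-trans (≤-reflexive (cong bit (sym h))) (m≤m+n _ 0)))

  -- An edge into an unowned vertex is light, since its other end is not heavy, and is therefore in
  -- `L` already.
  new≤owned : ∀ {Y} → L ⊑ Y → ∀ {u v d} (p : Walk u v d) → length (new Y p) ≤ count (owned own) (later p)
  new≤owned L⊑Y [] = z≤n
  new≤owned {Y} L⊑Y (_∷_ {u} {w} e p) with linked? Y u w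
  ... | yes _ = ≤-trans (new≤owned L⊑Y p) (m≤n+m _ (bit (owned own w)))
  ... | no ¬l with own w in own-w
  ...   | just _  = s≤s (new≤owned L⊑Y p)
  ...   | nothing = ⊥-elim (¬l ([ inj₂ , inj₁ ]′ (L⊑Y (light (~-sym e) (cong Maybe.is-nothing own-w) (no-heavy u)))))

  -- `good i a` means that star `i` is reached from `at a` with excess at most 2 over the distance
  -- to any of its members. `cost` is a potential argument: three edges may be bought for every pair
  -- that becomes good.
  record Bought : Set where
    field
      Y    : Edges
      L⊑Y  : L ⊑ Y
      good : Fin k → Fin σ → Bool
      reaches : ∀ {i a} → good i a ≡ true →
        ∃[ x ] own x ≡ just i × (∀ {y c} → own y ≡ just i → Walk (at a) y c → Near Y (at a) x (c + 2))
      cost : length Y ≤ length L + 3 * sum (λ i → card (good i))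

  Served : Edges → Fin σ × Fin σ → Set
  Served Y (a , b) = ∀ {d} → Walk (at a) (at b) d → Near Y (at a) (at b) (d + 10)

  module Buy (B : Bought) (a b : Fin σ) {d} (p : Walk (at a) (at b) d) (geo : Geodesic (at a) (at b) d) where
    open Bought B

    meets : Fin k → Bool
    meets i = does (Any.any? (λ x → Maybe.≡-dec Fin._≟_ (own x) (just i)) (vertices p))

    meets⁻ : ∀ {i} → meets i ≡ true → ∃[ x ] x ∈ vertices p × own x ≡ just i
    meets⁻ {i} m with x , x∈ , eq ← find (dec-true⁻ (Any.any? (λ x → Maybe.≡-dec Fin._≟_ (own x) (just i)) (vertices p)) m) = x , x∈ , eq

    meets⁺ : ∀ {i x} → x ∈ vertices p → own x ≡ just i → meets i ≡ true
    meets⁺ x∈ eq = dec-true (Any.any? _ (vertices p)) (lose x∈ eq)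

    -- The two estimates meet inside a common cluster.
    shortcut : ∀ {i} → meets i ≡ true → good i a ≡ true → good i b ≡ true → Near Y (at a) (at b) (d + 10)
    shortcut m ga gb
      with z , z∈ , own-z ← meets⁻ m | x , own-x , to-x ← reaches ga | y , own-y , to-y ← reaches gb
      with α , mkSplit {β} front back total _ ← split-∈ p z∈ | c , c≤2 , q ← narrow own-x own-y =
      near-weaken (begin
        -- The excess 10 is 2 for each use of `reaches` and `2 + 4` for crossing the star by
        -- `detour`.
        α + 2 + (c + 4 + (β + 2))   ≤⟨ +-monoʳ-≤ (α + 2) (+-monoˡ-≤ (β + 2) (+-monoˡ-≤ 4 c≤2)) ⟩
        α + 2 + (2 + 4 + (β + 2))   ≡⟨ shuffle α β ⟩
        α + β + 10                  ≡⟨ cong (_+ 10) total ⟩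
        d + 10                      ∎)
      (near-trans (to-x own-z front) (near-trans (near-mono L⊑Y (detour own-x own-y q)) (near-sym (to-y own-z (reverse back)))))
      where
      open ≤-Reasoning
      shuffle : ∀ α β → α + 2 + (2 + 4 + (β + 2)) ≡ α + β + 10
      shuffle = solve-∀

    module _ (needed : ∀ i → ¬ (meets i ≡ true × good i a ≡ true × good i b ≡ true)) where

      Y′ : Edges
      Y′ = Y ++ new Y p

      ends : Fin σ → Bool
      ends c = does (c Fin.≟ a) ∨ does (c Fin.≟ b)

      good′ : Fin k → Fin σ → Bool
      good′ i c = good i c ∨ (meets i ∧ ends c)

      realised = realise (++-⊑ˡ {Y}) p (∈-++⁺ʳ Y)

      along : ∀ {y z c} → y ∈ vertices p → z ∈ vertices p → Walk y z c → Near Y′ y z c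
      along {y} {z} y∈ z∈ = along-geodesic (proj₁ realised) geo
        (subst (λ l → y ∈ at a ∷ l) (sym (proj₂ realised)) y∈) (subst (λ l → z ∈ at a ∷ l) (sym (proj₂ realised)) z∈)

      end : ∀ c → ends c ≡ true → at c ∈ vertices p
      end c e with ∨-true⁻ {does (c Fin.≟ a)} e
      ... | inj₁ ea = here (cong at (dec-true⁻ (c Fin.≟ a) ea))
      ... | inj₂ eb = subst (λ c → at c ∈ vertices p) (sym (dec-true⁻ (c Fin.≟ b) eb)) (end-∈ p)

      reaches′ : ∀ {i c} → good′ i c ≡ true →
        ∃[ x ] own x ≡ just i × (∀ {y l} → own y ≡ just i → Walk (at c) y l → Near Y′ (at c) x (l + 2))
      reaches′ {i} {c} g with ∨-true⁻ {good i c} g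
      ... | inj₁ old with x , own-x , near ← reaches old =
        x , own-x , λ own-y q → near-mono (++-⊑ˡ {Y}) (near own-y q)
      ... | inj₂ me with m , e ← ∧-true⁻ {meets i} me with x , x∈ , own-x ← meets⁻ m =
        x , own-x , λ {y} {l} own-y q →
          let c′ , c′≤2 , r = narrow own-y own-x in
          near-weaken (+-monoʳ-≤ l c′≤2) (along (end c e) x∈ (q ⊕ r))

      -- Every new edge enters an owned vertex, and a geodesic has at most three vertices in a star,
      -- whose members are at mutual distance at most 2.
      new≤ : length (new Y p) ≤ 3 * card meets
      new≤ = begin
        length (new Y p)                                 ≤⟨ new≤owned L⊑Y p ⟩
        count (owned own) (later p)                      ≤⟨ m≤n+m _ (bit (owned own (at a))) ⟩
        count (owned own) (vertices p)                   ≡⟨ *-identityˡ _ ⟨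
        1 * count (owned own) (vertices p)               ≤⟨ double-count (λ j → owned own (vertex j)) (λ j i → class own i (vertex j)) meets 1 3 lower inside upper ⟩
        3 * card meets                                   ∎
        where
        open ≤-Reasoning
        vertex = lookup (vertices p)
        class⁻ : ∀ i x → class own i x ≡ true → own x ≡ just i
        class⁻ i x = dec-true⁻ (Maybe.≡-dec Fin._≟_ (own x) (just i))
        lower : ∀ j → owned own (vertex j) ≡ true → 1 ≤ card (λ i → class own i (vertex j))
        lower j o with i , eq ← owned⁻ own {vertex j} o =
          card-positive (λ i → class own i (vertex j)) i (dec-true (Maybe.≡-dec Fin._≟_ (own (vertex j)) (just i)) eq)
        inside : ∀ j i → owned own (vertex j) ≡ true → class own i (vertex j) ≡ true → meets i ≡ true
        inside j i _ c = meets⁺ (∈-lookup j) (class⁻ i (vertex j) c)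
        upper : ∀ i → card (λ j → owned own (vertex j) ∧ class own i (vertex j)) ≤ 3
        upper i = close-count p geo (λ x → owned own x ∧ class own i x) 2 λ {x} {z} px pz →
          narrow (class⁻ i x (proj₂ (∧-true⁻ {owned own x} px))) (class⁻ i z (proj₂ (∧-true⁻ {owned own z} pz)))

      -- By `needed`, a star met by the path is not yet good for one of the two ends, and buying the
      -- path makes it good for both.
      gain : ∀ i → bit (meets i) + card (good i) ≤ card (good′ i)
      gain i with true⊎false (meets i)
      ... | inj₂ ¬m = ≤-trans (≤-reflexive (cong (λ b → bit b + card (good i)) ¬m))
                        (card-mono {P = good i} {good′ i} λ c → ∨-trueˡ)
      ... | inj₁ m = ≤-trans (≤-reflexive (cong (λ b → bit b + card (good i)) m)) increase
        where
        improve : ∀ c → good i c ≡ false → ends c ≡ true → card (good i) < card (good′ i)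
        improve c bad e = card-mono-< {P = good i} {good′ i} (λ c → ∨-trueˡ) c bad (∨-trueʳ (good i c) (∧-true m e))
        increase : card (good i) < card (good′ i)
        increase with true⊎false (good i a) | true⊎false (good i b)
        ... | inj₂ bad | _        = improve a bad (∨-trueˡ (dec-true (a Fin.≟ a) refl))
        ... | inj₁ _   | inj₂ bad = improve b bad (∨-trueʳ (does (b Fin.≟ a)) (dec-true (b Fin.≟ b) refl))
        ... | inj₁ ga  | inj₁ gb  = ⊥-elim (needed i (m , ga , gb))

      cost′ : length Y′ ≤ length L + 3 * sum (λ i → card (good′ i))
      cost′ = begin
        length Y′                                                           ≡⟨ List.length-++ Y ⟩
        length Y + length (new Y p)                                         ≤⟨ +-mono-≤ cost new≤ ⟩
        length L + 3 * sum (λ i → card (good i)) + 3 * card meets           ≡⟨ shuffle (length L) (sum (λ i → card (good i))) (card meets) ⟩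
        length L + 3 * (card meets + sum (λ i → card (good i)))             ≡⟨ cong (λ s → length L + 3 * s) (∑-distrib-+ (bit ∘ meets) (λ i → card (good i))) ⟨
        length L + 3 * sum (λ i → bit (meets i) + card (good i))            ≤⟨ +-monoʳ-≤ (length L) (*-monoʳ-≤ 3 (sum-mono gain)) ⟩
        length L + 3 * sum (λ i → card (good′ i))                           ∎
        where
        open ≤-Reasoning
        shuffle : ∀ l s m → l + 3 * s + 3 * m ≡ l + 3 * (m + s)
        shuffle = solve-∀

      bought : Bought
      bought = record
        { Y = Y′ ; L⊑Y = λ l → ++-⊑ˡ {Y} (L⊑Y l) ; good = good′ ; reaches = λ {i} → reaches′ {i} ; cost = cost′ }

  serve : (B : Bought) (ab : Fin σ × Fin σ) →
    Σ[ B′ ∈ Bought ] Bought.Y B ⊑ Bought.Y B′ × Served (Bought.Y B′) ab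
  serve B (a , b) with distance (at a) (at b)
  ... | ⊤⁺ , none = B , (λ l → l) , λ p → ⊥-elim (none p)
  ... | ⟨ d ⟩ , p , geo
    with any? (λ i → (Buy.meets B a b p geo i Bool.≟ true) ×-dec (Bought.good B i a Bool.≟ true) ×-dec (Bought.good B i b Bool.≟ true))
  ...   | yes (i , m , ga , gb) = B , (λ l → l) ,
    λ q → near-weaken (+-monoˡ-≤ 10 (geo q)) (Buy.shortcut B a b p geo m ga gb)
  ...   | no none = Buy.bought B a b p geo needed , ++-⊑ˡ {Bought.Y B} ,
    λ q → near-weaken (m≤m+n _ 10) (Buy.along B a b p geo needed (here refl) (end-∈ p) q)
    where
    needed = λ i mg → none (i , mg)

  serve-all : (ps : List (Fin σ × Fin σ)) → Σ[ B ∈ Bought ] (∀ {ab} → ab ∈ ps → Served (Bought.Y B) ab)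
  serve-all [] = record
    { Y = L ; L⊑Y = λ l → l ; good = λ _ _ → false ; reaches = λ () ; cost = m≤m+n _ _ } , λ ()
  serve-all (ab ∷ ps) with B , served ← serve-all ps with B′ , Y⊑ , served′ ← serve B ab =
    B′ , λ { (here refl) → served′ ; (there ab∈) p → near-mono Y⊑ (served ab∈ p) }

  subset-spanner : ∃[ Y ] L ⊑ Y × length Y ≤ length L + 3 * (k * σ) ×
    (∀ {s t d} → s ∈ S → t ∈ S → Walk s t d → Near Y s t (d + 10))
  subset-spanner with B , served ← serve-all (cartesianProduct (allFin σ) (allFin σ)) =
    Y , L⊑Y , ≤-trans cost (+-monoʳ-≤ (length L) (*-monoʳ-≤ 3 total)) , near
    where
    open Bought B
    total : sum (λ i → card (good i)) ≤ k * σ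
    total = ≤-trans (sum-mono (λ i → card≤n (good i))) (≤-reflexive (sum-const k σ))
    near : ∀ {s t d} → s ∈ S → t ∈ S → Walk s t d → Near Y s t (d + 10)
    near {s} {t} {d} s∈ t∈ p =
      subst₂ (λ s t → Near Y s t (d + 10)) (sym (lookup-index s∈)) (sym (lookup-index t∈))
        (served (∈-cartesianProduct⁺ (∈-allFin (Any.index s∈)) (∈-allFin (Any.index t∈)))
          (subst₂ (λ s t → Walk s t d) (lookup-index s∈) (lookup-index t∈) p))

-- Assembling the spanner

take-length-++ : ∀ {A : Set} (xs ys : List A) → take (length xs) (xs ++ ys) ≡ xs
take-length-++ []       ys = refl
take-length-++ (x ∷ xs) ys = cong (x ∷_) (take-length-++ xs ys)

drop-length-++ : ∀ {A : Set} (xs ys : List A) → drop (length xs) (xs ++ ys) ≡ ys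
drop-length-++ []       ys = refl
drop-length-++ (x ∷ xs) ys = drop-length-++ xs ys

module Assembly {n : ℕ} (G : Graph n) {N M Λ m W t b α : ℕ}
  (n<2^N : n < 2 ^ N) (0<M : 1 ≤ M) (0<m : 1 ≤ m) (0<W : 1 ≤ W) (0<t : 1 ≤ t)
  (n≤tW : n ≤ t * W) (W≤bΛ : W ≤ b * Λ) (α-bound : ∀ a → M * m * a ≤ 3 * W → a ≤ α) where
  open Walks G
  open Rerouting G
  open Balls G

  abstract
    spanner : ∃[ L ] length L ≤ 2 * n × (∀ {u v} → u ~ v → Near L u v (2 * N))
    spanner = logarithmic-spanner N n<2^N

    S : Strips.Strips G {M} {Λ} {m} 0<M 0<m
    S = Strips.strips G 0<M 0<m

    stars : Strips.Strips G {M} {0} {1} 0<M (s≤s z≤n)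
    stars = Strips.strips G 0<M (s≤s z≤n)

  module S = Strips.Strips S
  module Stars = Strips.Strips stars
  open Detours G 0<M 0<m S

  -- `E` is the error of a thin piece: at most `α` strips are met, and each of `b` blocks has at
  -- most `m` heavy vertices that require a patch.
  radius κ E : ℕ
  radius = Λ + (Λ + 2)
  κ = 2 * N
  E = (4 + κ) * α + κ * (b * m)

  reach : List V → V → Bool
  reach xs = around (_∈ᵇ xs) radius

  -- The end pieces outside the neighbourhood of the hitting set are a prefix and a suffix of the
  -- chosen geodesic. Where they are cut depends on the hitting set, so all cuts are listed
  -- beforehand.
  corridors : ∀ u v → ∃ (Graph.IsDistance G u v) → List (V → Bool)
  corridors u v (⊤⁺ , _)        = []
  corridors u v (⟨ d ⟩ , p , _) = map (λ i → reach (take i (vertices p))) (upTo (suc n)) ++ map (λ i → reach (drop i (vertices p))) (upTo (suc n))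

  corridors-length : ∀ u v D → length (corridors u v D) ≤ suc n + suc n
  corridors-length u v (⊤⁺ , _) = z≤n
  corridors-length u v (⟨ d ⟩ , p , _) = ≤-reflexive (trans (List.length-++ (map (λ i → reach (take i (vertices p))) (upTo (suc n))))
    (cong₂ _+_ (trans (List.length-map _ (upTo (suc n))) (List.length-upTo (suc n))) (trans (List.length-map _ (upTo (suc n))) (List.length-upTo (suc n)))))

  abstract
    from : ∀ u → ∃[ Ps ] length Ps ≤ n * (suc n + suc n) × (∀ v {P} → P ∈ corridors u v (distance u v) → P ∈ Ps)
    from u = gather (λ v → corridors u v (distance u v)) (λ v → corridors-length u v (distance u v))

    family : ∃[ Ps ] length Ps ≤ n * (n * (suc n + suc n)) × (∀ u {P} → P ∈ proj₁ (from u) → P ∈ Ps)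
    family = gather (λ u → proj₁ (from u)) (λ u → proj₁ (proj₂ (from u)))

  large? : (P : V → Bool) → Dec (W ≤ card P)
  large? P = W ≤? card P

  -- There are at most `2 * n * n * suc n` corridors, fewer than `2 ^ j`.
  j : ℕ
  j = 2 + 3 * N

  family-size : length (filter large? (proj₁ family)) < 2 ^ j
  family-size = begin-strict
    length (filter large? (proj₁ family))         ≤⟨ List.length-filter large? (proj₁ family) ⟩
    length (proj₁ family)                         ≤⟨ proj₁ (proj₂ family) ⟩
    n * (n * (suc n + suc n))                     ≤⟨ *-mono-≤ (<⇒≤ n<2^N) (*-mono-≤ (<⇒≤ n<2^N) (+-mono-≤ n<2^N n<2^N)) ⟩
    2 ^ N * (2 ^ N * (2 ^ N + 2 ^ N))             ≡⟨ shuffle (2 ^ N) ⟩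
    2 * (2 ^ N) ^ 3                               ≡⟨ cong (2 *_) (trans (^-*-assoc 2 N 3) (cong (2 ^_) (*-comm N 3))) ⟩
    2 ^ suc (3 * N)                               <⟨ ^-monoʳ-< 2 (s≤s (s≤s z≤n)) {suc (3 * N)} {j} ≤-refl ⟩
    2 ^ j                                         ∎
    where
    open ≤-Reasoning
    shuffle : ∀ x → x * (x * (x + x)) ≡ 2 * (x * (x * (x * 1)))
    shuffle = solve-∀

  abstract
    hitters : ∃[ S ] length S ≤ j * t × (∀ {P} → P ∈ filter large? (proj₁ family) → Hit S P)
    hitters = Hitting.hitting 0<W 0<t n≤tW j (filter large? (proj₁ family))
      (λ P∈ → proj₂ (∈-filter⁻ large? {xs = proj₁ family} P∈)) family-size

  H : List V
  H = proj₁ hitters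

  hit : ∀ u v {P} → P ∈ corridors u v (distance u v) → W ≤ card P → Hit H P
  hit u v P∈ large = proj₂ (proj₂ hitters) (∈-filter⁺ large? (proj₂ (proj₂ family) u (proj₂ (proj₂ (from u)) v P∈)) large)

  abstract
    subset : ∃[ Y ] Stars.L ⊑ Y × length Y ≤ length Stars.L + 3 * (Stars.k * length H) ×
      (∀ {s t d} → s ∈ H → t ∈ H → Walk s t d → Near Y s t (d + 10))
    subset = Subset.subset-spanner G 0<M stars H

  nearH : V → Bool
  nearH = reach H

  abstract
    trees : ∃[ L ] length L ≤ card nearH × (∀ {y} → nearH y ≡ true → ∃[ s ] s ∈ᵇ H ≡ true × Near L s y radius)
    trees = forest radius

  L₁ L₂ L₃ L₄ Y : Edges
  L₁ = proj₁ spanner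
  L₂ = S.L
  L₃ = proj₁ subset
  L₄ = proj₁ trees
  Y = L₁ ++ (L₂ ++ (L₃ ++ L₄))

  L₂⊑Y : L₂ ⊑ Y
  L₂⊑Y l = ++-⊑ʳ L₁ (++-⊑ˡ {L₂} l)

  L₃⊑Y : L₃ ⊑ Y
  L₃⊑Y l = ++-⊑ʳ L₁ (++-⊑ʳ L₂ (++-⊑ˡ {L₃} l))

  L₄⊑Y : L₄ ⊑ Y
  L₄⊑Y l = ++-⊑ʳ L₁ (++-⊑ʳ L₂ (++-⊑ʳ L₃ l))

  patch : ∀ {u v} → u ~ v → Near Y u v κ
  patch e = near-mono (++-⊑ˡ {L₁}) (proj₂ (proj₂ spanner) e)

  -- A geodesic lies inside its own corridor, so it has fewer than `W ≤ b * Λ` vertices and `b`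
  -- blocks cover it.
  thin : ∀ {x v d} (q : Walk x v d) → Geodesic x v d → card (reach (vertices q)) < W → Near Y x v (d + E)
  thin {d = d} q geo <W =
    let a , Mma≤ , near = thin-walk L₂⊑Y patch b d≤bΛ q in
    near-weaken (+-monoʳ-≤ d (+-monoˡ-≤ _ (*-monoʳ-≤ (4 + κ) (α-bound a (≤-trans Mma≤ (*-monoʳ-≤ 3 (<⇒≤ <W))))))) near
    where
    d≤bΛ : d ≤ b * Λ
    d≤bΛ = ≤-trans (<⇒≤ (≤-trans (geodesic-size q geo (reach (vertices q)) (λ {x} x∈ → around-walk {_∈ᵇ vertices q} {i = radius} (∈ᵇ⁺ {x} {vertices q} x∈) [] z≤n)) (<⇒≤ <W))) W≤bΛ

  Away : List V → Set
  Away xs = ∀ {y} → y ∈ xs → nearH y ≡ true → ⊥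

  -- A member of the hitting set inside the corridor would be within `radius` of some vertex of
  -- `xs`, contrary to `Away`.
  away-small : ∀ {xs} → (W ≤ card (reach xs) → Hit H (reach xs)) → Away xs → card (reach xs) < W
  away-small {xs} hits away with W ≤? card (reach xs)
  ... | no small = ≰⇒> small
  ... | yes large with s , s∈ , near ← hits large with z , z∈ , d , d≤ , p ← around⁻ {_∈ᵇ xs} {radius} {s} near =
    ⊥-elim (away (∈ᵇ⁻ {z} z∈) (around-walk {_∈ᵇ H} {i = radius} (∈ᵇ⁺ {s} {H} s∈) (reverse p) d≤))

  first-near : ∀ {u v d} (p : Walk u v d) → Away (vertices p) ⊎ nearH u ≡ true ⊎
    (∃[ w ] ∃[ w′ ] ∃[ a ] ∃[ c ] Σ[ q ∈ Walk u w a ] Σ[ e ∈ w ~ w′ ] Σ[ r ∈ Walk w′ v c ]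
      a + suc c ≡ d × later p ≡ later q ++ vertices r × nearH w′ ≡ true × Away (vertices q))
  first-near {u} p with true⊎false (nearH u)
  ... | inj₁ near = inj₂ (inj₁ near)
  first-near [] | inj₂ far = inj₁ λ { (here refl) near → true≢false near far }
  first-near {u} (e ∷ p) | inj₂ far with first-near p
  ... | inj₁ away        = inj₁ λ { (here refl) near → true≢false near far ; (there y∈) → away y∈ }
  ... | inj₂ (inj₁ near) = inj₂ (inj₂ (_ , _ , _ , _ , [] , e , p , refl , refl , near ,
                             λ { (here refl) near → true≢false near far }))
  ... | inj₂ (inj₂ (_ , _ , _ , _ , q , e′ , r , total , later≡ , near , away)) =
    inj₂ (inj₂ (_ , _ , _ , _ , e ∷ q , e′ , r , cong suc total , cong (_ ∷_) later≡ , near ,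
      λ { (here refl) near → true≢false near far ; (there y∈) → away y∈ }))

  to-H : ∀ {w} → nearH w ≡ true → ∃[ s ] s ∈ H × Near Y s w radius
  to-H near with s , s∈ , close ← proj₂ (proj₂ trees) near = s , ∈ᵇ⁻ {s} s∈ , near-mono L₄⊑Y close

  near⇒walk : ∀ {L u v d} → Near L u v d → ∃[ c ] c ≤ d × Walk u v c
  near⇒walk (c , c≤d , p) = c , c≤d , embed p

  -- Each end pays `radius` twice: for its connection to the hitting set, and because the walk
  -- between the two members of that set makes the same detour.
  through-H : ∀ {w z c} → nearH w ≡ true → nearH z ≡ true → Walk w z c → Near Y w z (c + (4 * radius + 10))
  through-H {c = c} near-w near-z p
    with s , s∈ , sw ← to-H near-w | s′ , s′∈ , sz ← to-H near-z
    with x , x≤ , p₁ ← near⇒walk sw | y , y≤ , p₂ ← near⇒walk sz =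
    near-weaken (begin
      radius + (x + (c + y) + 10 + radius)               ≤⟨ +-monoʳ-≤ radius (+-monoˡ-≤ radius (+-monoˡ-≤ 10 (+-mono-≤ x≤ (+-monoʳ-≤ c y≤)))) ⟩
      radius + (radius + (c + radius) + 10 + radius)     ≡⟨ shuffle radius c ⟩
      c + (4 * radius + 10)                              ∎)
    (near-trans (near-sym sw) (near-trans (near-mono L₃⊑Y (proj₂ (proj₂ (proj₂ subset)) s∈ s′∈ (p₁ ⊕ p ⊕ reverse p₂))) sz))
    where
    open ≤-Reasoning
    shuffle : ∀ r c → r + (r + (c + r) + 10 + r) ≡ c + (4 * r + 10)
    shuffle = solve-∀

  Watched : List V → Set
  Watched vs = ∀ {ys zs} → vs ≡ ys ++ zs →
    (W ≤ card (reach ys) → Hit H (reach ys)) × (W ≤ card (reach zs) → Hit H (reach zs))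

  module _ {u v d} (p : Walk u v d) (geo : Geodesic u v d) (watched : Watched (vertices p)) where

    -- Two thin end pieces, the two patched edges that attach them, and the middle piece through the
    -- hitting set.
    Final : Set
    Final = Near Y u v (d + (2 * E + 2 * κ + (4 * radius + 10)))

    from-first : ∀ {w a c} → a + c ≡ d → Near Y u w (a + (E + κ)) → nearH w ≡ true → (r : Walk w v c) →
      Geodesic w v c → ∀ ys → vertices p ≡ ys ++ vertices r → Final
    from-first {w} {a} {c} total near-uw near-w r geo-r ys eq
      with z , x , s , near-z , away ← last-from nearH r near-w = finish s away (through-H near-w near-z (Split.front s))
      where
      open ≤-Reasoning
      finish : ∀ {z x} (s : Split r z x) → Away (later (Split.back s)) → Near Y w z (x + (4 * radius + 10)) → Final
      finish {x = x} (mkSplit front [] total′ _) away near-wz = near-weaken (begin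
        a + (E + κ) + (x + R)              ≡⟨ shuffle a x E κ R ⟩
        (a + (x + 0)) + (E + κ + R)        ≡⟨ cong (λ y → (a + y) + (E + κ + R)) total′ ⟩
        (a + c) + (E + κ + R)              ≡⟨ cong (_+ (E + κ + R)) total ⟩
        d + (E + κ + R)                    ≤⟨ +-monoʳ-≤ d (+-monoˡ-≤ R (+-mono-≤ (m≤m+n E _) (m≤m+n κ _))) ⟩
        d + (2 * E + 2 * κ + R)            ∎)
        (near-trans near-uw near-wz)
        where
        R = 4 * radius + 10
        shuffle : ∀ a x E κ R → a + (E + κ) + (x + R) ≡ (a + (x + 0)) + (E + κ + R)
        shuffle = solve-∀
      finish {x = x} s@(mkSplit front (_∷_ {d = y} e back) total′ later≡) away near-wz = near-weaken (begin
        a + (E + κ) + (x + R + (κ + (y + E)))   ≤⟨ n≤1+n _ ⟩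
        suc (a + (E + κ) + (x + R + (κ + (y + E))))  ≡⟨ shuffle a x y E κ R ⟩
        (a + (x + suc y)) + (2 * E + 2 * κ + R) ≡⟨ cong (λ y → (a + y) + (2 * E + 2 * κ + R)) total′ ⟩
        (a + c) + (2 * E + 2 * κ + R)           ≡⟨ cong (_+ (2 * E + 2 * κ + R)) total ⟩
        d + (2 * E + 2 * κ + R)                 ∎)
        (near-trans near-uw (near-trans near-wz (near-trans (patch e)
          (thin back (geodesic-suffix (e ∷ []) (Split.back-geodesic s geo-r))
            (away-small (proj₂ (watched {ys ++ w ∷ later front} suffix)) away)))))
        where
        R = 4 * radius + 10
        shuffle : ∀ a x y E κ R → suc (a + (E + κ) + (x + R + (κ + (y + E)))) ≡ (a + (x + suc y)) + (2 * E + 2 * κ + R)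
        shuffle = solve-∀
        suffix : vertices p ≡ (ys ++ w ∷ later front) ++ vertices back
        suffix = trans eq (trans (cong (λ l → ys ++ w ∷ l) later≡) (sym (List.++-assoc ys (w ∷ later front) (vertices back))))

    stretch : Final
    stretch with first-near p
    ... | inj₁ away = near-weaken (+-monoʳ-≤ d (≤-trans (m≤m+n E _) (≤-trans (m≤m+n (2 * E) (2 * κ)) (m≤m+n _ _))))
      (thin p geo (away-small (proj₁ (watched {vertices p} {[]} (sym (List.++-identityʳ (vertices p))))) away))
    ... | inj₂ (inj₁ near) = from-first refl (near-weaken z≤n near-refl) near p geo [] refl
    ... | inj₂ (inj₂ (w , w′ , a , c , q , e , r , total , later≡ , near , away)) =
      from-first {a = suc a} {c} (trans (sym (+-suc a c)) total)
        (near-weaken (≤-trans (≤-reflexive (+-assoc a E κ)) (n≤1+n _)) (near-trans (thin q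
          (geodesic-prefix (e ∷ r) (subst (λ d → Geodesic u v d) (sym total) geo))
          (away-small (proj₁ (watched {vertices q} {vertices r} split≡)) away)) (patch e)))
        near r (geodesic-suffix (e ∷ []) (geodesic-suffix q (subst (λ d → Geodesic u v d) (sym total) geo))) (vertices q) split≡
      where
      split≡ : vertices p ≡ vertices q ++ vertices r
      split≡ = cong (u ∷_) later≡

  watch : ∀ u v {d} (p : Walk u v d) (geo : Geodesic u v d) →
    (∀ {P} → P ∈ corridors u v (⟨ d ⟩ , p , geo) → W ≤ card P → Hit H P) → Watched (vertices p)
  watch u v {d} p geo hits {ys} {zs} eq =
    hits (∈-++⁺ˡ (subst (λ l → reach l ∈ takes) (trans (cong (take (length ys)) eq) (take-length-++ ys zs)) (∈-map⁺ _ index∈))) ,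
    hits (∈-++⁺ʳ takes (subst (λ l → reach l ∈ drops) (trans (cong (drop (length ys)) eq) (drop-length-++ ys zs)) (∈-map⁺ _ index∈)))
    where
    takes = map (λ i → reach (take i (vertices p))) (upTo (suc n))
    drops = map (λ i → reach (drop i (vertices p))) (upTo (suc n))
    open ≤-Reasoning
    index∈ : length ys ∈ upTo (suc n)
    index∈ = ∈-upTo⁺ (s≤s (begin
      length ys                    ≤⟨ m≤m+n (length ys) (length zs) ⟩
      length ys + length zs        ≡⟨ trans (cong length eq) (List.length-++ ys) ⟨
      length (vertices p)          ≡⟨ cong suc (length-later p) ⟩
      suc d                        ≤⟨ geodesic-size p geo (λ _ → true) (λ _ → refl) ⟩
      card {n} (λ _ → true)        ≤⟨ card≤n {n} (λ _ → true) ⟩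
      n                            ∎))

  stretched : ∀ {u v d} → Walk u v d → Near Y u v (d + (2 * E + 2 * κ + (4 * radius + 10)))
  stretched {u} {v} q with distance u v | hit u v
  ... | ⊤⁺ , none         | _    = ⊥-elim (none q)
  ... | ⟨ d ⟩ , p , geo   | hits = near-weaken (+-monoˡ-≤ _ (geo q)) (stretch p geo (λ {ys} {zs} → watch u v p geo hits {ys} {zs}))

  -- If W exceeds n then every corridor is small.
  stretched′ : n < W → ∀ {u v d} → Walk u v d → Near Y u v (d + E)
  stretched′ n<W {u} {v} q with distance u v
  ... | ⊤⁺ , none       = ⊥-elim (none q)
  ... | ⟨ d ⟩ , p , geo = near-weaken (+-monoˡ-≤ E (geo q)) (thin p geo (≤-<-trans (card≤n (reach (vertices p))) n<W))

  σ : ℕ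
  σ = length H

  σ≤ : σ ≤ j * t
  σ≤ = proj₁ (proj₂ hitters)

  strips≤ : M * m * S.k ≤ 3 * n
  strips≤ = ≤-trans (≤-reflexive (cong (M * m *_) (sym (trans (sum-const S.k 1) (*-identityʳ S.k)))))
    (≤-trans (S.few (λ _ → true) (λ _ → true) (λ _ _ → refl)) (*-monoʳ-≤ 3 (card≤n {n} (λ _ → true))))

  stars≤ : M * 1 * Stars.k ≤ 3 * n
  stars≤ = ≤-trans (≤-reflexive (cong (M * 1 *_) (sym (trans (sum-const Stars.k 1) (*-identityʳ Stars.k)))))
    (≤-trans (Stars.few (λ _ → true) (λ _ → true) (λ _ _ → refl)) (*-monoʳ-≤ 3 (card≤n {n} (λ _ → true))))

  edges≤ : ∀ X → length L₂ ≤ n * M + (n + X) → length Y ≤ 2 * (n * M) + 5 * n + (X + 3 * (Stars.k * σ))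
  edges≤ X L₂≤ = begin
    length Y
      ≡⟨ trans (List.length-++ L₁) (cong (length L₁ +_) (trans (List.length-++ L₂) (cong (length L₂ +_) (List.length-++ L₃)))) ⟩
    length L₁ + (length L₂ + (length L₃ + length L₄))
      ≤⟨ +-mono-≤ (proj₁ (proj₂ spanner)) (+-mono-≤ L₂≤ (+-mono-≤ (≤-trans (proj₁ (proj₂ (proj₂ subset))) (+-monoˡ-≤ _ Stars.cost₁))
           (≤-trans (proj₁ (proj₂ trees)) (card≤n nearH)))) ⟩
    2 * n + (n * M + (n + X) + ((n * M + (n + Stars.k * 0)) + 3 * (Stars.k * σ) + n))
      ≡⟨ shuffle n (n * M) X Stars.k σ ⟩
    2 * (n * M) + 5 * n + (X + 3 * (Stars.k * σ)) ∎
    where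
    open ≤-Reasoning
    shuffle : ∀ n nM X k σ → 2 * n + (nM + (n + X) + ((nM + (n + k * 0)) + 3 * (k * σ) + n)) ≡ 2 * nM + 5 * n + (X + 3 * (k * σ))
    shuffle = solve-∀

-- Choice of parameters

1≤2^ : ∀ a → 1 ≤ 2 ^ a
1≤2^ a = m^n>0 2 a

2^-mono : ∀ {a b} → a ≤ b → 2 ^ a ≤ 2 ^ b
2^-mono = ^-monoʳ-≤ 2

2^-cancel : ∀ a {x y} → 2 ^ a * x ≤ 2 ^ a * y → x ≤ y
2^-cancel a = *-cancelˡ-≤ (2 ^ a) {{m^n≢0 2 a}}

SpannerBound : ∀ {n} → Graph n → ℕ → ℕ → Set
SpannerBound {n} G c d = ∃[ Y ] length Y ≤ c × (∀ {u v l} → Walks.Walk G u v l → Walks.Near G Y u v (l + d))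

-- With `M = 2 ^ K` and `D = 2 ^ e`, the bounds `lower` and `upper` place `D³ M⁵` between the square
-- of `2 ^ N` and four times that square.
module Parameters {n N K e : ℕ} (G : Graph n) (n<2^N : n < 2 ^ N)
  (4K≤N : 4 * K ≤ N) (lower : 2 * N ≤ 5 * K + 3 * e) (upper : 3 * e + 5 * K ≤ 2 * N + 2) where

  stars≤ : ∀ l σ → 2 ^ K * 1 * l ≤ 3 * n → σ ≤ (2 + 3 * N) * 2 ^ (2 * K) →
    3 * (l * σ) ≤ 9 * ((2 + 3 * N) * 2 ^ (N + K))
  stars≤ l σ l≤ σ≤ = 2^-cancel K (begin
    2 ^ K * (3 * (l * σ))                                        ≡⟨ shuffle (2 ^ K) l σ ⟩
    3 * (2 ^ K * 1 * l * σ)                                      ≤⟨ *-monoʳ-≤ 3 (*-mono-≤ (≤-trans l≤ (*-monoʳ-≤ 3 (<⇒≤ n<2^N))) σ≤) ⟩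
    3 * (3 * 2 ^ N * ((2 + 3 * N) * 2 ^ (2 * K)))                ≡⟨ cong (λ z → 3 * (3 * 2 ^ N * ((2 + 3 * N) * z))) 2^2K ⟩
    3 * (3 * 2 ^ N * ((2 + 3 * N) * (2 ^ K * 2 ^ K)))            ≡⟨ shuffle′ (2 ^ N) (2 + 3 * N) (2 ^ K) ⟩
    2 ^ K * (9 * ((2 + 3 * N) * (2 ^ N * 2 ^ K)))                ≡⟨ cong (λ z → 2 ^ K * (9 * ((2 + 3 * N) * z))) (^-distribˡ-+-* 2 N K) ⟨
    2 ^ K * (9 * ((2 + 3 * N) * 2 ^ (N + K)))                    ∎)
    where
    open ≤-Reasoning
    2^2K : 2 ^ (2 * K) ≡ 2 ^ K * 2 ^ K
    2^2K = trans (cong (λ z → 2 ^ (K + z)) (+-identityʳ K)) (^-distribˡ-+-* 2 K K)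
    shuffle : ∀ k l σ → k * (3 * (l * σ)) ≡ 3 * (k * 1 * l * σ)
    shuffle = solve-∀
    shuffle′ : ∀ a b k → 3 * (3 * a * (b * (k * k))) ≡ k * (9 * (b * (a * k)))
    shuffle′ = solve-∀

  edges : ∀ X l σ → X ≤ 12 * 2 ^ (N + K) → 2 ^ K * 1 * l ≤ 3 * n → σ ≤ (2 + 3 * N) * 2 ^ (2 * K) →
    2 * (n * 2 ^ K) + 5 * n + (X + 3 * (l * σ)) ≤ 37 * (suc N * 2 ^ (N + K))
  edges X l σ X≤ l≤ σ≤ = begin
    2 * (n * 2 ^ K) + 5 * n + (X + 3 * (l * σ))
      ≤⟨ +-mono-≤ (+-mono-≤ (*-monoʳ-≤ 2 n2^K≤) (*-monoʳ-≤ 5 n≤)) (+-mono-≤ X≤ (stars≤ l σ l≤ σ≤)) ⟩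
    2 * P + 5 * P + (12 * P + 9 * ((2 + 3 * N) * P))
      -- The constant is `37 = 2 + 5 + 12 + 9 * 2`.
      ≡⟨ shuffle P N ⟩
    37 * P + 27 * (N * P)
      ≤⟨ +-monoʳ-≤ (37 * P) (*-monoˡ-≤ (N * P) 27≤37) ⟩
    37 * P + 37 * (N * P)
      ≡⟨ *-distribˡ-+ 37 P (N * P) ⟨
    37 * (suc N * P) ∎
    where
    open ≤-Reasoning
    P = 2 ^ (N + K)
    27≤37 : 27 ≤ 37
    27≤37 = m≤m+n 27 10
    n≤ : n ≤ P
    n≤ = ≤-trans (<⇒≤ n<2^N) (2^-mono (m≤m+n N K))
    n2^K≤ : n * 2 ^ K ≤ P
    n2^K≤ = ≤-trans (*-monoˡ-≤ (2 ^ K) (<⇒≤ n<2^N)) (≤-reflexive (sym (^-distribˡ-+-* 2 N K)))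
    shuffle : ∀ P N → 2 * P + 5 * P + (12 * P + 9 * ((2 + 3 * N) * P)) ≡ 37 * P + 27 * (N * P)
    shuffle = solve-∀

  error : ∀ y → y ≤ 2 ^ e → (4 + 2 * N) * (3 * 2 ^ e) + 2 * N * y ≤ (12 + 8 * N) * 2 ^ e
  error y y≤ = ≤-trans (+-monoʳ-≤ _ (*-monoʳ-≤ (2 * N) y≤)) (≤-reflexive (shuffle N (2 ^ e)))
    where
    shuffle : ∀ N D → (4 + 2 * N) * (3 * D) + 2 * N * D ≡ (12 + 8 * N) * D
    shuffle = solve-∀

  module Narrow (N≤7K : N ≤ 7 * K) where
    -- Exponents of `n / M³`, of `W = n / M²` and of `m = n / (M³ D)`.
    x w μ : ℕ
    x = N ∸ 3 * K
    w = x + K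
    μ = x ∸ e

    x+3K≡N : x + 3 * K ≡ N
    x+3K≡N = m∸n+n≡m (≤-trans (*-monoˡ-≤ K (n≤1+n 3)) 4K≤N)

    K≤x : K ≤ x
    K≤x = +-cancelʳ-≤ (3 * K) K x (≤-trans 4K≤N (≤-reflexive (sym x+3K≡N)))

    x≤4K : x ≤ 4 * K
    x≤4K = +-cancelʳ-≤ (3 * K) x (4 * K) (≤-trans (≤-reflexive x+3K≡N) (≤-trans N≤7K (≤-reflexive (shuffle K))))
      where
      shuffle : ∀ K → 7 * K ≡ 4 * K + 3 * K
      shuffle = solve-∀

    lower′ : 2 * x + K ≤ 3 * e
    lower′ = +-cancelˡ-≤ (5 * K) _ _ (≤-trans (≤-reflexive (trans (shuffle x K) (cong (2 *_) x+3K≡N))) lower)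
      where
      shuffle : ∀ x K → 5 * K + (2 * x + K) ≡ 2 * (x + 3 * K)
      shuffle = solve-∀

    upper′ : 3 * e ≤ 2 * x + K + 2
    upper′ = +-cancelʳ-≤ (5 * K) _ _ (≤-trans upper (≤-reflexive (trans (cong (λ N → 2 * N + 2) (sym x+3K≡N)) (shuffle x K))))
      where
      shuffle : ∀ x K → 2 * (x + 3 * K) + 2 ≡ 2 * x + K + 2 + 5 * K
      shuffle = solve-∀

    x≤μ+e : x ≤ μ + e
    x≤μ+e = ≤-trans (m≤n+m∸n x e) (≤-reflexive (+-comm e μ))

    -- `W / Λ ≤ D`, from `D³ M⁵ ≥ n²` and `M⁴ ≤ n`, the latter in the form `K≤x`.
    w≤2e : w ≤ e + e
    w≤2e = *-cancelˡ-≤ 3 (begin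
      3 * (x + K)                ≡⟨ shuffle x K ⟩
      3 * x + 2 * K + K          ≤⟨ +-monoʳ-≤ (3 * x + 2 * K) K≤x ⟩
      3 * x + 2 * K + x          ≡⟨ shuffle′ x K ⟩
      2 * (2 * x + K)            ≤⟨ *-monoʳ-≤ 2 lower′ ⟩
      2 * (3 * e)                ≡⟨ shuffle″ e ⟩
      3 * (e + e)                ∎)
      where
      open ≤-Reasoning
      shuffle : ∀ x K → 3 * (x + K) ≡ 3 * x + 2 * K + K
      shuffle = solve-∀
      shuffle′ : ∀ x K → 3 * x + 2 * K + x ≡ 2 * (2 * x + K)
      shuffle′ = solve-∀
      shuffle″ : ∀ e → 2 * (3 * e) ≡ 3 * (e + e)
      shuffle″ = solve-∀

    -- The heavy vertices of all blocks number at most `(W / Λ) * m ≤ D`. For `e ≤ x` this is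
    -- `lower′` rearranged; otherwise `m = 1` and `w≤2e` suffices.
    blocks≤ : (w ∸ e) + μ ≤ e
    blocks≤ with e ≤? x
    ... | no e≰x = begin
      (w ∸ e) + (x ∸ e)     ≡⟨ cong ((w ∸ e) +_) (m≤n⇒m∸n≡0 (<⇒≤ (≰⇒> e≰x))) ⟩
      (w ∸ e) + 0           ≡⟨ +-identityʳ (w ∸ e) ⟩
      w ∸ e                 ≤⟨ ∸-monoˡ-≤ e w≤2e ⟩
      e + e ∸ e             ≡⟨ m+n∸n≡m e e ⟩
      e                     ∎
      where open ≤-Reasoning
    ... | yes e≤x = +-cancelˡ-≤ (2 * e) _ _ (begin
      2 * e + ((w ∸ e) + μ)           ≡⟨ shuffle e (w ∸ e) μ ⟩
      ((w ∸ e) + e) + (μ + e)         ≡⟨ cong₂ _+_ (m∸n+n≡m (≤-trans e≤x (m≤m+n x K))) (m∸n+n≡m e≤x) ⟩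
      x + K + x                       ≡⟨ shuffle′ x K ⟩
      2 * x + K                       ≤⟨ lower′ ⟩
      3 * e                           ≡⟨ shuffle″ e ⟩
      2 * e + e                       ∎)
      where
      open ≤-Reasoning
      shuffle : ∀ e w μ → 2 * e + (w + μ) ≡ (w + e) + (μ + e)
      shuffle = solve-∀
      shuffle′ : ∀ x K → x + K + x ≡ 2 * x + K
      shuffle′ = solve-∀
      shuffle″ : ∀ e → 3 * e ≡ 2 * e + e
      shuffle″ = solve-∀

    -- `D ≤ 4 * M² * m` is what makes strips of length `D` affordable; here `N ≤ 7 * K` enters,
    -- through `x≤4K`. The summand 2 absorbs the rounding in `upper` and turns the factor 3 of
    -- `strips≤` into 12.
    e≤ : e ≤ μ + 2 * K + 2
    e≤ = +-cancelʳ-≤ e _ _ (*-cancelˡ-≤ 3 (begin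
      3 * (e + e)                              ≡⟨ shuffle e ⟩
      2 * (3 * e)                              ≤⟨ *-monoʳ-≤ 2 upper′ ⟩
      2 * (2 * x + K + 2)                      ≡⟨ shuffle′ x K ⟩
      x + (3 * x + 2 * K + 4)                  ≤⟨ +-mono-≤ x≤4K (+-monoʳ-≤ (3 * x + 2 * K) (m≤m+n 4 2)) ⟩
      4 * K + (3 * x + 2 * K + 6)              ≡⟨ shuffle″ x K ⟩
      3 * (x + (2 * K + 2))                    ≤⟨ *-monoʳ-≤ 3 (+-monoˡ-≤ (2 * K + 2) x≤μ+e) ⟩
      3 * (μ + e + (2 * K + 2))                ≡⟨ cong (3 *_) (shuffle‴ μ e K) ⟩
      3 * (μ + 2 * K + 2 + e)                  ∎))
      where
      open ≤-Reasoning
      shuffle : ∀ e → 3 * (e + e) ≡ 2 * (3 * e)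
      shuffle = solve-∀
      shuffle′ : ∀ x K → 2 * (2 * x + K + 2) ≡ x + (3 * x + 2 * K + 4)
      shuffle′ = solve-∀
      shuffle″ : ∀ x K → 4 * K + (3 * x + 2 * K + 6) ≡ 3 * (x + (2 * K + 2))
      shuffle″ = solve-∀
      shuffle‴ : ∀ μ e K → μ + e + (2 * K + 2) ≡ μ + 2 * K + 2 + e
      shuffle‴ = solve-∀

    α-bound : ∀ a → 2 ^ K * 2 ^ μ * a ≤ 3 * 2 ^ w → a ≤ 3 * 2 ^ e
    α-bound a h = 2^-cancel (K + μ) (begin
      2 ^ (K + μ) * a               ≡⟨ cong (_* a) (^-distribˡ-+-* 2 K μ) ⟩
      2 ^ K * 2 ^ μ * a             ≤⟨ h ⟩
      3 * 2 ^ w                     ≤⟨ *-monoʳ-≤ 3 (2^-mono (≤-trans (+-monoˡ-≤ K x≤μ+e) (≤-reflexive (shuffle μ e K)))) ⟩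
      3 * 2 ^ (K + μ + e)           ≡⟨ cong (3 *_) (^-distribˡ-+-* 2 (K + μ) e) ⟩
      3 * (2 ^ (K + μ) * 2 ^ e)     ≡⟨ shuffle′ (2 ^ (K + μ)) (2 ^ e) ⟩
      2 ^ (K + μ) * (3 * 2 ^ e)     ∎)
      where
      open ≤-Reasoning
      shuffle : ∀ μ e K → μ + e + K ≡ K + μ + e
      shuffle = solve-∀
      shuffle′ : ∀ a b → 3 * (a * b) ≡ a * (3 * b)
      shuffle′ = solve-∀

    strip-edges : ∀ k → 2 ^ K * 2 ^ μ * k ≤ 3 * n → k * 2 ^ e ≤ 12 * 2 ^ (N + K)
    strip-edges k h = 2^-cancel (K + μ) (begin
      2 ^ (K + μ) * (k * 2 ^ e)             ≡⟨ cong (_* (k * 2 ^ e)) (^-distribˡ-+-* 2 K μ) ⟩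
      2 ^ K * 2 ^ μ * (k * 2 ^ e)           ≡⟨ *-assoc (2 ^ K * 2 ^ μ) k (2 ^ e) ⟨
      2 ^ K * 2 ^ μ * k * 2 ^ e             ≤⟨ *-mono-≤ (≤-trans h (*-monoʳ-≤ 3 (<⇒≤ n<2^N))) (2^-mono e≤) ⟩
      3 * 2 ^ N * 2 ^ (μ + 2 * K + 2)       ≡⟨ *-assoc 3 (2 ^ N) _ ⟩
      3 * (2 ^ N * 2 ^ (μ + 2 * K + 2))     ≡⟨ cong (3 *_) (^-distribˡ-+-* 2 N (μ + 2 * K + 2)) ⟨
      3 * 2 ^ (N + (μ + 2 * K + 2))         ≡⟨ cong (λ z → 3 * 2 ^ z) (shuffle N μ K) ⟩
      3 * 2 ^ (2 + ((K + μ) + (N + K)))     ≡⟨ shuffle′ (2 ^ ((K + μ) + (N + K))) ⟩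
      12 * 2 ^ ((K + μ) + (N + K))          ≡⟨ cong (12 *_) (^-distribˡ-+-* 2 (K + μ) (N + K)) ⟩
      12 * (2 ^ (K + μ) * 2 ^ (N + K))      ≡⟨ shuffle″ (2 ^ (K + μ)) (2 ^ (N + K)) ⟩
      2 ^ (K + μ) * (12 * 2 ^ (N + K))      ∎)
      where
      open ≤-Reasoning
      shuffle : ∀ N μ K → N + (μ + 2 * K + 2) ≡ 2 + ((K + μ) + (N + K))
      shuffle = solve-∀
      shuffle′ : ∀ z → 3 * (2 * (2 * z)) ≡ 12 * z
      shuffle′ = solve-∀
      shuffle″ : ∀ a b → 12 * (a * b) ≡ a * (12 * b)
      shuffle″ = solve-∀

    n≤tW : n ≤ 2 ^ (2 * K) * 2 ^ w
    n≤tW = ≤-trans (<⇒≤ n<2^N) (≤-reflexive (trans (cong (2 ^_) (trans (sym x+3K≡N) (shuffle x K))) (^-distribˡ-+-* 2 (2 * K) w)))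
      where
      shuffle : ∀ x K → x + 3 * K ≡ 2 * K + (x + K)
      shuffle = solve-∀

    W≤bΛ : 2 ^ w ≤ 2 ^ (w ∸ e) * 2 ^ e
    W≤bΛ = ≤-trans (2^-mono (≤-trans (m≤n+m∸n w e) (≤-reflexive (+-comm e (w ∸ e))))) (≤-reflexive (^-distribˡ-+-* 2 (w ∸ e) e))

    module A = Assembly G {N} {2 ^ K} {2 ^ e} {2 ^ μ} {2 ^ w} {2 ^ (2 * K)} {2 ^ (w ∸ e)} {3 * 2 ^ e}
      n<2^N (1≤2^ K) (1≤2^ μ) (1≤2^ w) (1≤2^ (2 * K)) n≤tW W≤bΛ α-bound

    total-error : 2 * A.E + 2 * (2 * N) + (4 * (2 ^ e + (2 ^ e + 2)) + 10) ≤ 50 * (suc N * 2 ^ e)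
    total-error = begin
      2 * A.E + 2 * (2 * N) + (4 * (D + (D + 2)) + 10)
        ≤⟨ +-monoˡ-≤ _ (+-monoˡ-≤ _ (*-monoʳ-≤ 2 (error _ (≤-trans (≤-reflexive (sym (^-distribˡ-+-* 2 (w ∸ e) μ))) (2^-mono blocks≤))))) ⟩
      2 * ((12 + 8 * N) * D) + 2 * (2 * N) + (4 * (D + (D + 2)) + 10)
        ≡⟨ shuffle N D ⟩
      (32 + 16 * N) * D + (18 + 4 * N) * 1
        ≤⟨ +-monoʳ-≤ ((32 + 16 * N) * D) (*-mono-≤ (+-monoʳ-≤ 18 (*-monoˡ-≤ N (m≤m+n 4 30))) (1≤2^ e)) ⟩
      (32 + 16 * N) * D + (18 + 34 * N) * D
        ≡⟨ shuffle′ N D ⟩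
      50 * (suc N * D) ∎
      where
      open ≤-Reasoning
      D = 2 ^ e
      shuffle : ∀ N D → 2 * ((12 + 8 * N) * D) + 2 * (2 * N) + (4 * (D + (D + 2)) + 10) ≡ (32 + 16 * N) * D + (18 + 4 * N) * 1
      shuffle = solve-∀
      shuffle′ : ∀ N D → (32 + 16 * N) * D + (18 + 34 * N) * D ≡ 50 * (suc N * D)
      shuffle′ = solve-∀

    bound : SpannerBound G (37 * (suc N * 2 ^ (N + K))) (50 * (suc N * 2 ^ e))
    bound = A.Y ,
      ≤-trans (A.edges≤ (A.S.k * 2 ^ e) A.S.cost₁) (edges _ A.Stars.k A.σ (strip-edges A.S.k A.strips≤) A.stars≤ A.σ≤) ,
      λ {u} {v} {l} p → Walks.near-weaken G (+-monoʳ-≤ l total-error) (A.stretched p)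

  module Wide (7K≤N : 7 * K ≤ N) where

    -- `n / (M D) ≤ D`, where `7 * K ≤ N` enters: it bounds the total number of strips by `3 * D`.
    N≤K+2e : N ≤ K + (e + e)
    N≤K+2e = *-cancelˡ-≤ 3 (+-cancelʳ-≤ (N + 7 * K) _ _ (begin
      3 * N + (N + 7 * K)                      ≡⟨ shuffle N K ⟩
      2 * (2 * N) + 7 * K                      ≤⟨ +-mono-≤ (*-monoʳ-≤ 2 lower) 7K≤N ⟩
      2 * (5 * K + 3 * e) + N                  ≡⟨ shuffle′ N K e ⟩
      3 * (K + (e + e)) + (N + 7 * K)          ∎))
      where
      open ≤-Reasoning
      shuffle : ∀ N K → 3 * N + (N + 7 * K) ≡ 2 * (2 * N) + 7 * K
      shuffle = solve-∀
      shuffle′ : ∀ N K e → 2 * (5 * K + 3 * e) + N ≡ 3 * (K + (e + e)) + (N + 7 * K)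
      shuffle′ = solve-∀

    α-bound : ∀ a → 2 ^ K * 2 ^ e * a ≤ 3 * 2 ^ N → a ≤ 3 * 2 ^ e
    α-bound a h = 2^-cancel (K + e) (begin
      2 ^ (K + e) * a               ≡⟨ cong (_* a) (^-distribˡ-+-* 2 K e) ⟩
      2 ^ K * 2 ^ e * a             ≤⟨ h ⟩
      3 * 2 ^ N                     ≤⟨ *-monoʳ-≤ 3 (2^-mono (≤-trans N≤K+2e (≤-reflexive (sym (+-assoc K e e))))) ⟩
      3 * 2 ^ (K + e + e)           ≡⟨ cong (3 *_) (^-distribˡ-+-* 2 (K + e) e) ⟩
      3 * (2 ^ (K + e) * 2 ^ e)     ≡⟨ shuffle (2 ^ (K + e)) (2 ^ e) ⟩
      2 ^ (K + e) * (3 * 2 ^ e)     ∎)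
      where
      open ≤-Reasoning
      shuffle : ∀ a b → 3 * (a * b) ≡ a * (3 * b)
      shuffle = solve-∀

    -- One factor of `k * k` is at most `3 * D` by `α-bound`, and `D * k` is at most `3 * 2 ^ N`.
    strip-edges : ∀ k → 2 ^ K * 2 ^ e * k ≤ 3 * n → n + k * k ≤ 12 * 2 ^ (N + K)
    strip-edges k h = begin
      n + k * k                                ≤⟨ +-mono-≤ (<⇒≤ n<2^N) (*-monoˡ-≤ k (α-bound k h′)) ⟩
      2 ^ N + 3 * 2 ^ e * k                    ≡⟨ cong (2 ^ N +_) (shuffle (2 ^ e) k) ⟩
      2 ^ N + 3 * (1 * 2 ^ e * k)              ≤⟨ +-monoʳ-≤ (2 ^ N) (*-monoʳ-≤ 3 (≤-trans (*-monoˡ-≤ k (*-monoˡ-≤ (2 ^ e) (1≤2^ K))) h′)) ⟩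
      2 ^ N + 3 * (3 * 2 ^ N)                  ≤⟨ m≤m+n _ (2 * 2 ^ N) ⟩
      2 ^ N + 3 * (3 * 2 ^ N) + 2 * 2 ^ N      ≡⟨ shuffle′ (2 ^ N) ⟩
      12 * 2 ^ N                               ≤⟨ *-monoʳ-≤ 12 (2^-mono (m≤m+n N K)) ⟩
      12 * 2 ^ (N + K)                         ∎
      where
      open ≤-Reasoning
      h′ : 2 ^ K * 2 ^ e * k ≤ 3 * 2 ^ N
      h′ = ≤-trans h (*-monoʳ-≤ 3 (<⇒≤ n<2^N))
      shuffle : ∀ D k → 3 * D * k ≡ 3 * (1 * D * k)
      shuffle = solve-∀
      shuffle′ : ∀ P → P + 3 * (3 * P) + 2 * P ≡ 12 * P
      shuffle′ = solve-∀

    -- With `Λ = W = 2 ^ N > n`, one block covers any geodesic and no corridor has `W` vertices.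
    module A = Assembly G {N} {2 ^ K} {2 ^ N} {2 ^ e} {2 ^ N} {2 ^ (2 * K)} {1} {3 * 2 ^ e}
      n<2^N (1≤2^ K) (1≤2^ e) (1≤2^ N) (1≤2^ (2 * K))
      (≤-trans (<⇒≤ n<2^N) (m≤n*m (2 ^ N) (2 ^ (2 * K)) {{m^n≢0 2 (2 * K)}})) (m≤m+n (2 ^ N) 0) α-bound

    total-error : A.E ≤ 50 * (suc N * 2 ^ e)
    total-error = begin
      A.E                          ≤⟨ error _ (≤-reflexive (+-identityʳ (2 ^ e))) ⟩
      (12 + 8 * N) * 2 ^ e         ≤⟨ *-monoˡ-≤ (2 ^ e) (+-mono-≤ (m≤m+n 12 38) (*-monoˡ-≤ N (m≤m+n 8 42))) ⟩
      (50 + 50 * N) * 2 ^ e        ≡⟨ shuffle N (2 ^ e) ⟩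
      50 * (suc N * 2 ^ e)         ∎
      where
      open ≤-Reasoning
      shuffle : ∀ N D → (50 + 50 * N) * D ≡ 50 * (suc N * D)
      shuffle = solve-∀

    bound : SpannerBound G (37 * (suc N * 2 ^ (N + K))) (50 * (suc N * 2 ^ e))
    bound = A.Y ,
      ≤-trans (A.edges≤ (n + A.S.k * A.S.k) A.S.cost₂) (edges _ A.Stars.k A.σ (strip-edges A.S.k A.strips≤) A.stars≤ A.σ≤) ,
      -- The radius exceeds `n` here, so a detour through the hitting set would be worthless; the
      -- bound for small corridors avoids it.
      λ {u} {v} {l} p → Walks.near-weaken G (+-monoʳ-≤ l total-error) (A.stretched′ n<2^N p)

  bound : SpannerBound G (37 * (suc N * 2 ^ (N + K))) (50 * (suc N * 2 ^ e))
  bound with ≤-total N (7 * K)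
  ... | inj₁ N≤7K = Narrow.bound N≤7K
  ... | inj₂ 7K≤N = Wide.bound 7K≤N

-- From edge lists to subgraphs; integer exponents

additive-spanner : ∀ {n} (G : Graph n) c d → SpannerBound G c d →
  ∃[ H ] H ⊆ᴳ G × ∣E∣ H ≤ c × (∀ u v → (δ G u v ≤⁺ δ H u v) × (δ H u v ≤⁺ δ G u v +⁺ d))
additive-spanner G c k (Y , Y≤c , near) = Sub Y , (λ u v → proj₁) , ≤-trans (∣E∣-Sub Y) Y≤c , compare
  where
  open Walks G
  compare : ∀ u v → (δ G u v ≤⁺ δ (Sub Y) u v) × (δ (Sub Y) u v ≤⁺ δ G u v +⁺ k)
  compare u v with distance u v | Graph.distance (Sub Y) u v
  ... | ⊤⁺ , _            | ⊤⁺ , _             = (⊤⁺ ≤⊤⁺) , (⊤⁺ ≤⊤⁺)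
  ... | ⊤⁺ , none         | ⟨ _ ⟩ , q , _      = ⊥-elim (none (embed q))
  ... | ⟨ _ ⟩ , p , _     | ⊤⁺ , none          = ⊥-elim (none (proj₂ (proj₂ (near p))))
  ... | ⟨ _ ⟩ , p , geo   | ⟨ _ ⟩ , q , geo′   =
    [ geo (embed q) ] , [ ≤-trans (geo′ (proj₂ (proj₂ (near p)))) (proj₁ (proj₂ (near p))) ]

n<2^[1+⌊log₂n⌋] : ∀ n → n < 2 ^ suc ⌊log₂ n ⌋
n<2^[1+⌊log₂n⌋] n = ≰⇒> λ 2^≤n →
  <⇒≱ ≤-refl (≤-trans (≤-reflexive (sym (⌊log₂[2^n]⌋≡n (suc ⌊log₂ n ⌋)))) (⌊log₂⌋-mono-≤ 2^≤n))

2^⌊log₂n⌋≤n : ∀ n → 1 ≤ n → 2 ^ ⌊log₂ n ⌋ ≤ n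
2^⌊log₂n⌋≤n = <-rec _ step
  where
  open ≤-Reasoning
  step : ∀ n → (∀ {m} → m < n → 1 ≤ m → 2 ^ ⌊log₂ m ⌋ ≤ m) → 1 ≤ n → 2 ^ ⌊log₂ n ⌋ ≤ n
  step 1 _ _ = ≤-refl
  step n@(suc (suc n′)) rec _ = begin
    2 ^ ⌊log₂ n ⌋                  ≡⟨ cong (2 ^_) (m+[n∸m]≡n (⌊log₂⌋-mono-≤ {2} {n} (s≤s (s≤s z≤n)))) ⟨
    2 * 2 ^ (⌊log₂ n ⌋ ∸ 1)        ≡⟨ cong (λ z → 2 * 2 ^ z) (⌊log₂⌊n/2⌋⌋≡⌊log₂n⌋∸1 n) ⟨
    2 * 2 ^ ⌊log₂ ⌊ n /2⌋ ⌋        ≤⟨ *-monoʳ-≤ 2 (rec (⌊n/2⌋<n (suc n′)) (⌊n/2⌋-mono {2} {n} (s≤s (s≤s z≤n)))) ⟩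
    2 * ⌊ n /2⌋                    ≡⟨ cong (⌊ n /2⌋ +_) (+-identityʳ ⌊ n /2⌋) ⟩
    ⌊ n /2⌋ + ⌊ n /2⌋              ≤⟨ +-monoʳ-≤ ⌊ n /2⌋ (⌊n/2⌋≤⌈n/2⌉ n) ⟩
    ⌊ n /2⌋ + ⌈ n /2⌉              ≡⟨ ⌊n/2⌋+⌈n/2⌉≡n n ⟩
    n                              ∎

-- `e` is `(2 * N - 5 * K) / 3` rounded up: the lower bound stays exact, and the upper one loses at
-- most 2. The difference is nonnegative because `4 * K ≤ N`.
error-exponent : ∀ N K → 4 * K ≤ N → ∃[ e ] 2 * N ≤ 5 * K + 3 * e × 3 * e + 5 * K ≤ 2 * N + 2
error-exponent N K 4K≤N = e , lower , upper
  where
  open ≤-Reasoning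
  y e : ℕ
  y = 2 * N ∸ 5 * K
  e = (y + 2) ℕ./ 3
  5K+y : 5 * K + y ≡ 2 * N
  5K+y = m+[n∸m]≡n (begin
    5 * K          ≤⟨ *-monoˡ-≤ K (m≤m+n 5 3) ⟩
    8 * K          ≡⟨ *-assoc 2 4 K ⟩
    2 * (4 * K)    ≤⟨ *-monoʳ-≤ 2 4K≤N ⟩
    2 * N          ∎)
  lower : 2 * N ≤ 5 * K + 3 * e
  lower = ≤-trans (≤-reflexive (sym 5K+y)) (+-monoʳ-≤ (5 * K) (+-cancelˡ-≤ 2 _ _ (begin
    2 + y                      ≡⟨ +-comm 2 y ⟩
    y + 2                      ≡⟨ m≡m%n+[m/n]*n (y + 2) 3 ⟩
    (y + 2) ℕ.% 3 + e * 3      ≤⟨ +-mono-≤ (m<1+n⇒m≤n (m%n<n (y + 2) 3)) (≤-reflexive (*-comm e 3)) ⟩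
    2 + 3 * e                  ∎)))
  upper : 3 * e + 5 * K ≤ 2 * N + 2
  upper = begin
    3 * e + 5 * K              ≡⟨ cong (_+ 5 * K) (*-comm 3 e) ⟩
    e * 3 + 5 * K              ≤⟨ +-monoˡ-≤ (5 * K) (m/n*n≤m (y + 2) 3) ⟩
    y + 2 + 5 * K              ≡⟨ shuffle y (5 * K) ⟩
    5 * K + y + 2              ≡⟨ cong (_+ 2) 5K+y ⟩
    2 * N + 2                  ∎
    where
    shuffle : ∀ y k → y + 2 + k ≡ k + y + 2
    shuffle = solve-∀

-- Comparison of exponents over the rationals

ι : ℕ → ℚ
ι zero    = 0ℚ
ι (suc k) = 1ℚ ℚ.+ ι k

ι-+ : ∀ a b → ι (a + b) ≡ ι a ℚ.+ ι b
ι-+ zero    b = sym (ℚ.+-identityˡ (ι b))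
ι-+ (suc a) b = trans (cong (1ℚ ℚ.+_) (ι-+ a b)) (sym (ℚ.+-assoc 1ℚ (ι a) (ι b)))

ι-* : ∀ a b → ι (a * b) ≡ ι a ℚ.* ι b
ι-* zero    b = sym (ℚ.*-zeroˡ (ι b))
ι-* (suc a) b = begin
  ι (b + a * b)                     ≡⟨ ι-+ b (a * b) ⟩
  ι b ℚ.+ ι (a * b)                 ≡⟨ cong₂ ℚ._+_ (sym (ℚ.*-identityˡ (ι b))) (ι-* a b) ⟩
  1ℚ ℚ.* ι b ℚ.+ ι a ℚ.* ι b        ≡⟨ ℚ.*-distribʳ-+ (ι b) 1ℚ (ι a) ⟨
  (1ℚ ℚ.+ ι a) ℚ.* ι b              ∎
  where open ≡-Reasoning

ι-nonNeg : ∀ k → ℚ.NonNegative (ι k)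
ι-nonNeg zero    = _
ι-nonNeg (suc k) = ℚ.nonNeg+nonNeg⇒nonNeg 1ℚ (ι k) {{ι-nonNeg k}}

ι-pos : ∀ k → ℚ.Positive (ι (suc k))
ι-pos k = ℚ.pos+nonNeg⇒pos 1ℚ (ι k) {{ι-nonNeg k}}

ι-mono : ∀ {a b} → a ≤ b → ι a ℚ.≤ ι b
ι-mono {b = b} z≤n = ℚ.nonNegative⁻¹ (ι b) {{ι-nonNeg b}}
ι-mono (s≤s a≤b)   = ℚ.+-monoʳ-≤ 1ℚ (ι-mono a≤b)

+-cancelˡ-≤ℚ : ∀ r {p q} → r ℚ.+ p ℚ.≤ r ℚ.+ q → p ℚ.≤ q
+-cancelˡ-≤ℚ r {p} {q} h = subst₂ ℚ._≤_ (cancel r p) (cancel r q) (ℚ.+-monoʳ-≤ (ℚ.- r) h)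
  where
  open ℚ.+-*-Solver
  cancel : ∀ r p → ℚ.- r ℚ.+ (r ℚ.+ p) ≡ p
  cancel = solve 2 (λ r p → :- r :+ (r :+ p) := p) refl

ι-cancel : ∀ {a b} → ι a ℚ.≤ ι b → a ≤ b
ι-cancel {zero}          _ = z≤n
ι-cancel {suc a} {zero}  h = ⊥-elim (ℚ.<-irrefl refl (ℚ.<-≤-trans (ℚ.positive⁻¹ (ι (suc a)) {{ι-pos a}}) h))
ι-cancel {suc a} {suc b} h = s≤s (ι-cancel (+-cancelˡ-≤ℚ 1ℚ h))

toℚᵘ-ι : ∀ k → ℚ.toℚᵘ (ι k) ℚᵘ.≃ ℚᵘ.mkℚᵘ (ℤ.+ k) 0
toℚᵘ-ι zero    = ℚᵘ.≃-refl
toℚᵘ-ι (suc k) = ℚᵘ.≃-trans (ℚ.toℚᵘ-homo-+ 1ℚ (ι k))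
  (ℚᵘ.≃-trans (ℚᵘ.+-congʳ (ℚ.toℚᵘ 1ℚ) (toℚᵘ-ι k)) (ℚᵘ.*≡* (cong (λ z → (ℤ.+ 1 ℤ.+ z) ℤ.* ℤ.+ 1) (ℤ.*-identityʳ (ℤ.+ k)))))

clear-denominator : ∀ r p → ℚ.↥ r ≡ ℤ.+ p → r ℚ.* ι (ℚ.↧ₙ r) ≡ ι p
clear-denominator r@(ℚ.mkℚ _ d _) p refl = ℚ.toℚᵘ-injective (ℚᵘ.≃-trans (ℚ.toℚᵘ-homo-* r (ι (suc d)))
  (ℚᵘ.≃-trans (ℚᵘ.*-congˡ {ℚᵘ.mkℚᵘ (ℤ.+ p) d} (toℚᵘ-ι (suc d)))
    (ℚᵘ.≃-trans (ℚᵘ.*≡* lemma) (ℚᵘ.≃-sym (toℚᵘ-ι p)))))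
  where
  lemma : ℤ.+ p ℤ.* ℤ.+ suc d ℤ.* ℤ.+ 1 ≡ ℤ.+ p ℤ.* ℤ.+ (suc d * 1)
  lemma = trans (ℤ.*-identityʳ _) (cong (λ z → ℤ.+ p ℤ.* ℤ.+ z) (sym (*-identityʳ (suc d))))

^-distribʳ-* : ∀ q a b → (a * b) ^ q ≡ a ^ q * b ^ q
^-distribʳ-* zero    a b = refl
^-distribʳ-* (suc q) a b = trans (cong (a * b *_) (^-distribʳ-* q a b)) ([m*n]*[o*p]≡[m*o]*[n*p] a b (a ^ q) (b ^ q))

-- After raising to the power `q`, only exponents of 2 are compared. `0ℚ ≤ r` keeps `n ^ p` on the
-- right-hand side, where `2 ^ ℓ ≤ n` bounds it from below.
power-bound : ∀ {n ℓ x c A B C} r → 0ℚ ℚ.≤ r → ι x ℚ.≤ r ℚ.* ι ℓ ℚ.+ ι c → 2 ^ ℓ ≤ n →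
  A ≤ B * 2 ^ x → B * 2 ^ c ≤ C → [ A ≤ C · n ^ℚ r ]
power-bound (ℚ.mkℚ (-[1+ p ]) d cop) (ℚ.*≤* ()) _ _ _ _
power-bound {n} {ℓ} {x} {c} {A} {B} {C} r@(ℚ.mkℚ (ℤ.+ p) d cop) _ h 2^ℓ≤n A≤ ≤C = begin
  A ^ q                                 ≤⟨ ^-monoˡ-≤ q A≤ ⟩
  (B * 2 ^ x) ^ q                       ≡⟨ ^-distribʳ-* q B (2 ^ x) ⟩
  B ^ q * (2 ^ x) ^ q                   ≡⟨ cong (B ^ q *_) (^-*-assoc 2 x q) ⟩
  B ^ q * 2 ^ (x * q)                   ≤⟨ *-monoʳ-≤ (B ^ q) (^-monoʳ-≤ 2 exponents) ⟩
  B ^ q * 2 ^ (c * q + ℓ * p)           ≡⟨ cong (B ^ q *_) (^-distribˡ-+-* 2 (c * q) (ℓ * p)) ⟩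
  B ^ q * (2 ^ (c * q) * 2 ^ (ℓ * p))   ≡⟨ *-assoc (B ^ q) (2 ^ (c * q)) (2 ^ (ℓ * p)) ⟨
  B ^ q * 2 ^ (c * q) * 2 ^ (ℓ * p)     ≡⟨ cong₂ (λ y z → B ^ q * y * z) (^-*-assoc 2 c q) (^-*-assoc 2 ℓ p) ⟨
  B ^ q * (2 ^ c) ^ q * (2 ^ ℓ) ^ p     ≡⟨ cong (_* (2 ^ ℓ) ^ p) (^-distribʳ-* q B (2 ^ c)) ⟨
  (B * 2 ^ c) ^ q * (2 ^ ℓ) ^ p         ≤⟨ *-mono-≤ (^-monoˡ-≤ q ≤C) (^-monoˡ-≤ p 2^ℓ≤n) ⟩
  C ^ q * n ^ p                         ∎
  where
  open ≤-Reasoning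
  q = suc d
  scaled : (r ℚ.* ι ℓ ℚ.+ ι c) ℚ.* ι q ≡ ι (c * q + ℓ * p)
  scaled = trans (rearrange r (ι ℓ) (ι c) (ι q)) (trans (cong (λ z → ι c ℚ.* ι q ℚ.+ ι ℓ ℚ.* z) (clear-denominator r p refl))
    (sym (trans (ι-+ (c * q) (ℓ * p)) (cong₂ ℚ._+_ (ι-* c q) (ι-* ℓ p)))))
    where
    open ℚ.+-*-Solver
    rearrange : ∀ r l c q → (r ℚ.* l ℚ.+ c) ℚ.* q ≡ c ℚ.* q ℚ.+ l ℚ.* (r ℚ.* q)
    rearrange = solve 4 (λ r l c q → (r :* l :+ c) :* q := c :* q :+ l :* (r :* q)) refl
  exponents : x * q ≤ c * q + ℓ * p
  exponents = ι-cancel (subst₂ ℚ._≤_ (sym (ι-* x q)) scaled (ℚ.*-monoʳ-≤-nonNeg (ι q) {{ι-nonNeg q}} h))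

∣∣≤⇒≤+ : ∀ {p q e} → ℚ.∣ p ℚ.- q ∣ ℚ.≤ e → p ℚ.≤ q ℚ.+ e
∣∣≤⇒≤+ {p} {q} {e} h = begin
  p                           ≡⟨ split p q ⟩
  q ℚ.+ (p ℚ.- q)             ≤⟨ ℚ.+-monoʳ-≤ q (p≤∣p∣ (p ℚ.- q)) ⟩
  q ℚ.+ ℚ.∣ p ℚ.- q ∣         ≤⟨ ℚ.+-monoʳ-≤ q h ⟩
  q ℚ.+ e                     ∎
  where
  open ℚ.≤-Reasoning
  split : ∀ p q → p ≡ q ℚ.+ (p ℚ.- q)
  split = ℚ.+-*-Solver.solve 2 (λ p q → let open ℚ.+-*-Solver in p := q :+ (p :- q)) refl
  p≤∣p∣ : ∀ p → p ℚ.≤ ℚ.∣ p ∣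
  p≤∣p∣ p with ℚ.≤-total 0ℚ p
  ... | inj₁ 0≤p = ℚ.≤-reflexive (sym (ℚ.0≤p⇒∣p∣≡p 0≤p))
  ... | inj₂ p≤0 = ℚ.≤-trans p≤0 (ℚ.0≤∣p∣ p)

difference-nonNeg : ∀ {p q} → p ℚ.≤ q → 0ℚ ℚ.≤ q ℚ.- p
difference-nonNeg {p} {q} p≤q = subst (ℚ._≤ q ℚ.- p) (ℚ.+-inverseʳ p) (ℚ.+-monoˡ-≤ (ℚ.- p) p≤q)

p≤p+nonNeg : ∀ {p q} → 0ℚ ℚ.≤ q → p ℚ.≤ p ℚ.+ q
p≤p+nonNeg {p} {q} 0≤q = subst (ℚ._≤ p ℚ.+ q) (ℚ.+-identityʳ p) (ℚ.+-monoʳ-≤ p 0≤q)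

-- The integer part of x, cut off below at 0 and above at B.
truncate : ∀ x B → ∃[ K ] K ≤ B × (K ≡ 0 ⊎ ι K ℚ.≤ x) × (K ≡ B ⊎ x ℚ.≤ ι (suc K))
truncate x zero = 0 , z≤n , inj₁ refl , inj₁ refl
truncate x (suc B) with ι (suc B) ℚ.≤? x
... | yes h = suc B , ≤-refl , inj₂ h , inj₁ refl
... | no ¬h with K , K≤B , lower , upper ← truncate x B = K , m≤n⇒m≤1+n K≤B , lower , inj₂ (below upper)
  where
  below : K ≡ B ⊎ x ℚ.≤ ι (suc K) → x ℚ.≤ ι (suc K)
  below (inj₁ refl) = ℚ.<⇒≤ (ℚ.≰⇒> ¬h)
  below (inj₂ h)    = h

-- Rounding the exponents for a real `ε`

module Exponents (ε : ℝ) (0≤ε : fromℚ 0ℚ ≤ʳ ε) (ε≤¼ : ε ≤ʳ fromℚ (ℤ.+ 1 / 4)) where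

  ε⟨_⟩ : ℕ → ℚ
  ε⟨ i ⟩ = approx ε i

  -- K ≈ ε ℓ up to an additive constant, so that 2 ^ K is n ^ ε up to a factor.
  edge-exponent : ∀ ℓ → ∃[ K ] 4 * K ≤ ℓ × ∃[ N ] ∀ i → N ≤ i →
    ι K ℚ.≤ ε⟨ i ⟩ ℚ.* ι ℓ ℚ.+ 1ℚ × ε⟨ i ⟩ ℚ.* ι ℓ ℚ.≤ ι (2 + K)
  edge-exponent ℓ = K , 4K≤ℓ , N₀ ⊔ (N₁ ⊔ N₂) , λ i N≤i →
    let N₀≤i = m⊔n≤o⇒m≤o N₀ (N₁ ⊔ N₂) N≤i
        N₁≤i = m⊔n≤o⇒m≤o N₁ N₂ (m⊔n≤o⇒n≤o N₀ (N₁ ⊔ N₂) N≤i)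
        N₂≤i = m⊔n≤o⇒n≤o N₁ N₂ (m⊔n≤o⇒n≤o N₀ (N₁ ⊔ N₂) N≤i)
    in upper i N₀≤i N₁≤i (proj₁ (proj₂ (proj₂ truncated))) , lower i N₀≤i N₂≤i (proj₂ (proj₂ (proj₂ truncated)))
    where
    open ℚ.≤-Reasoning
    instance
      ℓ>0 : ℚ.Positive (ι (suc ℓ))
      ℓ>0 = ι-pos ℓ
      ℓ≢0 : ℚ.NonZero (ι (suc ℓ))
      ℓ≢0 = ℚ.pos⇒nonZero (ι (suc ℓ))
    -- With precision `1 / (ℓ + 1)` the error in `ε ℓ` is at most 1.
    η : ℚ
    η = ℚ.1/ ι (suc ℓ)
    instance
      η>0 : ℚ.Positive η
      η>0 = ℚ.1/pos⇒pos (ι (suc ℓ))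
      η≥0 : ℚ.NonNegative η
      η≥0 = ℚ.pos⇒nonNeg η
    0<η : 0ℚ ℚ.< η
    0<η = ℚ.positive⁻¹ η
    ηℓ≤1 : η ℚ.* ι ℓ ℚ.≤ 1ℚ
    ηℓ≤1 = ℚ.≤-trans (ℚ.*-monoˡ-≤-nonNeg η (ι-mono (n≤1+n ℓ))) (ℚ.≤-reflexive (ℚ.*-inverseˡ (ι (suc ℓ))))
    N₀ N₁ N₂ : ℕ
    N₀ = proj₁ (cauchy ε η 0<η)
    N₁ = proj₁ (0≤ε η 0<η)
    N₂ = proj₁ (ε≤¼ η 0<η)
    a : ℚ
    a = ε⟨ N₀ ⟩
    -- The approximation `a` may be negative or exceed a quarter; the cut-offs at 0 and `ℓ / 4`
    -- restore the range of `ε` exactly.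
    truncated = truncate (a ℚ.* ι ℓ) (ℓ ℕ./ 4)
    K : ℕ
    K = proj₁ truncated
    4K≤ℓ : 4 * K ≤ ℓ
    4K≤ℓ = ≤-trans (*-monoʳ-≤ 4 (proj₁ (proj₂ truncated))) (≤-trans (≤-reflexive (*-comm 4 (ℓ ℕ./ 4))) (m/n*n≤m ℓ 4))
    scale : ∀ {p q} → p ℚ.≤ q ℚ.+ η → p ℚ.* ι ℓ ℚ.≤ q ℚ.* ι ℓ ℚ.+ 1ℚ
    scale {p} {q} h = begin
      p ℚ.* ι ℓ                        ≤⟨ ℚ.*-monoʳ-≤-nonNeg (ι ℓ) {{ι-nonNeg ℓ}} h ⟩
      (q ℚ.+ η) ℚ.* ι ℓ                ≡⟨ ℚ.*-distribʳ-+ (ι ℓ) q η ⟩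
      q ℚ.* ι ℓ ℚ.+ η ℚ.* ι ℓ          ≤⟨ ℚ.+-monoʳ-≤ (q ℚ.* ι ℓ) ηℓ≤1 ⟩
      q ℚ.* ι ℓ ℚ.+ 1ℚ                 ∎
    upper : ∀ i → N₀ ≤ i → N₁ ≤ i → K ≡ 0 ⊎ ι K ℚ.≤ a ℚ.* ι ℓ → ι K ℚ.≤ ε⟨ i ⟩ ℚ.* ι ℓ ℚ.+ 1ℚ
    upper i N₀≤i N₁≤i (inj₂ h) = ℚ.≤-trans h (scale {a} {ε⟨ i ⟩} (∣∣≤⇒≤+ {a} {ε⟨ i ⟩} (proj₂ (cauchy ε η 0<η) N₀ i ≤-refl N₀≤i)))
    upper i N₀≤i N₁≤i (inj₁ K≡0) = begin
      ι K                              ≡⟨ cong ι K≡0 ⟩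
      0ℚ                               ≡⟨ ℚ.*-zeroˡ (ι ℓ) ⟨
      0ℚ ℚ.* ι ℓ                       ≤⟨ scale {0ℚ} {ε⟨ i ⟩} (proj₂ (0≤ε η 0<η) i N₁≤i) ⟩
      ε⟨ i ⟩ ℚ.* ι ℓ ℚ.+ 1ℚ            ∎
    lower : ∀ i → N₀ ≤ i → N₂ ≤ i → K ≡ ℓ ℕ./ 4 ⊎ a ℚ.* ι ℓ ℚ.≤ ι (suc K) → ε⟨ i ⟩ ℚ.* ι ℓ ℚ.≤ ι (2 + K)
    lower i N₀≤i N₂≤i (inj₂ h) = begin
      ε⟨ i ⟩ ℚ.* ι ℓ                   ≤⟨ scale {ε⟨ i ⟩} {a} (∣∣≤⇒≤+ {ε⟨ i ⟩} {a} (proj₂ (cauchy ε η 0<η) i N₀ N₀≤i ≤-refl)) ⟩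
      a ℚ.* ι ℓ ℚ.+ 1ℚ                 ≤⟨ ℚ.+-monoˡ-≤ 1ℚ h ⟩
      ι (suc K) ℚ.+ 1ℚ                 ≡⟨ ℚ.+-comm (ι (suc K)) 1ℚ ⟩
      ι (2 + K)                        ∎
    lower i N₀≤i N₂≤i (inj₁ K≡) = begin
      ε⟨ i ⟩ ℚ.* ι ℓ                           ≤⟨ scale {ε⟨ i ⟩} {¼} (proj₂ (ε≤¼ η 0<η) i N₂≤i) ⟩
      ¼ ℚ.* ι ℓ ℚ.+ 1ℚ                         ≤⟨ ℚ.+-monoˡ-≤ 1ℚ (ℚ.*-monoˡ-≤-nonNeg ¼ (ι-mono ℓ≤)) ⟩
      ¼ ℚ.* ι (4 * suc K) ℚ.+ 1ℚ               ≡⟨ cong (λ z → ¼ ℚ.* z ℚ.+ 1ℚ) (ι-* 4 (suc K)) ⟩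
      ¼ ℚ.* (ι 4 ℚ.* ι (suc K)) ℚ.+ 1ℚ         ≡⟨ cong (ℚ._+ 1ℚ) (ℚ.*-assoc ¼ (ι 4) (ι (suc K))) ⟨
      1ℚ ℚ.* ι (suc K) ℚ.+ 1ℚ                  ≡⟨ cong (ℚ._+ 1ℚ) (ℚ.*-identityˡ (ι (suc K))) ⟩
      ι (suc K) ℚ.+ 1ℚ                         ≡⟨ ℚ.+-comm (ι (suc K)) 1ℚ ⟩
      ι (2 + K)                                ∎
      where
      ¼ : ℚ
      ¼ = ℤ.+ 1 / 4
      ℓ≤ : ℓ ≤ 4 * suc K
      ℓ≤ = ≤-trans (≤-reflexive (m≡m%n+[m/n]*n ℓ 4)) (≤-trans (+-monoˡ-≤ _ (<⇒≤ (m%n<n ℓ 4)))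
        (≤-reflexive (trans (cong (λ k → 4 + k * 4) (sym K≡)) (*-comm (suc K) 4))))

  edge-bound : ∀ ℓ r → fromℚ 1ℚ +ʳ ε <ʳ fromℚ r →
    0ℚ ℚ.≤ r × ι (ℓ + proj₁ (edge-exponent ℓ)) ℚ.≤ r ℚ.* ι ℓ ℚ.+ ι 1
  edge-bound ℓ r (η , 0<η , N , below) = ℚ.≤-trans 0≤1+ε 1+ε≤r , (begin
    ι (ℓ + K)                                   ≡⟨ ι-+ ℓ K ⟩
    ι ℓ ℚ.+ ι K                                 ≤⟨ ℚ.+-monoʳ-≤ (ι ℓ) (proj₁ (proj₂ (proj₂ (proj₂ (edge-exponent ℓ))) i NK≤i)) ⟩
    ι ℓ ℚ.+ (ε⟨ i ⟩ ℚ.* ι ℓ ℚ.+ 1ℚ)             ≡⟨ rearrange (ι ℓ) ε⟨ i ⟩ ⟩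
    (1ℚ ℚ.+ ε⟨ i ⟩) ℚ.* ι ℓ ℚ.+ 1ℚ              ≤⟨ ℚ.+-monoˡ-≤ 1ℚ (ℚ.*-monoʳ-≤-nonNeg (ι ℓ) {{ι-nonNeg ℓ}} 1+ε≤r) ⟩
    r ℚ.* ι ℓ ℚ.+ 1ℚ                            ∎)
    where
    open ℚ.≤-Reasoning
    K NK N₁ i : ℕ
    K = proj₁ (edge-exponent ℓ)
    NK = proj₁ (proj₂ (proj₂ (edge-exponent ℓ)))
    N₁ = proj₁ (0≤ε 1ℚ (ℚ.positive⁻¹ 1ℚ))
    i = N ⊔ (NK ⊔ N₁)
    NK≤i : NK ≤ i
    NK≤i = ≤-trans (m≤m⊔n NK N₁) (m≤n⊔m N (NK ⊔ N₁))
    1+ε≤r : 1ℚ ℚ.+ ε⟨ i ⟩ ℚ.≤ r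
    1+ε≤r = ℚ.≤-trans (p≤p+nonNeg (ℚ.<⇒≤ 0<η)) (below i (m≤m⊔n N (NK ⊔ N₁)))
    0≤1+ε : 0ℚ ℚ.≤ 1ℚ ℚ.+ ε⟨ i ⟩
    0≤1+ε = ℚ.≤-trans (proj₂ (0≤ε 1ℚ (ℚ.positive⁻¹ 1ℚ)) i (≤-trans (m≤n⊔m NK N₁) (m≤n⊔m N (NK ⊔ N₁))))
      (ℚ.≤-reflexive (ℚ.+-comm ε⟨ i ⟩ 1ℚ))
    rearrange : ∀ l e → l ℚ.+ (e ℚ.* l ℚ.+ 1ℚ) ≡ (1ℚ ℚ.+ e) ℚ.* l ℚ.+ 1ℚ
    rearrange = solve 2 (λ l e → l :+ (e :* l :+ con 1ℚ) := (con 1ℚ :+ e) :* l :+ con 1ℚ) refl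
      where open ℚ.+-*-Solver

  error-bound : ∀ ℓ e r → fromℚ (ℤ.+ 2 / 3) -ʳ (ℤ.+ 5 / 3) ·ʳ ε <ʳ fromℚ r →
    3 * e + 5 * proj₁ (edge-exponent ℓ) ≤ 2 * suc ℓ + 2 →
    0ℚ ℚ.≤ r × ι e ℚ.≤ r ℚ.* ι ℓ ℚ.+ ι 5
  error-bound ℓ e r (η , 0<η , N , below) 3e≤ = ℚ.≤-trans 0≤s s≤r ,
    ℚ.*-cancelˡ-≤-pos (ι 3) {{ι-pos 2}} (+-cancelˡ-≤ℚ (ι 5 ℚ.* ι K) (begin
      ι 5 ℚ.* ι K ℚ.+ ι 3 ℚ.* ι e
        ≡⟨ cong₂ ℚ._+_ (ι-* 5 K) (ι-* 3 e) ⟨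
      ι (5 * K) ℚ.+ ι (3 * e)
        ≡⟨ ι-+ (5 * K) (3 * e) ⟨
      ι (5 * K + 3 * e)
        ≤⟨ ι-mono (≤-trans (≤-reflexive (+-comm (5 * K) (3 * e))) (≤-trans 3e≤ (≤-reflexive (shuffle ℓ)))) ⟩
      ι (2 * ℓ + 4)
        ≡⟨ trans (ι-+ (2 * ℓ) 4) (cong (ℚ._+ ι 4) (ι-* 2 ℓ)) ⟩
      ι 2 ℚ.* ι ℓ ℚ.+ ι 4
        ≤⟨ p≤p+nonNeg slack ⟩
      -- Adding 1 makes the constant `4 + 5 * 2 + 1 = 15` divisible by 3, which gives the additive
      -- `ι 5`.
      ι 2 ℚ.* ι ℓ ℚ.+ ι 4 ℚ.+ (ι 5 ℚ.* (ι (2 + K) ℚ.- ε⟨ i ⟩ ℚ.* ι ℓ) ℚ.+ 1ℚ)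
        ≡⟨ rearrange (ι ℓ) (ι K) ε⟨ i ⟩ ⟩
      ι 5 ℚ.* ι K ℚ.+ ι 3 ℚ.* (s ℚ.* ι ℓ ℚ.+ ι 5)
        ≤⟨ ℚ.+-monoʳ-≤ (ι 5 ℚ.* ι K) (ℚ.*-monoˡ-≤-nonNeg (ι 3) {{ι-nonNeg 3}} (ℚ.+-monoˡ-≤ (ι 5) (ℚ.*-monoʳ-≤-nonNeg (ι ℓ) {{ι-nonNeg ℓ}} s≤r))) ⟩
      ι 5 ℚ.* ι K ℚ.+ ι 3 ℚ.* (r ℚ.* ι ℓ ℚ.+ ι 5) ∎))
    where
    open ℚ.≤-Reasoning
    -- Eventually `ε⟨ i ⟩` is at most `3/8`, and `2/3 - 5/3 * 3/8 = 1/24` is still positive.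
    ⅛ : ℚ
    ⅛ = ℤ.+ 1 / 8
    K NK N₁ i : ℕ
    K = proj₁ (edge-exponent ℓ)
    NK = proj₁ (proj₂ (proj₂ (edge-exponent ℓ)))
    N₁ = proj₁ (ε≤¼ ⅛ (ℚ.positive⁻¹ ⅛))
    i = N ⊔ (NK ⊔ N₁)
    s : ℚ
    s = ℤ.+ 2 / 3 ℚ.+ (ℚ.- 1ℚ) ℚ.* (ℤ.+ 5 / 3 ℚ.* ε⟨ i ⟩)
    s≤r : s ℚ.≤ r
    s≤r = ℚ.≤-trans (p≤p+nonNeg (ℚ.<⇒≤ 0<η)) (below i (m≤m⊔n N (NK ⊔ N₁)))
    slack : 0ℚ ℚ.≤ ι 5 ℚ.* (ι (2 + K) ℚ.- ε⟨ i ⟩ ℚ.* ι ℓ) ℚ.+ 1ℚ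
    slack = ℚ.≤-trans (ℚ.*-monoˡ-≤-nonNeg (ι 5) {{ι-nonNeg 5}} (difference-nonNeg
      (proj₂ (proj₂ (proj₂ (proj₂ (edge-exponent ℓ))) i (≤-trans (m≤m⊔n NK N₁) (m≤n⊔m N (NK ⊔ N₁)))))))
      (p≤p+nonNeg (ℚ.nonNegative⁻¹ 1ℚ))
    0≤s : 0ℚ ℚ.≤ s
    0≤s = begin
      0ℚ                                                                      ≤⟨ ℚ.nonNegative⁻¹ (ℤ.+ 1 / 24) ⟩
      ℤ.+ 1 / 24                                                              ≤⟨ p≤p+nonNeg (ℚ.*-monoˡ-≤-nonNeg (ℤ.+ 5 / 3) (difference-nonNeg
                                                                                   (proj₂ (ε≤¼ ⅛ (ℚ.positive⁻¹ ⅛)) i (≤-trans (m≤n⊔m NK N₁) (m≤n⊔m N (NK ⊔ N₁)))))) ⟩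
      ℤ.+ 1 / 24 ℚ.+ ℤ.+ 5 / 3 ℚ.* (ℤ.+ 1 / 4 ℚ.+ ⅛ ℚ.- ε⟨ i ⟩)               ≡⟨ expand ε⟨ i ⟩ ⟩
      s                                                                       ∎
      where
      expand : ∀ x → ℤ.+ 1 / 24 ℚ.+ ℤ.+ 5 / 3 ℚ.* (ℤ.+ 1 / 4 ℚ.+ ⅛ ℚ.- x) ≡ ℤ.+ 2 / 3 ℚ.+ (ℚ.- 1ℚ) ℚ.* (ℤ.+ 5 / 3 ℚ.* x)
      expand = solve 1 (λ x → con (ℤ.+ 1 / 24) :+ con (ℤ.+ 5 / 3) :* (con (ℤ.+ 1 / 4) :+ con ⅛ :- x) :=
        con (ℤ.+ 2 / 3) :+ con (ℚ.- 1ℚ) :* (con (ℤ.+ 5 / 3) :* x)) refl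
        where open ℚ.+-*-Solver
    shuffle : ∀ ℓ → 2 * suc ℓ + 2 ≡ 2 * ℓ + 4
    shuffle = solve-∀
    rearrange : ∀ l k x → ι 2 ℚ.* l ℚ.+ ι 4 ℚ.+ (ι 5 ℚ.* (1ℚ ℚ.+ (1ℚ ℚ.+ k) ℚ.- x ℚ.* l) ℚ.+ 1ℚ) ≡
      ι 5 ℚ.* k ℚ.+ ι 3 ℚ.* ((ℤ.+ 2 / 3 ℚ.+ (ℚ.- 1ℚ) ℚ.* (ℤ.+ 5 / 3 ℚ.* x)) ℚ.* l ℚ.+ ι 5)
    rearrange = solve 3 (λ l k x → con (ι 2) :* l :+ con (ι 4) :+ (con (ι 5) :* (con 1ℚ :+ (con 1ℚ :+ k) :- x :* l) :+ con 1ℚ) :=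
      con (ι 5) :* k :+ con (ι 3) :* ((con (ℤ.+ 2 / 3) :+ con (ℚ.- 1ℚ) :* (con (ℤ.+ 5 / 3) :* x)) :* l :+ con (ι 5))) refl
      where open ℚ.+-*-Solver

  -- For `n ≥ 2` the logarithm is at least 1, so `2 + ℓ ≤ 3 * ℓ`; hence the starting value 2 in both
  -- asymptotic bounds.
  log-absorbs : ∀ {n} c → 2 ≤ n → c * (2 + ⌊log₂ n ⌋) ≤ 3 * c * ⌊log₂ n ⌋ ^ 1
  log-absorbs {n} c 2≤n = begin
    c * (2 + ℓ)                    ≤⟨ *-monoʳ-≤ c (+-monoˡ-≤ ℓ (*-monoʳ-≤ 2 (⌊log₂⌋-mono-≤ 2≤n))) ⟩
    c * (2 * ℓ + ℓ)                ≡⟨ shuffle c ℓ ⟩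
    3 * c * (ℓ * 1)                ∎
    where
    open ≤-Reasoning
    ℓ = ⌊log₂ n ⌋
    shuffle : ∀ c l → c * (2 * l + l) ≡ 3 * c * (l * 1)
    shuffle = solve-∀

  module _ (n : ℕ) where
    ℓ : ℕ
    ℓ = ⌊log₂ n ⌋

    K : ℕ
    K = proj₁ (edge-exponent ℓ)

    4K≤1+ℓ : 4 * K ≤ suc ℓ
    4K≤1+ℓ = m≤n⇒m≤1+n (proj₁ (proj₂ (edge-exponent ℓ)))

    e : ℕ
    e = proj₁ (error-exponent (suc ℓ) K 4K≤1+ℓ)

    edge-count error-size : ℕ
    edge-count = 37 * ((2 + ℓ) * 2 ^ (suc ℓ + K))
    error-size = 50 * ((2 + ℓ) * 2 ^ e)

    spanner-bound : (G : Graph n) → SpannerBound G edge-count error-size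
    spanner-bound G = Parameters.bound {n} {suc ℓ} {K} {e} G (n<2^[1+⌊log₂n⌋] n) 4K≤1+ℓ
      (proj₁ (proj₂ (error-exponent (suc ℓ) K 4K≤1+ℓ))) (proj₂ (proj₂ (error-exponent (suc ℓ) K 4K≤1+ℓ)))

  edge-count∈Õ : edge-count ∈Õ[n^ fromℚ 1ℚ +ʳ ε ]
  -- `444 = 3 * 37 * 2 * 2`, with one factor 2 from the exponent `suc ℓ` in place of `ℓ` and one
  -- from the rounding of `K`.
  edge-count∈Õ = 444 , 1 , 2 , λ n 1≤n 2≤n r below →
    power-bound {n} {ℓ n} {ℓ n + K n} {1} {edge-count n} {74 * (2 + ℓ n)} r (proj₁ (edge-bound (ℓ n) r below)) (proj₂ (edge-bound (ℓ n) r below)) (2^⌊log₂n⌋≤n n 1≤n)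
      (≤-reflexive (shuffle (2 + ℓ n) (2 ^ (ℓ n + K n)))) (≤-trans (≤-reflexive (shuffle′ (2 + ℓ n))) (log-absorbs 148 2≤n))
    where
    shuffle : ∀ a b → 37 * (a * (2 * b)) ≡ 74 * a * b
    shuffle = solve-∀
    shuffle′ : ∀ a → 74 * a * 2 ≡ 148 * a
    shuffle′ = solve-∀

  error-size∈Õ : error-size ∈Õ[n^ fromℚ (ℤ.+ 2 / 3) -ʳ (ℤ.+ 5 / 3) ·ʳ ε ]
  -- `4800 = 3 * 50 * 2 ^ 5`, where the exponent 5 is the additive term of `error-bound`.
  error-size∈Õ = 4800 , 1 , 2 , λ n 1≤n 2≤n r below →
    let 0≤r , e≤ = error-bound (ℓ n) (e n) r below (proj₂ (proj₂ (error-exponent (suc (ℓ n)) (K n) (4K≤1+ℓ n)))) in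
    power-bound {n} {ℓ n} {e n} {5} {error-size n} {50 * (2 + ℓ n)} r 0≤r e≤ (2^⌊log₂n⌋≤n n 1≤n)
      (≤-reflexive (sym (*-assoc 50 (2 + ℓ n) (2 ^ e n)))) (≤-trans (≤-reflexive (shuffle (2 + ℓ n))) (log-absorbs 1600 2≤n))
    where
    shuffle : ∀ a → 50 * a * 32 ≡ 1600 * a
    shuffle = solve-∀

open import Data.Integer using (+_)

theorem3 : (ε : ℝ) → fromℚ 0ℚ ≤ʳ ε → ε ≤ʳ fromℚ (+ 1 / 4) →
    ∃[ f ] f ∈Õ[n^ fromℚ 1ℚ +ʳ ε ] ×
    ∃[ g ] g ∈Õ[n^ fromℚ (+ 2 / 3) -ʳ (+ 5 / 3) ·ʳ ε ] ×
    (∀ n (G : Graph n) → ∃[ H ] H ⊆ᴳ G × ∣E∣ H ≤ f n ×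
    (∀ u v → (δ G u v ≤⁺ δ H u v) × (δ H u v ≤⁺ δ G u v +⁺ g n)))
theorem3 ε 0≤ε ε≤¼ = edge-count , edge-count∈Õ , error-size , error-size∈Õ ,
  λ n G → additive-spanner G (edge-count n) (error-size n) (spanner-bound n G)
  where open Exponents ε 0≤ε ε≤¼
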